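{- There is an absolute constant $C>0$ such that the following holds. Let $p$ be a prime, let $x,y\in\mathbb{Z}$ with $p\nmid y$, and let $\mathscr{W}$ be any set of integers that are pairwise incongruent modulo $p$. Then \[ \sum_{w\in\mathscr{W}}|S(x,y,w;p)|\leq C\,(\#\mathscr{W})^{3/4}\,p . \]
   Context: For a prime $p$, write $\mathrm{e}_p(t)=\exp(2\pi i t/p)$, and for an integer $m$ not divisible by $p$ let $\overline{m}$ denote the unique integer in $\{1,\ldots,p-1\}$ with $m\overline{m}\equiv 1\pmod p$. For integers $x,y,w$, \[ S(x,y,w;p)=\sum_{\substack{1\leq m<p\\ p\nmid (m+w)}}\mathrm{e}_p\bigl(x\overline{m}+y\,\overline{m+w}\bigr). \] -}

module Defs where

open import Data.Empty using (⊥-elim)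
open import Data.Integer.Base as ℤ using (ℤ; +_; 1ℤ)
import Data.Integer.Properties as ℤ
open import Data.Integer.Divisibility.Signed using (_∣_; _∣?_)
open import Data.List.Base using (List; foldr; map; filter; head; applyUpTo)
open import Data.Maybe.Base using (fromMaybe)
open import Data.Nat.Base as ℕ using (ℕ; zero; suc)
import Data.Nat.Properties as ℕ
import Data.Nat.Solver as ℕ using (module +-*-Solver)
open import Data.Product.Base using (_×_; _,_; ∃-syntax; proj₁; proj₂)
open import Data.Rational
open import Data.Rational.Properties
open import Data.Rational.Solver using (module +-*-Solver)
import Data.Rational.Unnormalised.Base as ℚᵘ
import Data.Rational.Unnormalised.Properties as ℚᵘ
open import Data.Sum.Base using (_⊎_; inj₁; inj₂)
open import Relation.Binary.PropositionalEquality
open import Relation.Nullary using (¬_; yes; no)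
open import Relation.Nullary.Decidable using (¬?)

module ℕSolver = ℕ.+-*-Solver
open ℕSolver using () renaming (_:=_ to _≐_; _:+_ to _⊞_; _:*_ to _⊛_)
open +-*-Solver using (solve; _:=_; _:+_; _:*_; :-_; _:-_; con)

-- Opaque only to keep the type checker from unfolding the gcd computations
-- inside _/_.
opaque
  fromℕ : ℕ → ℚ
  fromℕ n = + n / 1

  1/suc : ℕ → ℚ
  1/suc n = + 1 / suc n

/-mono-≤ : ∀ {a b c d} → a ℕ.* suc d ℕ.≤ c ℕ.* suc b → + a / suc b ≤ + c / suc d
/-mono-≤ {a} {b} {c} {d} h = toℚᵘ-cancel-≤
  (ℚᵘ.≤-respʳ-≃ (ℚᵘ.≃-sym (toℚᵘ-fromℚᵘ (ℚᵘ.mkℚᵘ (+ c) d)))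
  (ℚᵘ.≤-respˡ-≃ (ℚᵘ.≃-sym (toℚᵘ-fromℚᵘ (ℚᵘ.mkℚᵘ (+ a) b)))
  (ℚᵘ.*≤* (subst₂ ℤ._≤_ (ℤ.pos-* a (suc d)) (ℤ.pos-* c (suc b)) (ℤ.+≤+ h)))))

/-cong-ℕ : ∀ {a b c d} → a ℕ.* suc d ≡ c ℕ.* suc b → + a / suc b ≡ + c / suc d
/-cong-ℕ {a} {b} {c} {d} h =
  ≤-antisym (/-mono-≤ {a} {b} {c} {d} (ℕ.≤-reflexive h))
            (/-mono-≤ {c} {d} {a} {b} (ℕ.≤-reflexive (sym h)))

/-*-/ : ∀ a b c d → (+ a / suc b) * (+ c / suc d) ≡ + (a ℕ.* c) / (suc b ℕ.* suc d)
/-*-/ a b c d = toℚᵘ-injective (begin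
  toℚᵘ ((+ a / suc b) * (+ c / suc d))
    ≈⟨ toℚᵘ-homo-* (+ a / suc b) (+ c / suc d) ⟩
  toℚᵘ (+ a / suc b) ℚᵘ.* toℚᵘ (+ c / suc d)
    ≈⟨ ℚᵘ.*-cong (toℚᵘ-fromℚᵘ (ℚᵘ.mkℚᵘ (+ a) b)) (toℚᵘ-fromℚᵘ (ℚᵘ.mkℚᵘ (+ c) d)) ⟩
  ℚᵘ.mkℚᵘ (+ a) b ℚᵘ.* ℚᵘ.mkℚᵘ (+ c) d
    ≡⟨ cong (λ t → ℚᵘ.mkℚᵘ t (d ℕ.+ b ℕ.* suc d)) (sym (ℤ.pos-* a c)) ⟩
  ℚᵘ.mkℚᵘ (+ (a ℕ.* c)) (d ℕ.+ b ℕ.* suc d)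
    ≈⟨ ℚᵘ.≃-sym (toℚᵘ-fromℚᵘ (ℚᵘ.mkℚᵘ (+ (a ℕ.* c)) (d ℕ.+ b ℕ.* suc d))) ⟩
  toℚᵘ (+ (a ℕ.* c) / (suc b ℕ.* suc d)) ∎)
  where open ℚᵘ.≃-Reasoning

opaque
  unfolding fromℕ 1/suc

  fromℕ-mono : ∀ {m n} → m ℕ.≤ n → fromℕ m ≤ fromℕ n
  fromℕ-mono {m} {n} h = /-mono-≤ {m} {0} {n} {0} (ℕ.*-monoˡ-≤ 1 h)

  fromℕ-suc : ∀ n → fromℕ (suc n) ≡ fromℕ n + 1ℚ
  fromℕ-suc n = toℚᵘ-injective (begin
    toℚᵘ (fromℕ (suc n))                 ≈⟨ toℚᵘ-fromℚᵘ (ℚᵘ.mkℚᵘ (+ suc n) 0) ⟩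
    ℚᵘ.mkℚᵘ (+ suc n) 0
      ≡⟨ cong (λ t → ℚᵘ.mkℚᵘ t 0) (cong +_ (sym (trans (cong₂ ℕ._+_ (ℕ.*-identityʳ n) refl) (ℕ.+-comm n 1)))) ⟩
    ℚᵘ.mkℚᵘ (+ (n ℕ.* 1 ℕ.+ 1)) 0        ≡⟨ cong (λ t → ℚᵘ.mkℚᵘ (t ℤ.+ + 1) 0) (ℤ.pos-* n 1) ⟩
    ℚᵘ.mkℚᵘ (+ n) 0 ℚᵘ.+ toℚᵘ 1ℚ
      ≈⟨ ℚᵘ.+-congˡ (toℚᵘ 1ℚ) (ℚᵘ.≃-sym (toℚᵘ-fromℚᵘ (ℚᵘ.mkℚᵘ (+ n) 0))) ⟩
    toℚᵘ (fromℕ n) ℚᵘ.+ toℚᵘ 1ℚ          ≈⟨ ℚᵘ.≃-sym (toℚᵘ-homo-+ (fromℕ n) 1ℚ) ⟩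
    toℚᵘ (fromℕ n + 1ℚ) ∎)
    where open ℚᵘ.≃-Reasoning

  fromℕ-+ : ∀ m n → fromℕ (m ℕ.+ n) ≡ fromℕ m + fromℕ n
  fromℕ-+ zero    n = sym (+-identityˡ (fromℕ n))
  fromℕ-+ (suc m) n = trans (fromℕ-suc (m ℕ.+ n)) (trans (cong (_+ 1ℚ) (fromℕ-+ m n))
    (trans (solve 3 (λ a b c → a :+ b :+ c := a :+ c :+ b) refl (fromℕ m) (fromℕ n) 1ℚ)
           (cong (_+ fromℕ n) (sym (fromℕ-suc m)))))

  fromℕ-* : ∀ m n → fromℕ (m ℕ.* n) ≡ fromℕ m * fromℕ n
  fromℕ-* m n = sym (/-*-/ m 0 n 0)

  1/suc-inverse : ∀ n → fromℕ (suc n) * 1/suc n ≡ 1ℚ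
  1/suc-inverse n = trans (/-*-/ (suc n) 0 1 n)
    (/-cong-ℕ {suc n ℕ.* 1} {n ℕ.+ 0} {1} {0} (begin
      suc n ℕ.* 1 ℕ.* 1      ≡⟨ ℕ.*-identityʳ _ ⟩
      suc n ℕ.* 1            ≡⟨ ℕ.*-comm (suc n) 1 ⟩
      1 ℕ.* suc n            ≡⟨ cong (λ t → 1 ℕ.* suc t) (sym (ℕ.+-identityʳ n)) ⟩
      1 ℕ.* suc (n ℕ.+ 0)    ∎))
    where open ≡-Reasoning

  1/suc-antimono : ∀ {m n} → m ℕ.≤ n → 1/suc n ≤ 1/suc m
  1/suc-antimono {m} {n} h = /-mono-≤ {1} {n} {1} {m} (ℕ.*-monoʳ-≤ 1 (ℕ.s≤s h))

  0≤fromℕ : ∀ n → 0ℚ ≤ fromℕ n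
  0≤fromℕ n = fromℕ-mono {0} {n} ℕ.z≤n

  0≤/ : ∀ a b → 0ℚ ≤ + a / suc b
  0≤/ a b = /-mono-≤ {0} {0} {a} {b} ℕ.z≤n

  0≤1/suc : ∀ n → 0ℚ ≤ 1/suc n
  0≤1/suc n = 0≤/ 1 n

  0<1/suc : ∀ n → 0ℚ < 1/suc n
  0<1/suc n with 0ℚ <? 1/suc n
  ... | yes p = p
  ... | no ¬p = ⊥-elim (1≢0 (trans (sym (1/suc-inverse n))
      (trans (cong (fromℕ (suc n) *_) (≤-antisym (≮⇒≥ ¬p) (0≤1/suc n))) (*-zeroʳ (fromℕ (suc n))))))

  fromℕ-0 : fromℕ 0 ≡ 0ℚ
  fromℕ-0 = refl

  fromℕ-1 : fromℕ 1 ≡ 1ℚ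
  fromℕ-1 = refl

  0<1 : 0ℚ < 1ℚ
  0<1 = *<* (ℤ.+<+ (ℕ.s≤s ℕ.z≤n))

  0<½ : 0ℚ < ½
  0<½ = *<* (ℤ.+<+ (ℕ.s≤s ℕ.z≤n))

  ≤fromℕ : ∀ q → q ≤ fromℕ ℤ.∣ ↥ q ∣
  ≤fromℕ q@(mkℚ a b _) = toℚᵘ-cancel-≤
    (ℚᵘ.≤-respʳ-≃ (ℚᵘ.≃-sym (toℚᵘ-fromℚᵘ (ℚᵘ.mkℚᵘ (+ ℤ.∣ a ∣) 0)))
      (ℚᵘ.*≤* (aux a)))
    where
    aux : ∀ a → a ℤ.* + 1 ℤ.≤ + ℤ.∣ a ∣ ℤ.* + suc b
    aux (+ n) = subst₂ ℤ._≤_ (ℤ.pos-* n 1) (ℤ.pos-* n (suc b))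
      (ℤ.+≤+ (ℕ.*-monoʳ-≤ n (ℕ.s≤s ℕ.z≤n)))
    aux (ℤ.-[1+ n ]) = subst (ℤ.-[1+ n ] ℤ.* + 1 ℤ.≤_) (ℤ.pos-* (suc n) (suc b)) ℤ.-≤+

  1/suc-small : ∀ {ε} → 0ℚ < ε → ∃[ N ] 1/suc N ≤ ε
  1/suc-small {mkℚ (+ zero) b c} (*<* (ℤ.+<+ ()))
  1/suc-small {mkℚ (+ suc a) b c} _ = b , toℚᵘ-cancel-≤
    (ℚᵘ.≤-respˡ-≃ (ℚᵘ.≃-sym (toℚᵘ-fromℚᵘ (ℚᵘ.mkℚᵘ (+ 1) b)))
      (ℚᵘ.*≤* (subst₂ ℤ._≤_ (ℤ.pos-* 1 (suc b)) (ℤ.pos-* (suc a) (suc b))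
        (ℤ.+≤+ (ℕ.*-monoˡ-≤ (suc b) (ℕ.s≤s (ℕ.z≤n {a})))))))
  1/suc-small {mkℚ (ℤ.-[1+ a ]) b c} (*<* ())

0<fromℕ-suc : ∀ n → 0ℚ < fromℕ (suc n)
0<fromℕ-suc n = <-≤-trans (subst (0ℚ <_) (sym fromℕ-1) 0<1) (fromℕ-mono (ℕ.s≤s (ℕ.z≤n {n})))

*-monoˡ : ∀ {r p q} → 0ℚ ≤ r → p ≤ q → r * p ≤ r * q
*-monoˡ {r} 0≤r = *-monoˡ-≤-nonNeg r {{nonNegative 0≤r}}

*-monoʳ : ∀ {r p q} → 0ℚ ≤ r → p ≤ q → p * r ≤ q * r
*-monoʳ {r} 0≤r = *-monoʳ-≤-nonNeg r {{nonNegative 0≤r}}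

*-mono : ∀ {p q r s} → 0ℚ ≤ p → p ≤ q → 0ℚ ≤ s → r ≤ s → p * r ≤ q * s
*-mono 0≤p p≤q 0≤s r≤s = ≤-trans (*-monoˡ 0≤p r≤s) (*-monoʳ 0≤s p≤q)

0≤* : ∀ {p q} → 0ℚ ≤ p → 0ℚ ≤ q → 0ℚ ≤ p * q
0≤* {p} {q} 0≤p 0≤q = subst (_≤ p * q) (*-zeroʳ p) (*-monoˡ 0≤p 0≤q)

0<* : ∀ {p q} → 0ℚ < p → 0ℚ < q → 0ℚ < p * q
0<* {p} {q} 0<p 0<q =
  subst (_< p * q) (*-zeroʳ p) (*-monoʳ-<-pos p {{positive 0<p}} 0<q)

0≤+ : ∀ {p q} → 0ℚ ≤ p → 0ℚ ≤ q → 0ℚ ≤ p + q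
0≤+ 0≤p 0≤q = +-mono-≤ 0≤p 0≤q

p≤p+q : ∀ {p q} → 0ℚ ≤ q → p ≤ p + q
p≤p+q {p} {q} 0≤q = subst (_≤ p + q) (+-identityʳ p) (+-monoʳ-≤ p 0≤q)

p≤q+p : ∀ {p q} → 0ℚ ≤ q → p ≤ q + p
p≤q+p {p} {q} 0≤q = subst (p ≤_) (+-comm p q) (p≤p+q 0≤q)

half : ∀ {ε} → 0ℚ < ε → 0ℚ < ½ * ε
half = 0<* 0<½

half+half : ∀ ε → ½ * ε + ½ * ε ≡ ε
half+half = solve 1 (λ e → con ½ :* e :+ con ½ :* e := e) refl

≤⇒∣∣≤ : ∀ {p q b} → p ≤ q + b → q ≤ p + b → ∣ p - q ∣ ≤ b
≤⇒∣∣≤ {p} {q} {b} h₁ h₂ with ∣p∣≡p∨∣p∣≡-p (p - q)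
... | inj₁ e = subst₂ _≤_ (sym e)
      (solve 2 (λ q b → (q :+ b) :+ :- q := b) refl q b) (+-monoˡ-≤ (- q) h₁)
... | inj₂ e = subst₂ _≤_
      (trans (solve 2 (λ p q → q :+ :- p := :- (p :+ :- q)) refl p q) (sym e))
      (solve 2 (λ p b → (p :+ b) :+ :- p := b) refl p b) (+-monoˡ-≤ (- p) h₂)

p≤∣p∣ : ∀ p → p ≤ ∣ p ∣
p≤∣p∣ p with ≤-total 0ℚ p
... | inj₁ 0≤p = ≤-reflexive (sym (0≤p⇒∣p∣≡p 0≤p))
... | inj₂ p≤0 = ≤-trans p≤0 (0≤∣p∣ p)

∣∣≤⇒≤ : ∀ {p q b} → ∣ p - q ∣ ≤ b → p ≤ q + b
∣∣≤⇒≤ {p} {q} {b} h = subst (_≤ q + b)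
  (solve 2 (λ p q → q :+ (p :+ :- q) := p) refl p q)
  (+-monoʳ-≤ q (≤-trans (p≤∣p∣ (p - q)) h))

∣-∣-sym : ∀ p q → ∣ p - q ∣ ≡ ∣ q - p ∣
∣-∣-sym p q = trans (sym (∣-p∣≡∣p∣ (p - q)))
  (cong ∣_∣ (solve 2 (λ p q → :- (p :+ :- q) := q :+ :- p) refl p q))

∣-∣-triangle : ∀ p q r → ∣ p - r ∣ ≤ ∣ p - q ∣ + ∣ q - r ∣
∣-∣-triangle p q r = subst (λ t → ∣ t ∣ ≤ ∣ p - q ∣ + ∣ q - r ∣)
  (solve 3 (λ p q r → (p :+ :- q) :+ (q :+ :- r) := p :+ :- r) refl p q r)
  (∣p+q∣≤∣p∣+∣q∣ (p - q) (q - r))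

shrink : ∀ B {ε} → 0ℚ < ε → ∃[ δ ] (0ℚ < δ × B * δ ≤ ε)
shrink B {ε} 0<ε = 1/suc n * ε , 0<* (0<1/suc n) 0<ε , (begin
  B * (1/suc n * ε)
    ≤⟨ *-monoʳ (<⇒≤ (0<* (0<1/suc n) 0<ε))
        (≤-trans (≤fromℕ B) (fromℕ-mono (ℕ.n≤1+n n))) ⟩
  fromℕ (suc n) * (1/suc n * ε)   ≡⟨ sym (*-assoc (fromℕ (suc n)) (1/suc n) ε) ⟩
  fromℕ (suc n) * 1/suc n * ε     ≡⟨ cong (_* ε) (1/suc-inverse n) ⟩
  1ℚ * ε                          ≡⟨ *-identityˡ ε ⟩
  ε                               ∎)
  where
  open ≤-Reasoning
  n = ℤ.∣ ↥ B ∣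

1/suc-small′ : ∀ A → 0ℚ ≤ A → ∀ {ε} → 0ℚ < ε → ∃[ N ] A * 1/suc N ≤ ε
1/suc-small′ A 0≤A 0<ε with shrink A 0<ε
... | δ , 0<δ , h with 1/suc-small 0<δ
... | N , h′ = N , ≤-trans (*-monoˡ 0≤A h′) h

Cauchy : (ℕ → ℚ) → Set
Cauchy s = ∀ ε → 0ℚ < ε → ∃[ N ] (∀ m n → N ℕ.≤ m → N ℕ.≤ n → ∣ s m - s n ∣ ≤ ε)

-- Not a quotient: different sequences may represent the same real number. The
-- relations _≤ʳ_ and _<ʳ_ do not depend on the choice of representatives.
record ℝ : Set where
  constructor mkℝ
  field
    seq    : ℕ → ℚ
    cauchy : Cauchy seq

open ℝ public

infix 4 _≤ʳ_ _<ʳ_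
infixl 6 _+ʳ_
infixl 7 _*ʳ_
infix 8 _^¾

_≤ʳ_ : ℝ → ℝ → Set
x ≤ʳ y = ∀ ε → 0ℚ < ε → ∃[ N ] (∀ n → N ℕ.≤ n → seq x n ≤ seq y n + ε)

_<ʳ_ : ℝ → ℝ → Set
x <ʳ y = ∃[ ε ] (0ℚ < ε × ∃[ N ] (∀ n → N ℕ.≤ n → seq x n + ε ≤ seq y n))

fromℚ : ℚ → ℝ
fromℚ q = mkℝ (λ _ → q) λ ε 0<ε → 0 , λ _ _ _ _ →
  subst (_≤ ε) (sym (cong ∣_∣ (+-inverseʳ q))) (<⇒≤ 0<ε)

0ʳ : ℝ
0ʳ = fromℚ 0ℚ

cauchy-+ : ∀ {s t} → Cauchy s → Cauchy t → Cauchy (λ n → s n + t n)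
cauchy-+ {s} {t} cs ct ε 0<ε with cs (½ * ε) (half 0<ε) | ct (½ * ε) (half 0<ε)
... | M , hs | N , ht = M ℕ.⊔ N , λ m n M≤m M≤n → begin
  ∣ (s m + t m) - (s n + t n) ∣
    ≡⟨ cong ∣_∣ (solve 4 (λ a b c d → (a :+ b) :+ :- (c :+ d) := (a :+ :- c) :+ (b :+ :- d))
          refl (s m) (t m) (s n) (t n)) ⟩
  ∣ (s m - s n) + (t m - t n) ∣    ≤⟨ ∣p+q∣≤∣p∣+∣q∣ (s m - s n) (t m - t n) ⟩
  ∣ s m - s n ∣ + ∣ t m - t n ∣
    ≤⟨ +-mono-≤ (hs m n (ℕ.m⊔n≤o⇒m≤o M N M≤m) (ℕ.m⊔n≤o⇒m≤o M N M≤n))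
                (ht m n (ℕ.m⊔n≤o⇒n≤o M N M≤m) (ℕ.m⊔n≤o⇒n≤o M N M≤n)) ⟩
  ½ * ε + ½ * ε                    ≡⟨ half+half ε ⟩
  ε                                ∎
  where open ≤-Reasoning

prefixBound : (ℕ → ℚ) → ℕ → ℚ
prefixBound s zero    = 0ℚ
prefixBound s (suc n) = prefixBound s n + ∣ s n ∣

0≤prefixBound : ∀ s n → 0ℚ ≤ prefixBound s n
0≤prefixBound s zero    = ≤-refl
0≤prefixBound s (suc n) = 0≤+ (0≤prefixBound s n) (0≤∣p∣ (s n))

≤prefixBound : ∀ s {k n} → k ℕ.< n → ∣ s k ∣ ≤ prefixBound s n
≤prefixBound s {k} {suc n} (ℕ.s≤s k≤n) with ℕ.m≤n⇒m<n∨m≡n k≤n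
... | inj₁ k<n  = ≤-trans (≤prefixBound s k<n) (p≤p+q (0≤∣p∣ (s n)))
... | inj₂ refl = p≤q+p (0≤prefixBound s n)

bounded : ∀ {s} → Cauchy s → ∃[ B ] (0ℚ ≤ B × ∀ n → ∣ s n ∣ ≤ B)
bounded {s} cs with cs 1ℚ 0<1
... | N , h = B + (∣ s N ∣ + 1ℚ) , 0≤+ 0≤B 0≤tail , bound
  where
  B = prefixBound s N
  0≤B = 0≤prefixBound s N
  0≤tail : 0ℚ ≤ ∣ s N ∣ + 1ℚ
  0≤tail = 0≤+ (0≤∣p∣ (s N)) (<⇒≤ 0<1)
  bound : ∀ n → ∣ s n ∣ ≤ B + (∣ s N ∣ + 1ℚ)
  bound n with ℕ.≤-<-connex N n
  ... | inj₂ n<N = ≤-trans (≤prefixBound s n<N) (p≤p+q 0≤tail)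
  ... | inj₁ N≤n = ≤-trans (begin
    ∣ s n ∣                     ≡⟨ cong ∣_∣ (solve 2 (λ a b → a := b :+ (a :+ :- b)) refl (s n) (s N)) ⟩
    ∣ s N + (s n - s N) ∣       ≤⟨ ∣p+q∣≤∣p∣+∣q∣ (s N) (s n - s N) ⟩
    ∣ s N ∣ + ∣ s n - s N ∣     ≤⟨ +-monoʳ-≤ ∣ s N ∣ (h n N N≤n ℕ.≤-refl) ⟩
    ∣ s N ∣ + 1ℚ                ∎) (p≤q+p 0≤B)
    where open ≤-Reasoning

cauchy-* : ∀ {s t} → Cauchy s → Cauchy t → Cauchy (λ n → s n * t n)
cauchy-* {s} {t} cs ct ε 0<ε with bounded {s} cs | bounded {t} ct
... | A , 0≤A , hA | B , 0≤B , hB with shrink A (half 0<ε) | shrink B (half 0<ε)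
... | α , 0<α , hα | β , 0<β , hβ with cs β 0<β | ct α 0<α
... | M , hs | N , ht = M ℕ.⊔ N , λ m n M≤m M≤n → begin
  ∣ s m * t m - s n * t n ∣
    ≡⟨ cong ∣_∣ (solve 4 (λ a b c d → a :* b :+ :- (c :* d)
          := a :* (b :+ :- d) :+ d :* (a :+ :- c)) refl (s m) (t m) (s n) (t n)) ⟩
  ∣ s m * (t m - t n) + t n * (s m - s n) ∣
    ≤⟨ ∣p+q∣≤∣p∣+∣q∣ (s m * (t m - t n)) (t n * (s m - s n)) ⟩
  ∣ s m * (t m - t n) ∣ + ∣ t n * (s m - s n) ∣
    ≡⟨ cong₂ _+_ (∣p*q∣≡∣p∣*∣q∣ (s m) (t m - t n)) (∣p*q∣≡∣p∣*∣q∣ (t n) (s m - s n)) ⟩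
  ∣ s m ∣ * ∣ t m - t n ∣ + ∣ t n ∣ * ∣ s m - s n ∣
    ≤⟨ +-mono-≤
        (*-mono (0≤∣p∣ (s m)) (hA m) (<⇒≤ 0<α)
          (ht m n (ℕ.m⊔n≤o⇒n≤o M N M≤m) (ℕ.m⊔n≤o⇒n≤o M N M≤n)))
        (*-mono (0≤∣p∣ (t n)) (hB n) (<⇒≤ 0<β)
          (hs m n (ℕ.m⊔n≤o⇒m≤o M N M≤m) (ℕ.m⊔n≤o⇒m≤o M N M≤n))) ⟩
  A * α + B * β         ≤⟨ +-mono-≤ hα hβ ⟩
  ½ * ε + ½ * ε         ≡⟨ half+half ε ⟩
  ε                     ∎
  where open ≤-Reasoning

cauchy-ordered : ∀ {s} →
  (∀ ε → 0ℚ < ε → ∃[ N ] (∀ m n → N ℕ.≤ n → n ℕ.≤ m → ∣ s m - s n ∣ ≤ ε)) → Cauchy s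
cauchy-ordered {s} h ε 0<ε with h ε 0<ε
... | N , g = N , λ m n N≤m N≤n → go m n N≤m N≤n (ℕ.≤-total n m)
  where
  go : ∀ m n → N ℕ.≤ m → N ℕ.≤ n → n ℕ.≤ m ⊎ m ℕ.≤ n → ∣ s m - s n ∣ ≤ ε
  go m n N≤m N≤n (inj₁ n≤m) = g m n N≤n n≤m
  go m n N≤m N≤n (inj₂ m≤n) = subst (_≤ ε) (∣-∣-sym (s n) (s m)) (g n m N≤m m≤n)

_+ʳ_ : ℝ → ℝ → ℝ
x +ʳ y = mkℝ (λ n → seq x n + seq y n) (cauchy-+ {seq x} {seq y} (cauchy x) (cauchy y))

_*ʳ_ : ℝ → ℝ → ℝ
x *ʳ y = mkℝ (λ n → seq x n * seq y n) (cauchy-* {seq x} {seq y} (cauchy x) (cauchy y))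

-- The largest j ≤ f with j² ≤ q (and 0 if there is none).
largest : ℚ → ℕ → ℕ
largest q zero    = 0
largest q (suc j) with fromℕ (suc j) * fromℕ (suc j) ≤? q
... | yes _ = suc j
... | no _  = largest q j

-- For q ≥ 0 this is the largest multiple of 1/(n+1) whose square is ≤ q, the
-- search being cut off at the numerator of q(n+1)², which is large enough; it
-- is 0 for q < 0.
approx√ : ℕ → ℚ → ℚ
approx√ n q = fromℕ (largest q′ ℤ.∣ ↥ q′ ∣) * 1/suc n
  where q′ = q * (fromℕ (suc n) * fromℕ (suc n))

largest-lower : ∀ q f → largest q f ≡ 0 ⊎ fromℕ (largest q f) * fromℕ (largest q f) ≤ q
largest-lower q zero = inj₁ refl
largest-lower q (suc j) with fromℕ (suc j) * fromℕ (suc j) ≤? q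
... | yes p = inj₂ p
... | no _  = largest-lower q j

largest-upper : ∀ q f → q < fromℕ (suc f) * fromℕ (suc f) →
  q < fromℕ (suc (largest q f)) * fromℕ (suc (largest q f))
largest-upper q zero h = h
largest-upper q (suc j) h with fromℕ (suc j) * fromℕ (suc j) ≤? q
... | yes _ = h
... | no ¬p = largest-upper q j (≰⇒> ¬p)

square-mono : ∀ {p q} → 0ℚ ≤ p → p ≤ q → p * p ≤ q * q
square-mono 0≤p p≤q = *-mono 0≤p p≤q (≤-trans 0≤p p≤q) p≤q

module Approx√ (n : ℕ) (q : ℚ) where
  N² = fromℕ (suc n) * fromℕ (suc n)
  q′ = q * N²
  f  = ℤ.∣ ↥ q′ ∣
  g  = largest q′ f
  r  = approx√ n q
  η  = 1/suc n

  0<N² : 0ℚ < N²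
  0<N² = 0<* 0<N 0<N
    where
    0<N : 0ℚ < fromℕ (suc n)
    0<N = 0<fromℕ-suc n

  0≤r : 0ℚ ≤ r
  0≤r = 0≤* (0≤fromℕ g) (0≤1/suc n)

  rescale : ∀ a → (a * η) * (a * η) * N² ≡ a * a
  rescale a = begin
    (a * η) * (a * η) * N²
      ≡⟨ solve 3 (λ a e m → (a :* e) :* (a :* e) :* (m :* m) := a :* a :* ((m :* e) :* (m :* e)))
           refl a η (fromℕ (suc n)) ⟩
    a * a * ((fromℕ (suc n) * η) * (fromℕ (suc n) * η))
      ≡⟨ cong (λ t → a * a * (t * t)) (1/suc-inverse n) ⟩
    a * a * (1ℚ * 1ℚ)   ≡⟨ *-identityʳ (a * a) ⟩
    a * a               ∎
    where open ≡-Reasoning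

  lower : r ≡ 0ℚ ⊎ r * r ≤ q
  lower with largest-lower q′ f
  ... | inj₁ e = inj₁ (trans (cong (λ k → fromℕ k * η) e) (trans (cong (_* η) fromℕ-0) (*-zeroˡ η)))
  ... | inj₂ h = inj₂ (*-cancelʳ-≤-pos N² {{positive 0<N²}}
                   (subst (_≤ q′) (sym (rescale (fromℕ g))) h))

  upper : q < (r + η) * (r + η)
  upper = *-cancelʳ-<-nonNeg N² {{nonNegative (<⇒≤ 0<N²)}}
    (subst (q′ <_) (trans (sym (rescale (fromℕ (suc g)))) (cong (λ t → t * t * N²) e))
      (largest-upper q′ f start))
    where
    e : fromℕ (suc g) * η ≡ r + η
    e = trans (cong (_* η) (fromℕ-suc g))
          (solve 2 (λ a b → (a :+ con 1ℚ) :* b := a :* b :+ b) refl (fromℕ g) η)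
    start : q′ < fromℕ (suc f) * fromℕ (suc f)
    start = ≤-<-trans (≤fromℕ q′) (<-≤-trans
      (subst₂ _<_ (+-identityʳ (fromℕ f)) (sym (fromℕ-suc f)) (+-monoʳ-< (fromℕ f) 0<1))
      (subst (fromℕ (suc f) ≤_) (fromℕ-* (suc f) (suc f))
        (fromℕ-mono (ℕ.m≤m*n (suc f) (suc f)))))

cauchy-√ : ∀ {s} → Cauchy s → Cauchy (λ n → approx√ n (s n))
cauchy-√ {s} cs ε 0<ε with 1/suc-small (half 0<ε) | cs (½ * ε * (½ * ε)) (0<* (half 0<ε) (half 0<ε))
... | M , hM | N , hN = M ℕ.⊔ N , λ m n hm hn → ≤⇒∣∣≤ (claim m n hm hn) (claim n m hn hm)
  where
  open ≤-Reasoning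
  claim : ∀ m n → M ℕ.⊔ N ℕ.≤ m → M ℕ.⊔ N ℕ.≤ n → approx√ m (s m) ≤ approx√ n (s n) + ε
  claim m n hm hn with approx√ m (s m) ≤? approx√ n (s n) + ε
  ... | yes p = p
  ... | no ¬p with Approx√.lower m (s m)
  ...   | inj₁ e = ≤-trans (≤-reflexive e) (0≤+ (Approx√.0≤r n (s n)) (<⇒≤ 0<ε))
  ...   | inj₂ h = ⊥-elim (<-irrefl refl (begin-strict
    (r + ε) * (r + ε)
      ≤⟨ square-mono (0≤+ 0≤r (<⇒≤ 0<ε)) (<⇒≤ (≰⇒> ¬p)) ⟩
    approx√ m (s m) * approx√ m (s m)               ≤⟨ h ⟩
    s m
      ≤⟨ ∣∣≤⇒≤ (hN m n (ℕ.m⊔n≤o⇒n≤o M N hm) (ℕ.m⊔n≤o⇒n≤o M N hn)) ⟩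
    s n + ½ * ε * (½ * ε)
      <⟨ +-monoˡ-< (½ * ε * (½ * ε)) (Approx√.upper n (s n)) ⟩
    (r + 1/suc n) * (r + 1/suc n) + ½ * ε * (½ * ε)
      ≤⟨ +-monoˡ-≤ (½ * ε * (½ * ε))
           (square-mono (0≤+ 0≤r (0≤1/suc n))
             (+-monoʳ-≤ r (≤-trans (1/suc-antimono (ℕ.m⊔n≤o⇒m≤o M N hn)) hM))) ⟩
    (r + ½ * ε) * (r + ½ * ε) + ½ * ε * (½ * ε)
      ≤⟨ p≤p+q (0≤+ (0≤* 0≤r (<⇒≤ 0<ε)) (0≤* (<⇒≤ 0<ε) (<⇒≤ (half 0<ε)))) ⟩
    (r + ½ * ε) * (r + ½ * ε) + ½ * ε * (½ * ε) + (r * ε + ε * (½ * ε))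
      ≡⟨ solve 2 (λ r e → (r :+ con ½ :* e) :* (r :+ con ½ :* e) :+ con ½ :* e :* (con ½ :* e)
                    :+ (r :* e :+ e :* (con ½ :* e)) := (r :+ e) :* (r :+ e)) refl r ε ⟩
    (r + ε) * (r + ε) ∎))
    where
    r = approx√ n (s n)
    0≤r = Approx√.0≤r n (s n)

-- For x ≥ 0 the nonnegative square root; the part of x below 0 is cut off.
√ : ℝ → ℝ
√ x = mkℝ (λ n → approx√ n (seq x n)) (cauchy-√ {seq x} (cauchy x))

-- n ^ (3/4), as the fourth root of n ^ 3.
_^¾ : ℕ → ℝ
n ^¾ = √ (√ (fromℚ (fromℕ (n ℕ.^ 3))))

Σ< : ℕ → (ℕ → ℚ) → ℚ
Σ< zero    f = 0ℚ
Σ< (suc n) f = Σ< n f + f n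

Σ<-mono : ∀ {f g} n → (∀ k → k ℕ.< n → f k ≤ g k) → Σ< n f ≤ Σ< n g
Σ<-mono zero    h = ≤-refl
Σ<-mono (suc n) h = +-mono-≤ (Σ<-mono n (λ k k<n → h k (ℕ.m<n⇒m<1+n k<n))) (h n ℕ.≤-refl)

Σ<-const : ∀ n c → Σ< n (λ _ → c) ≡ fromℕ n * c
Σ<-const zero    c = sym (trans (cong (_* c) fromℕ-0) (*-zeroˡ c))
Σ<-const (suc n) c = trans (cong (_+ c) (Σ<-const n c))
  (trans (solve 2 (λ a c → a :* c :+ c := (a :+ con 1ℚ) :* c) refl (fromℕ n) c)
         (cong (_* c) (sym (fromℕ-suc n))))

Σ<-split : ∀ m n f → Σ< (m ℕ.+ n) f ≡ Σ< m f + Σ< n (λ k → f (m ℕ.+ k))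
Σ<-split m zero    f = trans (cong (λ t → Σ< t f) (ℕ.+-identityʳ m)) (sym (+-identityʳ (Σ< m f)))
Σ<-split m (suc n) f = trans (cong (λ t → Σ< t f) (ℕ.+-suc m n))
  (trans (cong (_+ f (m ℕ.+ n)) (Σ<-split m n f))
         (+-assoc (Σ< m f) (Σ< n (λ k → f (m ℕ.+ k))) (f (m ℕ.+ n))))

Σ<-blocks : ∀ n m f → Σ< (n ℕ.* m) f ≡ Σ< n (λ k → Σ< m (λ i → f (k ℕ.* m ℕ.+ i)))
Σ<-blocks zero    m f = refl
Σ<-blocks (suc n) m f = trans (cong (λ t → Σ< t f) (ℕ.+-comm m (n ℕ.* m)))
  (trans (Σ<-split (n ℕ.* m) m f)
         (cong (_+ Σ< m (λ i → f (n ℕ.* m ℕ.+ i))) (Σ<-blocks n m f)))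

Σ<-shift : ∀ n f → Σ< n f + f n ≡ f 0 + Σ< n (λ k → f (suc k))
Σ<-shift n f = trans (Σ<-split 1 n f)
  (cong (_+ Σ< n (λ k → f (suc k))) (+-identityˡ (f 0)))

record ℚ[i] : Set where
  constructor _+i_
  field
    reℚ imℚ : ℚ

open ℚ[i] public

infix 5 _+i_
infixl 6 _⊕_ _⊖_
infixl 7 _⊗_ _·_

_⊕_ _⊖_ _⊗_ : ℚ[i] → ℚ[i] → ℚ[i]
(a +i b) ⊕ (c +i d) = (a + c) +i (b + d)
(a +i b) ⊖ (c +i d) = (a - c) +i (b - d)
(a +i b) ⊗ (c +i d) = (a * c - b * d) +i (a * d + b * c)

_·_ : ℚ → ℚ[i] → ℚ[i]
q · (a +i b) = (q * a) +i (q * b)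

-- z ^ k / k !
expTerm : ℚ[i] → ℕ → ℚ[i]
expTerm z zero    = 1ℚ +i 0ℚ
expTerm z (suc k) = 1/suc k · (z ⊗ expTerm z k)

-- The sum of the terms with index ≤ n.
expSum : ℕ → ℚ[i] → ℚ[i]
expSum zero    z = expTerm z 0
expSum (suc n) z = expSum n z ⊕ expTerm z (suc n)

‖_‖ : ℚ[i] → ℚ
‖ a +i b ‖ = ∣ a ∣ + ∣ b ∣

0≤‖_‖ : ∀ z → 0ℚ ≤ ‖ z ‖
0≤‖ a +i b ‖ = 0≤+ (0≤∣p∣ a) (0≤∣p∣ b)

‖⊕‖ : ∀ u v → ‖ u ⊕ v ‖ ≤ ‖ u ‖ + ‖ v ‖
‖⊕‖ (a +i b) (c +i d) = ≤-trans (+-mono-≤ (∣p+q∣≤∣p∣+∣q∣ a c) (∣p+q∣≤∣p∣+∣q∣ b d))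
  (≤-reflexive (solve 4 (λ a b c d → (a :+ c) :+ (b :+ d) := (a :+ b) :+ (c :+ d)) refl
    (∣ a ∣) (∣ b ∣) (∣ c ∣) (∣ d ∣)))

‖⊗‖ : ∀ u v → ‖ u ⊗ v ‖ ≤ ‖ u ‖ * ‖ v ‖
‖⊗‖ (a +i b) (c +i d) = begin
  ∣ a * c - b * d ∣ + ∣ a * d + b * c ∣
    ≤⟨ +-mono-≤ (∣p-q∣≤∣p∣+∣q∣ (a * c) (b * d)) (∣p+q∣≤∣p∣+∣q∣ (a * d) (b * c)) ⟩
  (∣ a * c ∣ + ∣ b * d ∣) + (∣ a * d ∣ + ∣ b * c ∣)
    ≡⟨ cong₂ _+_ (cong₂ _+_ (∣p*q∣≡∣p∣*∣q∣ a c) (∣p*q∣≡∣p∣*∣q∣ b d))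
                 (cong₂ _+_ (∣p*q∣≡∣p∣*∣q∣ a d) (∣p*q∣≡∣p∣*∣q∣ b c)) ⟩
  (∣ a ∣ * ∣ c ∣ + ∣ b ∣ * ∣ d ∣) + (∣ a ∣ * ∣ d ∣ + ∣ b ∣ * ∣ c ∣)
    ≡⟨ solve 4 (λ a b c d → (a :* c :+ b :* d) :+ (a :* d :+ b :* c) := (a :+ b) :* (c :+ d))
         refl (∣ a ∣) (∣ b ∣) (∣ c ∣) (∣ d ∣) ⟩
  (∣ a ∣ + ∣ b ∣) * (∣ c ∣ + ∣ d ∣) ∎
  where open ≤-Reasoning

‖·‖ : ∀ {q} → 0ℚ ≤ q → ∀ u → ‖ q · u ‖ ≡ q * ‖ u ‖
‖·‖ {q} 0≤q (a +i b) = trans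
  (cong₂ _+_ (trans (∣p*q∣≡∣p∣*∣q∣ q a) (cong (_* ∣ a ∣) (0≤p⇒∣p∣≡p 0≤q)))
             (trans (∣p*q∣≡∣p∣*∣q∣ q b) (cong (_* ∣ b ∣) (0≤p⇒∣p∣≡p 0≤q))))
  (sym (*-distribˡ-+ q (∣ a ∣) (∣ b ∣)))

⊖-telescope : ∀ u v w → u ⊖ w ≡ (u ⊖ v) ⊕ (v ⊖ w)
⊖-telescope (a +i b) (c +i d) (e +i f) = cong₂ _+i_ (eq a c e) (eq b d f)
  where
  eq : ∀ a c e → a - e ≡ (a - c) + (c - e)
  eq = solve 3 (λ a c e → a :- e := (a :- c) :+ (c :- e)) refl

⊕-⊖-comm : ∀ u v w x → (u ⊕ v) ⊖ (w ⊕ x) ≡ (u ⊖ w) ⊕ (v ⊖ x)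
⊕-⊖-comm (a +i b) (c +i d) (e +i f) (g +i h) = cong₂ _+i_ (eq a c e g) (eq b d f h)
  where
  eq : ∀ a c e g → (a + c) - (e + g) ≡ (a - e) + (c - g)
  eq = solve 4 (λ a c e g → (a :+ c) :- (e :+ g) := (a :- e) :+ (c :- g)) refl

⊕-⊖-assoc : ∀ u v w → (u ⊕ v) ⊖ w ≡ (u ⊖ w) ⊕ v
⊕-⊖-assoc (a +i b) (c +i d) (e +i f) = cong₂ _+i_ (eq a c e) (eq b d f)
  where
  eq : ∀ a c e → (a + c) - e ≡ (a - e) + c
  eq = solve 3 (λ a c e → (a :+ c) :- e := (a :- e) :+ c) refl

‖u⊖u‖ : ∀ u → ‖ u ⊖ u ‖ ≡ 0ℚ
‖u⊖u‖ (a +i b) =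
  trans (cong (λ s → ∣ s ∣ + ∣ b - b ∣) (+-inverseʳ a)) (cong (λ t → ∣ 0ℚ ∣ + ∣ t ∣) {b - b} {0ℚ} (+-inverseʳ b))

·⊗-difference : ∀ q z w u v →
  (q · (z ⊗ u)) ⊖ (q · (w ⊗ v)) ≡ q · ((z ⊗ (u ⊖ v)) ⊕ ((z ⊖ w) ⊗ v))
·⊗-difference q (a +i b) (c +i d) (e +i f) (g +i h) = cong₂ _+i_
  (solve 9 (λ q a b c d e f g h →
     q :* (a :* e :- b :* f) :- q :* (c :* g :- d :* h)
     := q :* ((a :* (e :- g) :- b :* (f :- h)) :+ ((a :- c) :* g :- (b :- d) :* h)))
     refl q a b c d e f g h)
  (solve 9 (λ q a b c d e f g h →
     q :* (a :* f :+ b :* e) :- q :* (c :* h :+ d :* g)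
     := q :* ((a :* (f :- h) :+ b :* (e :- g)) :+ ((a :- c) :* h :+ (b :- d) :* g)))
     refl q a b c d e f g h)

+-cancel-≤ : ∀ {a b} c → a + c ≤ c + b → a ≤ b
+-cancel-≤ {a} {b} c h = subst₂ _≤_
  (solve 2 (λ a c → :- c :+ (a :+ c) := a) refl a c)
  (solve 2 (λ b c → :- c :+ (c :+ b) := b) refl b c)
  (+-monoʳ-≤ (- c) h)

module ExpBound (B : ℕ) where
  open ≤-Reasoning

  b = fromℕ B
  K = B ℕ.+ B

  T : ℕ → ℚ
  T zero    = 1ℚ
  T (suc k) = 1/suc k * (b * T k)

  0≤T : ∀ k → 0ℚ ≤ T k
  0≤T zero    = <⇒≤ 0<1
  0≤T (suc k) = 0≤* (0≤1/suc k) (0≤* (0≤fromℕ B) (0≤T k))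

  P : ℕ → ℚ
  P n = Σ< n T

  ‖expTerm‖ : ∀ {z} → ‖ z ‖ ≤ b → ∀ k → ‖ expTerm z k ‖ ≤ T k
  ‖expTerm‖ h zero = ≤-refl
  ‖expTerm‖ {z} h (suc k) = begin
    ‖ 1/suc k · (z ⊗ expTerm z k) ‖   ≡⟨ ‖·‖ (0≤1/suc k) (z ⊗ expTerm z k) ⟩
    1/suc k * ‖ z ⊗ expTerm z k ‖
      ≤⟨ *-monoˡ (0≤1/suc k) (≤-trans (‖⊗‖ z (expTerm z k))
           (*-mono (0≤‖ z ‖) h (0≤T k) (‖expTerm‖ h k))) ⟩
    1/suc k * (b * T k) ∎

  T⁻ : ℕ → ℚ
  T⁻ zero    = 0ℚ
  T⁻ (suc k) = T k

  0≤T⁻ : ∀ k → 0ℚ ≤ T⁻ k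
  0≤T⁻ zero    = ≤-refl
  0≤T⁻ (suc k) = 0≤T k

  b*T⁻ : ∀ k → b * T⁻ k ≡ fromℕ k * T k
  b*T⁻ zero    = trans (*-zeroʳ b) (sym (trans (cong (_* 1ℚ) fromℕ-0) (*-zeroˡ 1ℚ)))
  b*T⁻ (suc k) = sym (begin-equality
    fromℕ (suc k) * (1/suc k * (b * T k))  ≡⟨ sym (*-assoc (fromℕ (suc k)) (1/suc k) (b * T k)) ⟩
    fromℕ (suc k) * 1/suc k * (b * T k)    ≡⟨ cong (_* (b * T k)) (1/suc-inverse k) ⟩
    1ℚ * (b * T k)                         ≡⟨ *-identityˡ (b * T k) ⟩
    b * T k                                ∎)

  ‖expTerm-difference‖ : ∀ {z w} → ‖ z ‖ ≤ b → ‖ w ‖ ≤ b → ∀ k →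
    ‖ expTerm z k ⊖ expTerm w k ‖ ≤ ‖ z ⊖ w ‖ * T⁻ k
  ‖expTerm-difference‖ {z} {w} hz hw zero = ≤-reflexive (sym (*-zeroʳ (‖ z ⊖ w ‖)))
  ‖expTerm-difference‖ {z} {w} hz hw (suc k) = begin
    ‖ expTerm z (suc k) ⊖ expTerm w (suc k) ‖
      ≡⟨ cong ‖_‖ (·⊗-difference (1/suc k) z w u v) ⟩
    ‖ 1/suc k · ((z ⊗ (u ⊖ v)) ⊕ ((z ⊖ w) ⊗ v)) ‖
      ≡⟨ ‖·‖ (0≤1/suc k) ((z ⊗ (u ⊖ v)) ⊕ ((z ⊖ w) ⊗ v)) ⟩
    1/suc k * ‖ (z ⊗ (u ⊖ v)) ⊕ ((z ⊖ w) ⊗ v) ‖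
      ≤⟨ *-monoˡ (0≤1/suc k) (≤-trans (‖⊕‖ (z ⊗ (u ⊖ v)) ((z ⊖ w) ⊗ v)) (+-mono-≤
           (≤-trans (‖⊗‖ z (u ⊖ v)) (*-mono (0≤‖ z ‖) hz (0≤* (0≤‖ z ⊖ w ‖) (0≤T⁻ k))
             (‖expTerm-difference‖ {z} {w} hz hw k)))
           (≤-trans (‖⊗‖ (z ⊖ w) v) (*-monoˡ (0≤‖ z ⊖ w ‖) (‖expTerm‖ {w} hw k))))) ⟩
    1/suc k * (b * (D * T⁻ k) + D * T k)
      ≡⟨ solve 5 (λ q b D s t → q :* (b :* (D :* s) :+ D :* t) := D :* (q :* (b :* s :+ t)))
           refl (1/suc k) b D (T⁻ k) (T k) ⟩
    D * (1/suc k * (b * T⁻ k + T k))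
      ≡⟨ cong (λ s → D * (1/suc k * (s + T k))) (b*T⁻ k) ⟩
    D * (1/suc k * (fromℕ k * T k + T k))
      ≡⟨ solve 4 (λ D q n t → D :* (q :* (n :* t :+ t)) := D :* (((n :+ con 1ℚ) :* q) :* t))
           refl D (1/suc k) (fromℕ k) (T k) ⟩
    D * ((fromℕ k + 1ℚ) * 1/suc k * T k)
      ≡⟨ cong (λ s → D * (s * 1/suc k * T k)) (sym (fromℕ-suc k)) ⟩
    D * (fromℕ (suc k) * 1/suc k * T k)
      ≡⟨ cong (λ s → D * (s * T k)) (1/suc-inverse k) ⟩
    D * (1ℚ * T k)    ≡⟨ cong (D *_) (*-identityˡ (T k)) ⟩
    D * T k           ∎
    where
    u = expTerm z k
    v = expTerm w k
    D = ‖ z ⊖ w ‖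

  ‖expSum-difference‖ : ∀ {z w} → ‖ z ‖ ≤ b → ‖ w ‖ ≤ b → ∀ n →
    ‖ expSum n z ⊖ expSum n w ‖ ≤ ‖ z ⊖ w ‖ * P n
  ‖expSum-difference‖ {z} {w} hz hw zero = ≤-reflexive (sym (*-zeroʳ (‖ z ⊖ w ‖)))
  ‖expSum-difference‖ {z} {w} hz hw (suc n) = begin
    ‖ expSum (suc n) z ⊖ expSum (suc n) w ‖
      ≡⟨ cong ‖_‖ (⊕-⊖-comm (expSum n z) z′ (expSum n w) w′) ⟩
    ‖ (expSum n z ⊖ expSum n w) ⊕ (z′ ⊖ w′) ‖
      ≤⟨ ‖⊕‖ (expSum n z ⊖ expSum n w) (z′ ⊖ w′) ⟩
    ‖ expSum n z ⊖ expSum n w ‖ + ‖ z′ ⊖ w′ ‖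
      ≤⟨ +-mono-≤ (‖expSum-difference‖ {z} {w} hz hw n)
                  (‖expTerm-difference‖ {z} {w} hz hw (suc n)) ⟩
    D * P n + D * T n   ≡⟨ sym (*-distribˡ-+ D (P n) (T n)) ⟩
    D * P (suc n)       ∎
    where
    z′ = expTerm z (suc n)
    w′ = expTerm w (suc n)
    D  = ‖ z ⊖ w ‖

  ‖expSum-tail‖ : ∀ {z} → ‖ z ‖ ≤ b → ∀ n d →
    ‖ expSum (d ℕ.+ n) z ⊖ expSum n z ‖ + P (suc n) ≤ P (suc (d ℕ.+ n))
  ‖expSum-tail‖ {z} hz n zero = ≤-reflexive
    (trans (cong (_+ P (suc n)) (‖u⊖u‖ (expSum n z))) (+-identityˡ (P (suc n))))
  ‖expSum-tail‖ {z} hz n (suc d) = begin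
    ‖ (u ⊕ t) ⊖ v ‖ + P (suc n)         ≡⟨ cong (λ s → ‖ s ‖ + P (suc n)) (⊕-⊖-assoc u t v) ⟩
    ‖ (u ⊖ v) ⊕ t ‖ + P (suc n)
      ≤⟨ +-monoˡ-≤ (P (suc n)) (≤-trans (‖⊕‖ (u ⊖ v) t)
           (+-monoʳ-≤ (‖ u ⊖ v ‖) (‖expTerm‖ {z} hz (suc m)))) ⟩
    ‖ u ⊖ v ‖ + T (suc m) + P (suc n)
      ≡⟨ solve 3 (λ a b c → a :+ b :+ c := a :+ c :+ b) refl (‖ u ⊖ v ‖) (T (suc m)) (P (suc n)) ⟩
    ‖ u ⊖ v ‖ + P (suc n) + T (suc m)
      ≤⟨ +-monoˡ-≤ (T (suc m)) (‖expSum-tail‖ {z} hz n d) ⟩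
    P (suc m) + T (suc m) ∎
    where
    m = d ℕ.+ n
    u = expSum m z
    v = expSum n z
    t = expTerm z (suc m)

  T-halves : ∀ {k} → K ℕ.≤ k → T (suc k) ≤ ½ * T k
  T-halves {k} K≤k = begin
    1/suc k * (b * T k)
      ≡⟨ solve 3 (λ q b t → q :* (b :* t) := con ½ :* ((b :+ b) :* q) :* t) refl (1/suc k) b (T k) ⟩
    ½ * ((b + b) * 1/suc k) * T k
      ≤⟨ *-monoʳ (0≤T k) (*-monoˡ (<⇒≤ 0<½) (*-monoʳ (0≤1/suc k) b+b≤)) ⟩
    ½ * (fromℕ (suc k) * 1/suc k) * T k  ≡⟨ cong (λ s → ½ * s * T k) (1/suc-inverse k) ⟩
    ½ * 1ℚ * T k                         ≡⟨ cong (_* T k) (*-identityʳ ½) ⟩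
    ½ * T k                              ∎
    where
    b+b≤ : b + b ≤ fromℕ (suc k)
    b+b≤ = subst (_≤ fromℕ (suc k)) (fromℕ-+ B B) (fromℕ-mono (ℕ.m≤n⇒m≤1+n K≤k))

  T-antitone : ∀ {n} d → K ℕ.≤ n → T (d ℕ.+ n) ≤ T n
  T-antitone zero K≤n = ≤-refl
  T-antitone {n} (suc d) K≤n = begin
    T (suc (d ℕ.+ n))   ≤⟨ T-halves (ℕ.≤-trans K≤n (ℕ.m≤n+m n d)) ⟩
    ½ * T (d ℕ.+ n)     ≤⟨ p≤p+q (0≤* (<⇒≤ 0<½) (0≤T (d ℕ.+ n))) ⟩
    ½ * T (d ℕ.+ n) + ½ * T (d ℕ.+ n)  ≡⟨ half+half (T (d ℕ.+ n)) ⟩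
    T (d ℕ.+ n)         ≤⟨ T-antitone d K≤n ⟩
    T n                 ∎

  P+T-antitone : ∀ {n} d → K ℕ.≤ n → P (suc (d ℕ.+ n)) + T (d ℕ.+ n) ≤ P (suc n) + T n
  P+T-antitone zero K≤n = ≤-refl
  P+T-antitone {n} (suc d) K≤n = begin
    P (suc m) + T (suc m) + T (suc m)      ≡⟨ +-assoc (P (suc m)) (T (suc m)) (T (suc m)) ⟩
    P (suc m) + (T (suc m) + T (suc m))
      ≤⟨ +-monoʳ-≤ (P (suc m)) (+-mono-≤ T≤ T≤) ⟩
    P (suc m) + (½ * T m + ½ * T m)        ≡⟨ cong (λ s → P (suc m) + s) (half+half (T m)) ⟩
    P (suc m) + T m                        ≤⟨ P+T-antitone d K≤n ⟩
    P (suc n) + T n                        ∎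
    where
    m = d ℕ.+ n
    T≤ : T (suc m) ≤ ½ * T m
    T≤ = T-halves (ℕ.≤-trans K≤n (ℕ.m≤n+m n d))

  M = P (suc K) + T K

  P≤M : ∀ {n} → K ℕ.≤ n → P n ≤ M
  P≤M {n} K≤n = begin
    P n              ≤⟨ p≤p+q (0≤T n) ⟩
    P (suc n)        ≤⟨ p≤p+q (0≤T n) ⟩
    P (suc n) + T n
      ≡⟨ cong (λ t → P (suc t) + T t) (sym (ℕ.m∸n+n≡m K≤n)) ⟩
    P (suc (n ℕ.∸ K ℕ.+ K)) + T (n ℕ.∸ K ℕ.+ K)
      ≤⟨ P+T-antitone (n ℕ.∸ K) ℕ.≤-refl ⟩
    M                ∎

  T-small : ∀ {n} → K ℕ.≤ n → T (suc n) ≤ b * T K * 1/suc n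
  T-small {n} K≤n = begin
    1/suc n * (b * T n)   ≡⟨ *-comm (1/suc n) (b * T n) ⟩
    b * T n * 1/suc n
      ≤⟨ *-monoʳ (0≤1/suc n) (*-monoˡ (0≤fromℕ B)
           (subst (λ t → T t ≤ T K) (ℕ.m∸n+n≡m K≤n) (T-antitone (n ℕ.∸ K) ℕ.≤-refl))) ⟩
    b * T K * 1/suc n     ∎

  ‖expSum-tail‖≤T : ∀ {z} → ‖ z ‖ ≤ b → ∀ {m n} → K ℕ.≤ n → n ℕ.≤ m →
    ‖ expSum m z ⊖ expSum n z ‖ ≤ T n
  ‖expSum-tail‖≤T {z} hz {m} {n} K≤n n≤m = subst (λ t → ‖ expSum t z ⊖ expSum n z ‖ ≤ T n)
    (ℕ.m∸n+n≡m n≤m)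
    (+-cancel-≤ (P (suc n)) (≤-trans (‖expSum-tail‖ {z} hz n d)
      (≤-trans (p≤p+q (0≤T (d ℕ.+ n))) (P+T-antitone d K≤n))))
    where d = m ℕ.∸ n

exp-cauchy : ∀ {s t} → Cauchy s → Cauchy t → ∀ ε → 0ℚ < ε →
  ∃[ N ] (∀ m n → N ℕ.≤ n → n ℕ.≤ m →
    ‖ expSum m (s m +i t m) ⊖ expSum n (s n +i t n) ‖ ≤ ε)
exp-cauchy {s} {t} cs ct ε 0<ε with bounded {s} cs | bounded {t} ct
... | S , 0≤S , hS | U , 0≤U , hU
    with 1/suc-small′ (ExpBound.b B * ExpBound.T B (ExpBound.K B))
           (0≤* (0≤fromℕ B) (ExpBound.0≤T B (ExpBound.K B))) (half 0<ε)
       | shrink (ExpBound.M B) (half 0<ε)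
  where B = ℤ.∣ ↥ (S + U) ∣
... | N₀ , hN₀ | δ , 0<δ , hδ with cs (½ * δ) (half 0<δ) | ct (½ * δ) (half 0<δ)
... | N₁ , hs | N₂ , ht = N , main
  where
  B = ℤ.∣ ↥ (S + U) ∣
  open ExpBound B
  open ≤-Reasoning
  N = suc (K ℕ.⊔ N₀) ℕ.⊔ (N₁ ℕ.⊔ N₂)
  z : ℕ → ℚ[i]
  z n = s n +i t n
  hz : ∀ n → ‖ z n ‖ ≤ b
  hz n = ≤-trans (+-mono-≤ (hS n) (hU n)) (≤fromℕ (S + U))
  hT : ∀ n → suc (K ℕ.⊔ N₀) ℕ.≤ n → T n ≤ ½ * ε
  hT (suc n) (ℕ.s≤s h) = ≤-trans (T-small (ℕ.m⊔n≤o⇒m≤o K N₀ h))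
    (≤-trans (*-monoˡ (0≤* (0≤fromℕ B) (0≤T K)) (1/suc-antimono (ℕ.m⊔n≤o⇒n≤o K N₀ h))) hN₀)
  main : ∀ m n → N ℕ.≤ n → n ℕ.≤ m → ‖ expSum m (z m) ⊖ expSum n (z n) ‖ ≤ ε
  main m n N≤n n≤m = begin
    ‖ expSum m (z m) ⊖ expSum n (z n) ‖
      ≡⟨ cong ‖_‖ (⊖-telescope (expSum m (z m)) (expSum n (z m)) (expSum n (z n))) ⟩
    ‖ (expSum m (z m) ⊖ expSum n (z m)) ⊕ (expSum n (z m) ⊖ expSum n (z n)) ‖
      ≤⟨ ‖⊕‖ (expSum m (z m) ⊖ expSum n (z m)) (expSum n (z m) ⊖ expSum n (z n)) ⟩
    ‖ expSum m (z m) ⊖ expSum n (z m) ‖ + ‖ expSum n (z m) ⊖ expSum n (z n) ‖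
      ≤⟨ +-mono-≤ (≤-trans (‖expSum-tail‖≤T {z m} (hz m) K≤n n≤m) (hT n 1+K⊔N₀≤n))
                  (‖expSum-difference‖ {z m} {z n} (hz m) (hz n) n) ⟩
    ½ * ε + ‖ z m ⊖ z n ‖ * P n
      ≤⟨ +-monoʳ-≤ (½ * ε) (*-mono (0≤‖ z m ⊖ z n ‖) ‖Δz‖≤δ (≤-trans (0≤P n) (P≤M K≤n)) (P≤M K≤n)) ⟩
    ½ * ε + δ * M     ≡⟨ cong (λ s → ½ * ε + s) (*-comm δ M) ⟩
    ½ * ε + M * δ     ≤⟨ +-monoʳ-≤ (½ * ε) hδ ⟩
    ½ * ε + ½ * ε     ≡⟨ half+half ε ⟩
    ε                 ∎
    where
    1+K⊔N₀≤n = ℕ.m⊔n≤o⇒m≤o (suc (K ℕ.⊔ N₀)) (N₁ ℕ.⊔ N₂) N≤n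
    N₁⊔N₂≤n  = ℕ.m⊔n≤o⇒n≤o (suc (K ℕ.⊔ N₀)) (N₁ ℕ.⊔ N₂) N≤n
    N₁≤n     = ℕ.m⊔n≤o⇒m≤o N₁ N₂ N₁⊔N₂≤n
    N₂≤n     = ℕ.m⊔n≤o⇒n≤o N₁ N₂ N₁⊔N₂≤n
    K≤n : K ℕ.≤ n
    K≤n = ℕ.≤-trans (ℕ.m≤m⊔n K N₀) (ℕ.≤-trans (ℕ.n≤1+n (K ℕ.⊔ N₀)) 1+K⊔N₀≤n)
    0≤P : ∀ n → 0ℚ ≤ P n
    0≤P zero    = ≤-refl
    0≤P (suc n) = 0≤+ (0≤P n) (0≤T n)
    ‖Δz‖≤δ : ‖ z m ⊖ z n ‖ ≤ δ
    ‖Δz‖≤δ = ≤-trans (+-mono-≤ (hs m n (ℕ.≤-trans N₁≤n n≤m) N₁≤n)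
                               (ht m n (ℕ.≤-trans N₂≤n n≤m) N₂≤n))
                     (≤-reflexive (half+half δ))

∣re∣≤‖_‖ : ∀ u → ∣ reℚ u ∣ ≤ ‖ u ‖
∣re∣≤‖ a +i b ‖ = p≤p+q (0≤∣p∣ b)

∣im∣≤‖_‖ : ∀ u → ∣ imℚ u ∣ ≤ ‖ u ‖
∣im∣≤‖ a +i b ‖ = p≤q+p (0≤∣p∣ a)

cauchy-exp-re : ∀ {s t} → Cauchy s → Cauchy t → Cauchy (λ n → reℚ (expSum n (s n +i t n)))
cauchy-exp-re {s} {t} cs ct = cauchy-ordered {λ n → reℚ (expSum n (s n +i t n))} λ ε 0<ε →
  let N , h = exp-cauchy {s} {t} cs ct ε 0<ε in
  N , λ m n N≤n n≤m → ≤-trans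
    (∣re∣≤‖ expSum m (s m +i t m) ⊖ expSum n (s n +i t n) ‖) (h m n N≤n n≤m)

cauchy-exp-im : ∀ {s t} → Cauchy s → Cauchy t → Cauchy (λ n → imℚ (expSum n (s n +i t n)))
cauchy-exp-im {s} {t} cs ct = cauchy-ordered {λ n → imℚ (expSum n (s n +i t n))} λ ε 0<ε →
  let N , h = exp-cauchy {s} {t} cs ct ε 0<ε in
  N , λ m n N≤n n≤m → ≤-trans
    (∣im∣≤‖ expSum m (s m +i t m) ⊖ expSum n (s n +i t n) ‖) (h m n N≤n n≤m)

record ℂ : Set where
  constructor mkℂ
  field
    re im : ℝ

open ℂ public

infixl 6 _+ᶜ_

0ᶜ : ℂ
0ᶜ = mkℂ 0ʳ 0ʳ

_+ᶜ_ : ℂ → ℂ → ℂ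
z +ᶜ w = mkℂ (re z +ʳ re w) (im z +ʳ im w)

modulus : ℂ → ℝ
modulus z = √ (re z *ʳ re z +ʳ im z *ʳ im z)

-- The power series along the diagonal: the n-th approximation to exp z is the
-- sum of z(n) ^ k / k ! over k ≤ n, z(n) being the n-th approximation to z.
exp : ℂ → ℂ
exp (mkℂ x y) = mkℂ
  (mkℝ (λ n → reℚ (expSum n (seq x n +i seq y n))) (cauchy-exp-re {seq x} {seq y} (cauchy x) (cauchy y)))
  (mkℝ (λ n → imℚ (expSum n (seq x n +i seq y n))) (cauchy-exp-im {seq x} {seq y} (cauchy x) (cauchy y)))

-- With n = N + 1, the value of 4 / (1 + x²) at x = k / n, divided by n.
opaque
  riemannTerm : ℕ → ℕ → ℚ
  riemannTerm N k = + (4 ℕ.* suc N) / (suc N ℕ.* suc N ℕ.+ k ℕ.* k)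

riemannSum : ℕ → ℚ
riemannSum N = Σ< (suc N) (λ k → riemannTerm N (suc k))

refine : ℕ → ℕ → ℕ
refine N M = M ℕ.+ N ℕ.* suc M

opaque
  frac : ℕ → ℕ → ℚ
  frac a b = + a / suc b

opaque
  unfolding frac riemannTerm fromℕ 1/suc

  riemannTerm≡frac : ∀ N k → riemannTerm N k ≡ frac (4 ℕ.* suc N) (N ℕ.+ N ℕ.* suc N ℕ.+ k ℕ.* k)
  riemannTerm≡frac N k = refl

  fromℕ≡frac : ∀ n → fromℕ n ≡ frac n 0
  fromℕ≡frac n = refl

  1/suc≡frac : ∀ n → 1/suc n ≡ frac 1 n
  1/suc≡frac n = refl

  frac-mono : ∀ a b c d → a ℕ.* suc d ℕ.≤ c ℕ.* suc b → frac a b ≤ frac c d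
  frac-mono a b c d = /-mono-≤ {a} {b} {c} {d}

  frac-* : ∀ a b c d → frac a b * frac c d ≡ frac (a ℕ.* c) (d ℕ.+ b ℕ.* suc d)
  frac-* = /-*-/

  0≤frac : ∀ a b → 0ℚ ≤ frac a b
  0≤frac = 0≤/

fromℕ*riemannTerm : ∀ N M j → fromℕ (suc M) * riemannTerm N j
  ≡ frac (suc M ℕ.* (4 ℕ.* suc N)) (N ℕ.+ N ℕ.* suc N ℕ.+ j ℕ.* j ℕ.+ 0)
fromℕ*riemannTerm N M j = trans
  (cong₂ _*_ (fromℕ≡frac (suc M)) (riemannTerm≡frac N j))
  (frac-* (suc M) 0 (4 ℕ.* suc N) (N ℕ.+ N ℕ.* suc N ℕ.+ j ℕ.* j))

cross-multiply : ∀ n m k → m ℕ.* (4 ℕ.* (n ℕ.* m)) ℕ.* (n ℕ.* n ℕ.+ k ℕ.* k)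
  ≡ 4 ℕ.* n ℕ.* (n ℕ.* m ℕ.* (n ℕ.* m) ℕ.+ k ℕ.* m ℕ.* (k ℕ.* m) ℕ.+ 0)
cross-multiply = ℕSolver.solve 3 (λ n m k →
  m ⊛ (ℕSolver.con 4 ⊛ (n ⊛ m)) ⊛ (n ⊛ n ⊞ k ⊛ k)
  ≐ ℕSolver.con 4 ⊛ n ⊛ (n ⊛ m ⊛ (n ⊛ m) ⊞ k ⊛ m ⊛ (k ⊛ m) ⊞ ℕSolver.con 0)) refl

cross-mono : ∀ n m {i j} → i ℕ.≤ j →
  4 ℕ.* n ℕ.* (n ℕ.* m ℕ.* (n ℕ.* m) ℕ.+ i ℕ.* i ℕ.+ 0)
  ℕ.≤ 4 ℕ.* n ℕ.* (n ℕ.* m ℕ.* (n ℕ.* m) ℕ.+ j ℕ.* j ℕ.+ 0)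
cross-mono n m h = ℕ.*-monoʳ-≤ (4 ℕ.* n)
  (ℕ.+-monoˡ-≤ 0 (ℕ.+-monoʳ-≤ (n ℕ.* m ℕ.* (n ℕ.* m)) (ℕ.*-mono-≤ h h)))

riemannTerm-upper : ∀ N M {k j} → k ℕ.* suc M ℕ.≤ j →
  fromℕ (suc M) * riemannTerm (refine N M) j ≤ riemannTerm N k
riemannTerm-upper N M {k} {j} h = subst₂ _≤_
  (sym (fromℕ*riemannTerm (refine N M) M j)) (sym (riemannTerm≡frac N k))
  (frac-mono (suc M ℕ.* (4 ℕ.* (suc N ℕ.* suc M))) _ (4 ℕ.* suc N) _
    (ℕ.≤-trans (ℕ.≤-reflexive (cross-multiply (suc N) (suc M) k)) (cross-mono (suc N) (suc M) h)))

riemannTerm-lower : ∀ N M {k j} → j ℕ.≤ k ℕ.* suc M →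
  riemannTerm N k ≤ fromℕ (suc M) * riemannTerm (refine N M) j
riemannTerm-lower N M {k} {j} h = subst₂ _≤_
  (sym (riemannTerm≡frac N k)) (sym (fromℕ*riemannTerm (refine N M) M j))
  (frac-mono (4 ℕ.* suc N) _ (suc M ℕ.* (4 ℕ.* (suc N ℕ.* suc M))) _
    (ℕ.≤-trans (cross-mono (suc N) (suc M) h) (ℕ.≤-reflexive (sym (cross-multiply (suc N) (suc M) k)))))

0≤riemannTerm : ∀ N k → 0ℚ ≤ riemannTerm N k
0≤riemannTerm N k = subst (0ℚ ≤_) (sym (riemannTerm≡frac N k))
  (0≤frac (4 ℕ.* suc N) (N ℕ.+ N ℕ.* suc N ℕ.+ k ℕ.* k))

riemannTerm-0 : ∀ N → riemannTerm N 0 ≤ fromℕ 4 * 1/suc N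
riemannTerm-0 N = subst₂ _≤_ (sym (riemannTerm≡frac N 0))
  (sym (trans (cong₂ _*_ (fromℕ≡frac 4) (1/suc≡frac N)) (frac-* 4 0 1 N)))
  (frac-mono (4 ℕ.* suc N) (N ℕ.+ N ℕ.* suc N ℕ.+ 0) (4 ℕ.* 1) (N ℕ.+ 0) (ℕ.≤-reflexive
    (ℕSolver.solve 1 (λ n → ℕSolver.con 4 ⊛ n ⊛ (n ⊞ ℕSolver.con 0)
      ≐ ℕSolver.con 4 ⊛ ℕSolver.con 1 ⊛ (n ⊛ n ⊞ ℕSolver.con 0)) refl (suc N))))

share : ∀ M {x} → fromℕ (suc M) * (1/suc M * x) ≡ x
share M {x} = trans (sym (*-assoc (fromℕ (suc M)) (1/suc M) x))
  (trans (cong (_* x) (1/suc-inverse M)) (*-identityˡ x))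

share′ : ∀ M {x} → 1/suc M * (fromℕ (suc M) * x) ≡ x
share′ M {x} = trans (sym (*-assoc (1/suc M) (fromℕ (suc M)) x))
  (trans (cong (_* x) (trans (*-comm (1/suc M) (fromℕ (suc M))) (1/suc-inverse M))) (*-identityˡ x))

Σ<-≤-share : ∀ M {f x} → (∀ i → i ℕ.< suc M → fromℕ (suc M) * f i ≤ x) → Σ< (suc M) f ≤ x
Σ<-≤-share M {f} {x} h = ≤-trans
  (Σ<-mono {f} {λ _ → 1/suc M * x} (suc M) (λ i i<m →
    subst (_≤ 1/suc M * x) (share′ M) (*-monoˡ (0≤1/suc M) (h i i<m))))
  (≤-reflexive (trans (Σ<-const (suc M) (1/suc M * x)) (share M)))

Σ<-≥-share : ∀ M {f x} → (∀ i → i ℕ.< suc M → x ≤ fromℕ (suc M) * f i) → x ≤ Σ< (suc M) f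
Σ<-≥-share M {f} {x} h = ≤-trans
  (≤-reflexive (sym (trans (Σ<-const (suc M) (1/suc M * x)) (share M))))
  (Σ<-mono {λ _ → 1/suc M * x} {f} (suc M) (λ i i<m →
    subst (1/suc M * x ≤_) (share′ M) (*-monoˡ (0≤1/suc M) (h i i<m))))

riemannSum-refine : ∀ N M → ∣ riemannSum N - riemannSum (refine N M) ∣ ≤ fromℕ 4 * 1/suc N
riemannSum-refine N M = ≤-trans
  (≤⇒∣∣≤ (≤-trans lower (p≤p+q (0≤riemannTerm N 0))) upper) (riemannTerm-0 N)
  where
  P = refine N M
  f : ℕ → ℚ
  f j = riemannTerm P (suc j)
  lower : riemannSum N ≤ riemannSum P
  lower = ≤-trans
    (Σ<-mono {λ k → riemannTerm N (suc k)} {λ k → Σ< (suc M) (λ i → f (k ℕ.* suc M ℕ.+ i))} (suc N)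
      (λ k _ → Σ<-≥-share M {λ i → f (k ℕ.* suc M ℕ.+ i)} (λ i i<m → riemannTerm-lower N M {suc k}
        (subst₂ ℕ._≤_ (ℕ.+-suc (k ℕ.* suc M) i) (ℕ.+-comm (k ℕ.* suc M) (suc M))
          (ℕ.+-monoʳ-≤ (k ℕ.* suc M) i<m)))))
    (≤-reflexive (sym (Σ<-blocks (suc N) (suc M) f)))
  left : Σ< (suc N) (riemannTerm N) ≤ riemannSum N + riemannTerm N 0
  left = ≤-trans (p≤p+q (0≤riemannTerm N (suc N)))
    (≤-reflexive (trans (Σ<-shift (suc N) (riemannTerm N)) (+-comm (riemannTerm N 0) (riemannSum N))))
  upper : riemannSum P ≤ riemannSum N + riemannTerm N 0
  upper = ≤-trans (≤-reflexive (Σ<-blocks (suc N) (suc M) f)) (≤-trans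
    (Σ<-mono {λ k → Σ< (suc M) (λ i → f (k ℕ.* suc M ℕ.+ i))} {riemannTerm N} (suc N)
      (λ k _ → Σ<-≤-share M {λ i → f (k ℕ.* suc M ℕ.+ i)} (λ i _ → riemannTerm-upper N M {k}
        (ℕ.m≤n⇒m≤1+n (ℕ.m≤m+n (k ℕ.* suc M) i)))))
    left)

cauchy-riemannSum : Cauchy riemannSum
cauchy-riemannSum ε 0<ε with 1/suc-small′ (fromℕ 4) (0≤fromℕ 4) (half 0<ε)
... | N , h = N , λ m n N≤m N≤n → begin
  ∣ riemannSum m - riemannSum n ∣
    ≤⟨ ∣-∣-triangle (riemannSum m) (riemannSum (refine m n)) (riemannSum n) ⟩
  ∣ riemannSum m - riemannSum (refine m n) ∣ + ∣ riemannSum (refine m n) - riemannSum n ∣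
    ≡⟨ cong (λ t → ∣ riemannSum m - riemannSum (refine m n) ∣ + t)
         (trans (∣-∣-sym (riemannSum (refine m n)) (riemannSum n))
                (cong (λ t → ∣ riemannSum n - riemannSum t ∣) (refine-comm m n))) ⟩
  ∣ riemannSum m - riemannSum (refine m n) ∣ + ∣ riemannSum n - riemannSum (refine n m) ∣
    ≤⟨ +-mono-≤ (riemannSum-refine m n) (riemannSum-refine n m) ⟩
  fromℕ 4 * 1/suc m + fromℕ 4 * 1/suc n
    ≤⟨ +-mono-≤ (small N≤m) (small N≤n) ⟩
  ½ * ε + ½ * ε   ≡⟨ half+half ε ⟩
  ε               ∎
  where
  open ≤-Reasoning
  small : ∀ {n} → N ℕ.≤ n → fromℕ 4 * 1/suc n ≤ ½ * ε
  small N≤n = ≤-trans (*-monoˡ (0≤fromℕ 4) (1/suc-antimono N≤n)) h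
  refine-comm : ∀ m n → refine m n ≡ refine n m
  refine-comm m n = ℕ.suc-injective (ℕ.*-comm (suc m) (suc n))

-- The integral of 4 / (1 + x²) over [0 , 1], as a limit of Riemann sums.
π : ℝ
π = mkℝ riemannSum cauchy-riemannSum

-- exp (2 π i t / p)
e : (p : ℕ) .{{_ : ℕ.NonZero p}} → ℤ → ℂ
e p t = exp (mkℂ 0ʳ (fromℚ (+ 2 / 1) *ʳ π *ʳ fromℚ (t / p)))

-- 1 , … , p - 1
units : ℕ → List ℕ
units p = applyUpTo suc (ℕ.pred p)

-- For p prime and p ∤ m there is exactly one k as required; the default value
-- 0 is only reached when m is not invertible modulo p.
inverse : ℕ → ℤ → ℕ
inverse p m = fromMaybe 0 (head (filter (λ k → + p ∣? (m ℤ.* + k ℤ.- 1ℤ)) (units p)))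

S : ℤ → ℤ → ℤ → (p : ℕ) .{{_ : ℕ.NonZero p}} → ℂ
S x y w p = foldr _+ᶜ_ 0ᶜ
  (map (λ m → e p (x ℤ.* + inverse p (+ m) ℤ.+ y ℤ.* + inverse p (+ m ℤ.+ w)))
       (filter (λ m → ¬? (+ p ∣? (+ m ℤ.+ w))) (units p)))

sumʳ : List ℝ → ℝ
sumʳ = foldr _+ʳ_ 0ʳ

{-# OPTIONS --safe #-}
module Submission where

-- Averaging over dilations replaces Weil's bound. For p ∤ t the substitution
-- m ↦ t m, w ↦ t w shows that the sum of |S(tx,ty,w;p)|² over w modulo p does
-- not depend on t. Summing over all t modulo p, orthogonality turns the total
-- into p times the number of (w, m, n) such that
--   x m⁻¹ + y (m+w)⁻¹ = x n⁻¹ + y (n+w)⁻¹.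
-- For w ≠ 0 and given m, clearing denominators and dividing by m - n leaves a
-- nonzero linear equation for n, so that there are at most two such n;
-- altogether there are at most 3p² triples. Hence the sum of |S(x,y,w;p)|²
-- over w is at most 3p³ / (p - 1), and Cauchy–Schwarz gives the bound
-- O((#W)^(1/2) p), which is stronger than the claim.
--
-- On the analytic side, only the relations e(s + t) = e(s) e(t) and e(p) = 1
-- and the nontriviality of e are needed. Identities between complex numbers
-- are treated in the ring of bounded sequences in ℚ[i] modulo null sequences.

open import Defs
open import Algebra.Bundles using (CommutativeRing)
open import Data.Nat.Base using (ℕ)
open import Data.Nat.Primality using (Prime; prime⇒nonZero)
open import Data.Product.Base using (_×_; ∃-syntax)
open import Level using (0ℓ)
open import Relation.Nullary using (¬_)

-- The analytic obstacle is that π and exp are given only through approximations: π by Riemann sums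
-- of 4/(1+x²), exp by partial sums run along the same index. That e(p) = 1 must therefore be
-- proved. The integrand shows how: (n+ik)/(n-ik) has argument 2 arctan(k/n), and passing from k-1
-- to k turns it by about 2n/(n²+k²), half a term of the Riemann sum. Composing n such turns, each
-- with an error of order 1/n², gives exp(iπ/2) = i, and squaring twice gives exp(2πi) = 1. Neither
-- trigonometric functions nor derivatives of functions are needed.
--
-- Identities modulo null sequences are asymptotic, whereas the final inequality compares rationals
-- at one large index. At such an index the second-moment identity holds up to an error 1, which the
-- constants absorb: 3p³ + 1 ≤ 7p²(p-1) for p ≥ 2. Comparing #W with the square of the approximate
-- (#W)^(3/4) costs a factor 4, and 4 · 7 ≤ 6² yields the final constant 6.

-- Counting solutions by sums of indicators.

module Counting where

  open import Data.Fin.Base using (Fin; zero; suc)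
  open import Data.Nat.Base using (suc; _*_; _≤_; z≤n; s≤s)
  open import Data.Nat.Properties
  open import Data.Product.Base using (_,_)
  open import Function.Base using (_∘_)
  open import Relation.Binary.PropositionalEquality using (_≡_; _≢_; refl)
  open import Relation.Nullary using (Dec; yes; no)
  open import Algebra.Properties.CommutativeMonoid.Sum +-0-commutativeMonoid public
    using (sum)

  indicator : {P : Set} → Dec P → ℕ
  indicator (yes _) = 1
  indicator (no _)  = 0

  -- Unfolded, `AtMost k P` says that k + 1 pairwise distinct indices never all satisfy `P`. The
  -- recursive form lets inductions spend one witness at a time, without any finite subsets.
  AtMost : ∀ {n} → ℕ → (Fin n → Set) → Set
  AtMost 0       P = ∀ i → ¬ P i
  AtMost (suc k) P = ∀ i → P i → AtMost k (λ j → P j × j ≢ i)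

  AtMost-⊆ : ∀ {m n} k {P : Fin m → Set} {Q : Fin n → Set} (f : Fin m → Fin n) →
    (∀ {i j} → f i ≡ f j → i ≡ j) → (∀ i → P i → Q (f i)) → AtMost k Q → AtMost k P
  AtMost-⊆ 0       f inj P⇒Q h i Pi = h (f i) (P⇒Q i Pi)
  AtMost-⊆ (suc k) f inj P⇒Q h i Pi =
    AtMost-⊆ k f inj (λ j → λ { (Pj , j≢i) → P⇒Q j Pj , j≢i ∘ inj }) (h (f i) (P⇒Q i Pi))

  -- Induction on `n`: if index 0 satisfies `P`, it contributes 1, and the hypothesis applied to it
  -- leaves one witness fewer for the rest.
  sum-indicator-≤ : ∀ {n} k {P : Fin n → Set} (P? : ∀ i → Dec (P i)) → AtMost k P →
    sum (λ i → indicator (P? i)) ≤ k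
  sum-indicator-≤ {0}     k P? h = z≤n
  sum-indicator-≤ {suc n} k P? h with P? zero
  sum-indicator-≤ {suc n} k       P? h | no _   =
    sum-indicator-≤ k (P? ∘ suc) (AtMost-⊆ k suc (λ { refl → refl }) (λ _ q → q) h)
  sum-indicator-≤ {suc n} 0       P? h | yes P0 with () ← h zero P0
  sum-indicator-≤ {suc n} (suc k) P? h | yes P0 = s≤s
    (sum-indicator-≤ k (P? ∘ suc) (AtMost-⊆ k suc (λ { refl → refl }) (λ _ q → q , λ ()) (h zero P0)))

  sum-≤ : ∀ {n} (f : Fin n → ℕ) c → (∀ i → f i ≤ c) → sum f ≤ n * c
  sum-≤ {0}     f c h = z≤n
  sum-≤ {suc n} f c h = +-mono-≤ (h zero) (sum-≤ (f ∘ suc) c (h ∘ suc))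

  indicator≤1 : {P : Set} (d : Dec P) → indicator d ≤ 1
  indicator≤1 (yes _) = ≤-refl
  indicator≤1 (no _)  = z≤n

-- Residues modulo p, and the inverse found by search.

module Congruences where

  open import Data.Integer.Base using (ℤ; +_; _-_)
  open import Data.Integer.Divisibility.Signed using (_∣_)

  module Residues (p : ℕ) (p-prime : Prime p) where

    open import Data.Empty using (⊥-elim)
    open import Data.Fin.Base using (Fin; toℕ; fromℕ<)
    open import Data.Fin.Permutation using (Permutation′; permutation)
    open import Data.Fin.Properties using (toℕ<n; toℕ-fromℕ<; toℕ-injective)
    open import Data.Integer.Base using (-_; _+_; _*_; 0ℤ; 1ℤ)
    import Data.Integer.Base as ℤ
    open import Data.Integer.DivMod using (_%ℕ_; _/ℕ_; n%ℕd<d; a≡a%ℕn+[a/ℕn]*n)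
    open import Data.Integer.Divisibility.Signed
    import Data.Integer.Properties as ℤ
    open import Data.Integer.Solver using (module +-*-Solver)
    open import Data.List.Base using (filter; head; applyUpTo)
    open import Data.List.Properties using (filter-≐)
    open import Data.Maybe.Base using (fromMaybe)
    open import Data.Nat.Base as ℕ using (suc; NonZero)
    import Data.Nat.Coprimality as Coprimality
    import Data.Nat.Divisibility as ℕ
    open import Data.Nat.GCD using (module Bézout)
    open import Data.Nat.Primality using (euclidsLemma; prime⇒nonTrivial)
    import Data.Nat.Properties as ℕ
    open import Data.Product.Base using (_,_; proj₁; proj₂)
    open import Data.Sum.Base using (_⊎_; inj₁; inj₂)
    import Data.Sum.Base as Sum
    open import Function.Base using (_∘_)
    open import Relation.Binary.PropositionalEquality
    open import Relation.Nullary using (Dec; yes; no)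
    open +-*-Solver using (solve; _:=_; _:+_; _:*_; :-_; _:-_; con)

    instance
      p≢0 : NonZero p
      p≢0 = prime⇒nonZero p-prime

    infix 4 _≋_

    -- A record and not an abbreviation for divisibility, so that `a` and `b` can be inferred from
    -- `a ≋ b`; they are not determined by `a - b`.
    record _≋_ (a b : ℤ) : Set where
      constructor ≋-intro
      field ∣-difference : + p ∣ a - b

    open _≋_ public

    ∣-resp : ∀ {a b} → a ≡ b → + p ∣ a → + p ∣ b
    ∣-resp refl h = h

    ∣-combine : ∀ {a b c} u v → c ≡ u * a + v * b → + p ∣ a → + p ∣ b → + p ∣ c
    ∣-combine u v e h k = ∣-resp (sym e) (∣m∣n⇒∣m+n (∣n⇒∣m*n u h) (∣n⇒∣m*n v k))

    ∣-euclid : ∀ a b → + p ∣ a * b → + p ∣ a ⊎ + p ∣ b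
    ∣-euclid a b h = Sum.map ∣ᵤ⇒∣ ∣ᵤ⇒∣
      (euclidsLemma ℤ.∣ a ∣ ℤ.∣ b ∣ p-prime (subst (p ℕ.∣_) (ℤ.abs-* a b) (∣⇒∣ᵤ h)))

    ∤1 : ¬ + p ∣ 1ℤ
    ∤1 h = ℕ.nonTrivial⇒≢1 {{prime⇒nonTrivial p-prime}} (ℕ.∣1⇒≡1 (∣⇒∣ᵤ h))

    ≋-refl : ∀ {a} → a ≋ a
    ≋-refl {a} = ≋-intro (∣-resp (sym (ℤ.+-inverseʳ a)) (divides 0ℤ refl))

    ≋-reflexive : ∀ {a b} → a ≡ b → a ≋ b
    ≋-reflexive refl = ≋-refl

    ≋-sym : ∀ {a b} → a ≋ b → b ≋ a
    ≋-sym {a} {b} (≋-intro h) =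
      ≋-intro (∣-resp (solve 2 (λ a b → :- (a :- b) := b :- a) refl a b) (∣m⇒∣-m h))

    ≋-trans : ∀ {a b c} → a ≋ b → b ≋ c → a ≋ c
    ≋-trans {a} {b} {c} (≋-intro h) (≋-intro k) = ≋-intro
      (∣-resp (solve 3 (λ a b c → (a :- b) :+ (b :- c) := a :- c) refl a b c) (∣m∣n⇒∣m+n h k))

    +-≋ : ∀ {a b c d} → a ≋ b → c ≋ d → a + c ≋ b + d
    +-≋ {a} {b} {c} {d} (≋-intro h) (≋-intro k) = ≋-intro (∣-resp
      (solve 4 (λ a b c d → (a :- b) :+ (c :- d) := (a :+ c) :- (b :+ d)) refl a b c d)
      (∣m∣n⇒∣m+n h k))

    *-≋ : ∀ {a b c d} → a ≋ b → c ≋ d → a * c ≋ b * d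
    *-≋ {a} {b} {c} {d} (≋-intro h) (≋-intro k) = ≋-intro (∣-combine c b
      (solve 4 (λ a b c d → a :* c :- b :* d := c :* (a :- b) :+ b :* (c :- d)) refl a b c d) h k)

    ∣-resp-≋ : ∀ {a b} → a ≋ b → + p ∣ a → + p ∣ b
    ∣-resp-≋ {a} {b} (≋-intro h) k =
      ∣-resp (solve 2 (λ a b → a :- (a :- b) := b) refl a b) (∣m∣n⇒∣m-n k h)

    ι : Fin p → ℤ
    ι i = + toℕ i

    residue : ℤ → Fin p
    residue a = fromℕ< (n%ℕd<d a p)

    ι-residue : ∀ a → ι (residue a) ≋ a
    ι-residue a = ≋-intro (divides (- (a /ℕ p)) (begin
      ι (residue a) - a
        ≡⟨ cong (λ r → + r - a) (toℕ-fromℕ< (n%ℕd<d a p)) ⟩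
      + (a %ℕ p) - a
        ≡⟨ cong (λ t → + (a %ℕ p) - t) (a≡a%ℕn+[a/ℕn]*n a p) ⟩
      + (a %ℕ p) - (+ (a %ℕ p) + (a /ℕ p) * + p)
        ≡⟨ solve 3 (λ r q n → r :- (r :+ q :* n) := (:- q) :* n) refl (+ (a %ℕ p)) (a /ℕ p) (+ p) ⟩
      - (a /ℕ p) * + p ∎))
      where open ≡-Reasoning

    <∧∣⇒≡0 : ∀ {n} → n ℕ.< p → + p ∣ + n → n ≡ 0
    <∧∣⇒≡0 {ℕ.zero}  _   _ = refl
    <∧∣⇒≡0 {suc n} n<p h = ⊥-elim (ℕ.≤⇒≯ (ℕ.∣⇒≤ (∣⇒∣ᵤ h)) n<p)

    ι-injective : ∀ {i j} → ι i ≋ ι j → i ≡ j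
    ι-injective {i} {j} h = toℕ-injective (go (ℕ.≤-total (toℕ i) (toℕ j)))
      where
      ordered : ∀ {m n} → n ℕ.≤ m → m ℕ.< p → + m ≋ + n → m ≡ n
      ordered {m} {n} n≤m m<p (≋-intro h) = ℕ.≤-antisym (ℕ.m∸n≡0⇒m≤n (<∧∣⇒≡0
        (ℕ.≤-<-trans (ℕ.m∸n≤m m n) m<p)
        (∣-resp (trans (ℤ.m-n≡m⊖n m n) (ℤ.⊖-≥ n≤m)) h))) n≤m
      go : toℕ i ℕ.≤ toℕ j ⊎ toℕ j ℕ.≤ toℕ i → toℕ i ≡ toℕ j
      go (inj₁ i≤j) = sym (ordered i≤j (toℕ<n j) (≋-sym h))
      go (inj₂ j≤i) = ordered j≤i (toℕ<n i) h

    residue-unique : ∀ {a i} → a ≋ ι i → residue a ≡ i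
    residue-unique {a} h = ι-injective (≋-trans (ι-residue a) h)

    module _ (f g : ℤ → ℤ) (f-cong : ∀ {a b} → a ≋ b → f a ≋ f b)
      (g-cong : ∀ {a b} → a ≋ b → g a ≋ g b)
      (f∘g : ∀ a → f (g a) ≋ a) (g∘f : ∀ a → g (f a) ≋ a) where

      residuePermutation : Permutation′ p
      residuePermutation = permutation (residue ∘ f ∘ ι) (residue ∘ g ∘ ι)
        (λ i → residue-unique (≋-trans (f-cong (ι-residue (g (ι i)))) (f∘g (ι i))))
        (λ i → residue-unique (≋-trans (g-cong (ι-residue (f (ι i)))) (g∘f (ι i))))

    ι≢0 : ∀ {i} → ¬ + p ∣ ι i → ∃[ k ] (toℕ i ≡ suc k)
    ι≢0 {i} h with toℕ i
    ... | ℕ.zero = ⊥-elim (h (divides 0ℤ refl))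
    ... | suc k  = k , refl

    -- The residue of `a` is positive and below p, hence coprime to p. The two shapes of a Bézout
    -- identity over ℕ differ by a sign, which is passed on to the inverse.
    bézout : ∀ a → ¬ + p ∣ a → ∃[ b ] a * b ≋ 1ℤ
    bézout a p∤a with ι≢0 {residue a} (λ h → p∤a (∣-resp-≋ (ι-residue a) h))
    ... | k , eq = go (Coprimality.coprime-Bézout (Coprimality.prime⇒coprime p-prime k<p))
      where
      k<p : suc k ℕ.< p
      k<p = subst (ℕ._< p) eq (toℕ<n (residue a))
      a≋k : a ≋ + suc k
      a≋k = ≋-sym (≋-trans (≋-reflexive (cong +_ (sym eq))) (ι-residue a))
      cast : ∀ s t u v → 1 ℕ.+ s ℕ.* t ≡ u ℕ.* v → 1ℤ + + s * + t ≡ + u * + v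
      cast s t u v e = trans (cong (λ z → 1ℤ + z) (sym (ℤ.pos-* s t))) (trans (cong +_ e) (ℤ.pos-* u v))
      finish : ∀ b → + suc k * b ≋ 1ℤ → ∃[ b ] a * b ≋ 1ℤ
      finish b h = b , ≋-trans (*-≋ a≋k (≋-refl {b})) h
      go : Bézout.Identity 1 p (suc k) → ∃[ b ] a * b ≋ 1ℤ
      go (Bézout.+- u v e) = finish (- + v) (≋-intro (divides (- + u) (begin
        + suc k * - + v - 1ℤ
          ≡⟨ solve 2 (λ k v → k :* (:- v) :- con 1ℤ := :- (con 1ℤ :+ v :* k)) refl (+ suc k) (+ v) ⟩
        - (1ℤ + + v * + suc k)   ≡⟨ cong -_ (cast v (suc k) u p e) ⟩
        - (+ u * + p)            ≡⟨ ℤ.neg-distribˡ-* (+ u) (+ p) ⟩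
        - + u * + p              ∎)))
        where open ≡-Reasoning
      go (Bézout.-+ u v e) = finish (+ v) (≋-intro (divides (+ u) (begin
        + suc k * + v - 1ℤ          ≡⟨ cong (_- 1ℤ) (ℤ.*-comm (+ suc k) (+ v)) ⟩
        + v * + suc k - 1ℤ          ≡⟨ cong (_- 1ℤ) (sym (cast u p v (suc k) e)) ⟩
        1ℤ + + u * + p - 1ℤ         ≡⟨ solve 1 (λ t → con 1ℤ :+ t :- con 1ℤ := t) refl (+ u * + p) ⟩
        + u * + p                   ∎)))
        where open ≡-Reasoning

    -- One successful candidate ensures a first hit, so the default value in `inverse` is not
    -- reached.
    head-filter : ∀ {P : ℕ → Set} (P? : ∀ k → Dec (P k)) (f : ℕ → ℕ) n {k} →
      k ℕ.< n → P (f k) → P (fromMaybe 0 (head (filter P? (applyUpTo f n))))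
    head-filter P? f (suc n) {k} k<n Pk with P? (f 0)
    ... | yes P0 = P0
    head-filter P? f (suc n) {ℕ.zero}  k<n Pk | no ¬P0 = ⊥-elim (¬P0 Pk)
    head-filter P? f (suc n) {suc k} k<n Pk | no ¬P0 =
      head-filter P? (f ∘ suc) n (ℕ.s<s⁻¹ k<n) Pk

    inv : ℤ → ℤ
    inv a = + inverse p a

    -- The list searched is fixed and the test depends only on the class of `a`, so the results are
    -- equal and not merely congruent.
    inverse-cong : ∀ {a b} → a ≋ b → inverse p a ≡ inverse p b
    inverse-cong {a} {b} h = cong (λ ks → fromMaybe 0 (head ks))
      (filter-≐ (λ k → + p ∣? (a * + k - 1ℤ)) (λ k → + p ∣? (b * + k - 1ℤ))
        ((λ {k} → transfer {a} {b} k h) , (λ {k} → transfer {b} {a} k (≋-sym h))) (units p))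
      where
      transfer : ∀ {a b} k → a ≋ b → + p ∣ a * + k - 1ℤ → + p ∣ b * + k - 1ℤ
      transfer k h d = ∣-difference (≋-trans (*-≋ (≋-sym h) (≋-refl {+ k})) (≋-intro d))

    -- The search only visits 1, ..., p - 1. A Bézout inverse has a nonzero residue, since otherwise
    -- p would divide 1, and this residue is among the candidates.
    *-inv : ∀ {a} → ¬ + p ∣ a → a * inv a ≋ 1ℤ
    *-inv {a} p∤a = ≋-intro (head-filter {P = λ k → + p ∣ a * + k - 1ℤ} (λ k → + p ∣? (a * + k - 1ℤ))
      suc (ℕ.pred p) {k} (ℕ.<⇒≤pred (subst (ℕ._< p) eq (toℕ<n (residue b)))) (∣-difference ak≋1))
      where
      b = proj₁ (bézout a p∤a)
      ab≋1 = proj₂ (bézout a p∤a)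
      nonzero = ι≢0 {residue b} (λ h → ∤1 (∣-resp-≋ ab≋1 (∣n⇒∣m*n a (∣-resp-≋ (ι-residue b) h))))
      k = proj₁ nonzero
      eq : toℕ (residue b) ≡ suc k
      eq = proj₂ nonzero
      ak≋1 : a * + suc k ≋ 1ℤ
      ak≋1 = ≋-trans (*-≋ (≋-refl {a}) (≋-trans (≋-reflexive (cong +_ (sym eq))) (ι-residue b))) ab≋1

    inverse-unique : ∀ {a b c} → a * b ≋ 1ℤ → a * c ≋ 1ℤ → b ≋ c
    inverse-unique {a} {b} {c} (≋-intro h) (≋-intro k) = ≋-intro (∣-combine c (- b)
      (solve 3 (λ a b c → b :- c := c :* (a :* b :- con 1ℤ) :+ (:- b) :* (a :* c :- con 1ℤ)) refl a b c)
      h k)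

  -- Bounding the number of triples (w, m, n) with equal phases.

  module Collisions (p : ℕ) (p-prime : Prime p) (x y : ℤ) (p∤y : ¬ + p ∣ y) where

    open Counting
    open Residues p p-prime
    open import Data.Empty using (⊥; ⊥-elim)
    open import Data.Fin.Base as Fin using (Fin; toℕ)
    open import Data.Fin.Properties using (_≟_; toℕ<n)
    open import Data.Integer.Base using (-_; _+_; _*_; 0ℤ; 1ℤ)
    open import Data.Integer.Divisibility.Signed
    open import Data.Integer.Solver using (module +-*-Solver)
    open import Data.Nat.Base as ℕ using (suc)
    import Data.Nat.Properties as ℕ
    open import Data.Product.Base using (_,_; proj₁; proj₂)
    open import Data.Sum.Base using (_⊎_; inj₁; inj₂; [_,_]′)
    open import Function.Base using (_∘_)
    open import Relation.Binary.PropositionalEquality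
    open import Relation.Nullary using (Dec; yes; no)
    open import Relation.Nullary.Decidable using (¬?; _×-dec_; map′)
    open ℕSolver using () renaming (_:=_ to _≐_; _:+_ to _⊞_; _:*_ to _⊛_)
    open +-*-Solver using (solve; _:=_; _:+_; _:*_; :-_; _:-_; con)

    phase : ℤ → ℤ → ℤ
    phase w m = x * inv m + y * inv (m + w)

    Good : ℤ → ℤ → Set
    Good w m = ¬ + p ∣ m × ¬ + p ∣ (m + w)

    good? : ∀ w m → Dec (Good w m)
    good? w m = ¬? (+ p ∣? m) ×-dec ¬? (+ p ∣? (m + w))

    _≋?_ : ∀ a b → Dec (a ≋ b)
    a ≋? b = map′ ≋-intro ∣-difference (+ p ∣? (a - b))

    Collision : ℤ → ℤ → ℤ → Set
    Collision w m n = Good w m × (Good w n × phase w m ≋ phase w n)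

    collision? : ∀ w m n → Dec (Collision w m n)
    collision? w m n = good? w m ×-dec (good? w n ×-dec (phase w m ≋? phase w n))

    -- Clearing denominators in phase w m ≋ phase w n leaves, besides the factor
    -- m - n, an expression which is linear in n.
    collision-linear : ∀ {w m n} → Collision w m n → ¬ m ≋ n →
      + p ∣ n * (x * (m + w) + y * m) + x * w * (m + w)
    collision-linear {w} {m} {n} ((p∤m , p∤m+w) , ((p∤n , p∤n+w) , ≋-intro h)) m≢n =
      [ (λ d → ⊥-elim (m≢n (≋-intro d))) , (λ d → d) ]′ (∣-euclid (m - n) _
        (∣-resp identity
          (∣m∣n⇒∣m+n (∣n⇒∣m*n (m * (m + w) * n * (n + w)) (∣m⇒∣-m h))
          (∣m∣n⇒∣m+n (∣n⇒∣m*n (- (x * m * (m + w) * (n + w))) (unit p∤n))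
          (∣m∣n⇒∣m+n (∣n⇒∣m*n (- (y * m * (m + w) * n)) (unit p∤n+w))
          (∣m∣n⇒∣m+n (∣n⇒∣m*n (x * (m + w) * n * (n + w)) (unit p∤m))
                     (∣n⇒∣m*n (y * m * n * (n + w)) (unit p∤m+w))))))))
      where
      unit : ∀ {a} → ¬ + p ∣ a → + p ∣ a * inv a - 1ℤ
      unit p∤a = ∣-difference (*-inv p∤a)
      -- The last four summands are multiples of some `a * inv a - 1`, hence of p. They replace the
      -- four inverses in the cleared difference, so that the identity holds with the inverses as
      -- free variables.
      identity :
        m * (m + w) * n * (n + w) * - (phase w m - phase w n)
        + (- (x * m * (m + w) * (n + w)) * (n * inv n - 1ℤ)
        + (- (y * m * (m + w) * n) * ((n + w) * inv (n + w) - 1ℤ)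
        + (x * (m + w) * n * (n + w) * (m * inv m - 1ℤ)
        + y * m * n * (n + w) * ((m + w) * inv (m + w) - 1ℤ))))
        ≡ (m - n) * (n * (x * (m + w) + y * m) + x * w * (m + w))
      identity = solve 9 (λ x y w m n a b c d →
        m :* (m :+ w) :* n :* (n :+ w) :* (:- ((x :* a :+ y :* b) :- (x :* c :+ y :* d)))
        :+ ((:- (x :* m :* (m :+ w) :* (n :+ w))) :* (n :* c :- con 1ℤ)
        :+ ((:- (y :* m :* (m :+ w) :* n)) :* ((n :+ w) :* d :- con 1ℤ)
        :+ (x :* (m :+ w) :* n :* (n :+ w) :* (m :* a :- con 1ℤ)
        :+ y :* m :* n :* (n :+ w) :* ((m :+ w) :* b :- con 1ℤ))))
        := (m :- n) :* (n :* (x :* (m :+ w) :+ y :* m) :+ x :* w :* (m :+ w)))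
        refl x y w m n (inv m) (inv (m + w)) (inv n) (inv (n + w))

    -- Two incongruent roots of the linear form n A + B would force p to divide A and therefore B =
    -- x w (m + w), hence x; then A leaves p dividing y m, which is excluded.
    no-two-collisions : ∀ {w m n k} → ¬ + p ∣ w → Collision w m n → Collision w m k →
      ¬ m ≋ n → ¬ m ≋ k → ¬ n ≋ k → ⊥
    no-two-collisions {w} {m} {n} {k} p∤w cₙ cₖ m≢n m≢k n≢k = [ n≢k ∘ ≋-intro , p∤A ]′
      (∣-euclid (n - k) A (∣-resp
        (solve 4 (λ n k a b → (n :* a :+ b) :- (k :* a :+ b) := (n :- k) :* a) refl n k A B)
        (∣m∣n⇒∣m-n n-root (collision-linear cₖ m≢k))))
      where
      A = x * (m + w) + y * m
      B = x * w * (m + w)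
      n-root : + p ∣ n * A + B
      n-root = collision-linear cₙ m≢n
      p∤m = proj₁ (proj₁ cₙ)
      p∤m+w = proj₂ (proj₁ cₙ)
      p∤A : ¬ + p ∣ A
      p∤A p∣A = [ [ p∤x , p∤w ]′ ∘ ∣-euclid x w , p∤m+w ]′
        (∣-euclid (x * w) (m + w) (∣m+n∣m⇒∣n {m = n * A} n-root (∣n⇒∣m*n n p∣A)))
        where
        p∤x : ¬ + p ∣ x
        p∤x p∣x = [ p∤y , p∤m ]′ (∣-euclid y m (∣m+n∣m⇒∣n {m = x * (m + w)} p∣A (∣m⇒∣m*n (m + w) p∣x)))

    -- Besides the trivial collision of `m` with itself there is at most one: among three distinct
    -- indices, two differ from `m`.
    collisions-atMost2 : ∀ {w} m → ¬ + p ∣ w → AtMost 2 (λ n → Collision w (ι m) (ι n))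
    collisions-atMost2 m p∤w i cᵢ j (cⱼ , j≢i) k ((cₖ , k≢i) , k≢j) with m ≟ i | m ≟ j
    ... | yes refl | _ = no-two-collisions p∤w cⱼ cₖ
      (j≢i ∘ sym ∘ ι-injective) (k≢i ∘ sym ∘ ι-injective) (k≢j ∘ sym ∘ ι-injective)
    ... | no m≢i | yes refl = no-two-collisions p∤w cᵢ cₖ
      (m≢i ∘ ι-injective) (k≢j ∘ sym ∘ ι-injective) (k≢i ∘ sym ∘ ι-injective)
    ... | no m≢i | no m≢j = no-two-collisions p∤w cᵢ cⱼ
      (m≢i ∘ ι-injective) (m≢j ∘ ι-injective) (j≢i ∘ sym ∘ ι-injective)

    collisions : ℤ → ℕ
    collisions w = sum (λ m → sum (λ n → indicator (collision? w (ι m) (ι n))))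

    collisions-≤ : ∀ w → ¬ + p ∣ w → collisions w ℕ.≤ p ℕ.* 2
    collisions-≤ w p∤w = sum-≤ _ 2 (λ m →
      sum-indicator-≤ 2 (λ n → collision? w (ι m) (ι n)) (collisions-atMost2 m p∤w))

    collisions-≤-trivial : ∀ w → collisions w ℕ.≤ p ℕ.* (p ℕ.* 1)
    collisions-≤-trivial w = sum-≤ _ (p ℕ.* 1) (λ m → sum-≤ _ 1 (λ n →
      indicator≤1 (collision? w (ι m) (ι n))))

    -- The class w = 0 is estimated trivially by p², because there the phase is (x + y) m⁻¹, which
    -- is constant if p divides x + y. The other p - 1 classes contribute at most 2p each.
    total-collisions-≤ : sum (λ w → collisions (ι w)) ℕ.≤ 3 ℕ.* (p ℕ.* p)
    total-collisions-≤ = go p refl (λ w → collisions (ι w)) (λ w → collisions-≤-trivial (ι w))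
      (λ w w≢0 → collisions-≤ (ι w) (λ p∣w → w≢0 (<∧∣⇒≡0 (toℕ<n w) p∣w)))
      where
      -- Splitting off the index 0 needs a length of the form `suc q`, so the length is generalised.
      go : ∀ q → q ≡ p → (f : Fin q → ℕ) → (∀ i → f i ℕ.≤ p ℕ.* (p ℕ.* 1)) →
        (∀ i → toℕ i ≢ 0 → f i ℕ.≤ p ℕ.* 2) → sum f ℕ.≤ 3 ℕ.* (p ℕ.* p)
      go 0       _ f h k = ℕ.z≤n
      go (suc q) q≡p f h k = begin
        f Fin.zero ℕ.+ sum (f ∘ Fin.suc)
          ≤⟨ ℕ.+-mono-≤ (h Fin.zero) (sum-≤ (f ∘ Fin.suc) (p ℕ.* 2) (λ i → k (Fin.suc i) λ ())) ⟩
        p ℕ.* (p ℕ.* 1) ℕ.+ q ℕ.* (p ℕ.* 2)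
          ≤⟨ ℕ.+-monoʳ-≤ (p ℕ.* (p ℕ.* 1)) (ℕ.*-monoˡ-≤ (p ℕ.* 2) q≤p) ⟩
        p ℕ.* (p ℕ.* 1) ℕ.+ p ℕ.* (p ℕ.* 2)
          ≡⟨ ℕSolver.solve 1 (λ p → p ⊛ (p ⊛ ℕSolver.con 1) ⊞ p ⊛ (p ⊛ ℕSolver.con 2)
               ≐ ℕSolver.con 3 ⊛ (p ⊛ p)) refl p ⟩
        3 ℕ.* (p ℕ.* p) ∎
        where
        open ℕ.≤-Reasoning
        q≤p : q ℕ.≤ p
        q≤p = ℕ.≤-trans (ℕ.n≤1+n q) (ℕ.≤-reflexive q≡p)

-- The averaged second moment, for a character with values in any commutative ring.

module CharacterSums (R : CommutativeRing 0ℓ 0ℓ) where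

  open Congruences
  open Counting using (indicator) renaming (sum to sumℕ)
  open CommutativeRing R hiding (_-_)
  open import Algebra.Properties.Semiring.Mult semiring renaming (_×_ to _·ℕ_)
  open import Algebra.Properties.Semiring.Sum semiring
  open import Relation.Binary.Reasoning.Setoid setoid
  open import Data.Fin.Base as Fin using (Fin; toℕ)
  open import Data.Fin.Properties using (toℕ<n)
  open import Data.Integer.Base as ℤ using (ℤ; +_; -[1+_]; _-_; 0ℤ; 1ℤ)
  import Data.Integer.Properties as ℤ
  open import Data.Integer.Divisibility.Signed using (_∣_; divides; ∣n⇒∣m*n)
  open import Data.Integer.Solver using (module +-*-Solver)
  open import Data.Nat.Base as ℕ using (suc)
  import Data.Nat.Properties as ℕ
  open import Data.Product.Base using (_,_; proj₁; proj₂)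
  open import Data.Sum.Base using ([_,_]′)
  open import Function.Base using (_∘_)
  open import Relation.Binary.PropositionalEquality as ≡ using (_≡_; _≢_)
  open import Relation.Nullary using (Dec; yes; no; contradiction)
  open import Relation.Nullary.Decidable using (_×-dec_)
  open +-*-Solver using (solve; _:=_; _:+_; _:*_; :-_; _:-_; con)

  -- The field `nontrivial` asks that χ j - 1 be no zero divisor. To know that it is nonzero would
  -- not suffice, as bounded sequences modulo null sequences have zero divisors.
  record IsCharacter (p : ℕ) (χ : ℤ → Carrier) : Set where
    field
      homo       : ∀ a b → χ (a ℤ.+ b) ≈ χ a * χ b
      period     : χ (+ p) ≈ 1#
      nontrivial : ∃[ j ] (∀ u → χ j * u ≈ u → u ≈ 0#)

  ·ℕ-* : ∀ k l a b → (k ·ℕ a) * (l ·ℕ b) ≈ (k ℕ.* l) ·ℕ (a * b)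
  ·ℕ-* k l a b = begin
    (k ·ℕ a) * (l ·ℕ b)    ≈⟨ ×-assoc-* k a (l ·ℕ b) ⟩
    k ·ℕ (a * (l ·ℕ b))    ≈⟨ ×-congʳ k (×-comm-* l a b) ⟩
    k ·ℕ (l ·ℕ (a * b))    ≈⟨ ×-assocˡ (a * b) k l ⟩
    (k ℕ.* l) ·ℕ (a * b)   ∎

  sum-·ℕʳ : ∀ {n} (k : Fin n → ℕ) a → sum (λ i → k i ·ℕ a) ≈ sumℕ k ·ℕ a
  sum-·ℕʳ {0}     k a = refl
  sum-·ℕʳ {suc n} k a = trans (+-congˡ (sum-·ℕʳ (k ∘ Fin.suc) a))
    (sym (×-homo-+ a (k Fin.zero) (sumℕ (k ∘ Fin.suc))))

  sum-·ℕˡ : ∀ {n} k (f : Fin n → Carrier) → sum (λ i → k ·ℕ f i) ≈ k ·ℕ sum f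
  sum-·ℕˡ k f = begin
    sum (λ i → k ·ℕ f i)        ≈⟨ sum-cong-≋ (λ i → ·ℕ-1# (f i)) ⟩
    sum (λ i → (k ·ℕ 1#) * f i) ≈⟨ *-distribˡ-sum (k ·ℕ 1#) f ⟨
    (k ·ℕ 1#) * sum f           ≈⟨ ·ℕ-1# (sum f) ⟨
    k ·ℕ sum f                  ∎
    where
    ·ℕ-1# : ∀ a → k ·ℕ a ≈ (k ·ℕ 1#) * a
    ·ℕ-1# a = sym (trans (×-assoc-* k 1# a) (×-congʳ k (*-identityˡ a)))

  sum-* : ∀ {m n} (f : Fin m → Carrier) (g : Fin n → Carrier) →
    sum f * sum g ≈ sum (λ i → sum (λ j → f i * g j))
  sum-* f g = trans (*-distribʳ-sum (sum g) f) (sum-cong-≋ (λ i → *-distribˡ-sum (f i) g))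

  sum-constant-tail : ∀ n (f : Fin n → Carrier) {c} → (z : Fin n) → toℕ z ≡ 0 →
    (∀ i → toℕ i ≢ 0 → f i ≈ c) → sum f ≈ f z + ℕ.pred n ·ℕ c
  sum-constant-tail (suc n) f Fin.zero _ h =
    +-congˡ (trans (sum-cong-≋ (λ i → h (Fin.suc i) λ ())) (sum-replicate n))

  indicator-×-dec : ∀ {P Q : Set} (d : Dec P) (e : Dec Q) →
    indicator (d ×-dec e) ≡ indicator d ℕ.* indicator e
  indicator-×-dec (no _)  e       = ≡.refl
  indicator-×-dec (yes _) (no _)  = ≡.refl
  indicator-×-dec (yes _) (yes _) = ≡.refl

  module SecondMoment (p : ℕ) (p-prime : Prime p) (x y : ℤ) (p∤y : ¬ + p ∣ y)
    (χ : ℤ → Carrier) (χ-isCharacter : IsCharacter p χ) where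

    open Residues p p-prime
    open Collisions p p-prime x y p∤y
    open IsCharacter χ-isCharacter

    -- The homomorphism law alone only makes χ(0) idempotent; the period gives it the value 1.
    χ-0 : χ 0ℤ ≈ 1#
    χ-0 = begin
      χ 0ℤ             ≈⟨ *-identityʳ (χ 0ℤ) ⟨
      χ 0ℤ * 1#        ≈⟨ *-congˡ period ⟨
      χ 0ℤ * χ (+ p)   ≈⟨ homo 0ℤ (+ p) ⟨
      χ (+ p)          ≈⟨ period ⟩
      1#               ∎

    χ-+multiple : ∀ a k → χ (a ℤ.+ + k ℤ.* + p) ≈ χ a
    χ-+multiple a 0       = reflexive (≡.cong χ (ℤ.+-identityʳ a))
    χ-+multiple a (suc k) = begin
      χ (a ℤ.+ + suc k ℤ.* + p)
        ≡⟨ ≡.cong χ (solve 3 (λ a k p → a :+ (con 1ℤ :+ k) :* p := (a :+ k :* p) :+ p)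
             ≡.refl a (+ k) (+ p)) ⟩
      χ ((a ℤ.+ + k ℤ.* + p) ℤ.+ + p)       ≈⟨ homo (a ℤ.+ + k ℤ.* + p) (+ p) ⟩
      χ (a ℤ.+ + k ℤ.* + p) * χ (+ p)       ≈⟨ *-cong (χ-+multiple a k) period ⟩
      χ a * 1#                              ≈⟨ *-identityʳ (χ a) ⟩
      χ a                                   ∎

    χ-cong : ∀ {a b} → a ≋ b → χ a ≈ χ b
    χ-cong {a} {b} (≋-intro (divides (+ k) e)) = trans
      (reflexive (≡.cong χ (≡.trans (solve 2 (λ a b → a := b :+ (a :- b)) ≡.refl a b)
        (≡.cong (λ t → b ℤ.+ t) e))))
      (χ-+multiple b k)
    χ-cong {a} {b} (≋-intro (divides -[1+ k ] e)) = sym (trans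
      (reflexive (≡.cong χ (≡.trans (solve 2 (λ a b → b := a :+ (:- (a :- b))) ≡.refl a b)
        (≡.cong (λ t → a ℤ.+ t)
          (≡.trans (≡.cong ℤ.-_ e) (ℤ.neg-distribˡ-* -[1+ k ] (+ p)))))))
      (χ-+multiple a (suc k)))

    sum-reindex : (F : ℤ → Carrier) → (∀ {a b} → a ≋ b → F a ≈ F b) →
      (f g : ℤ → ℤ) → (∀ {a b} → a ≋ b → f a ≋ f b) → (∀ {a b} → a ≋ b → g a ≋ g b) →
      (∀ a → f (g a) ≋ a) → (∀ a → g (f a) ≋ a) →
      sum (λ i → F (f (ι i))) ≈ sum (λ i → F (ι i))
    sum-reindex F F-cong f g f-cong g-cong f∘g g∘f = sym (trans
      (sum-permute (λ i → F (ι i)) (residuePermutation f g f-cong g-cong f∘g g∘f))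
      (sum-cong-≋ (λ i → F-cong (ι-residue (f (ι i))))))

    -- For incongruent `a` and `b`, translating t by j (a - b)⁻¹ multiplies every term by χ j. The
    -- sum is thus fixed by χ j, and `nontrivial` makes it vanish.
    orthogonality : ∀ a b → sum (λ t → χ (ι t ℤ.* (a - b))) ≈ indicator (a ≋? b) ·ℕ (p ·ℕ 1#)
    orthogonality a b with a ≋? b
    ... | yes (≋-intro p∣a-b) = begin
      sum (λ t → χ (ι t ℤ.* (a - b)))
        ≈⟨ sum-cong-≋ (λ t → trans (χ-cong (≋-intro (∣-resp
             (≡.sym (ℤ.+-identityʳ (ι t ℤ.* (a - b)))) (∣n⇒∣m*n (ι t) p∣a-b)))) χ-0) ⟩
      sum {p} (λ _ → 1#)     ≈⟨ sum-replicate p ⟩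
      p ·ℕ 1#                ≈⟨ ×-homo-1 (p ·ℕ 1#) ⟨
      1 ·ℕ (p ·ℕ 1#)         ∎
    ... | no a≢b = proj₂ nontrivial (sum (λ t → χ (ι t ℤ.* d))) (begin
      χ j * sum (λ t → χ (ι t ℤ.* d))      ≈⟨ *-distribˡ-sum (χ j) (λ t → χ (ι t ℤ.* d)) ⟩
      sum (λ t → χ j * χ (ι t ℤ.* d))
        ≈⟨ sum-cong-≋ (λ t → trans (sym (homo j (ι t ℤ.* d))) (χ-cong (shift (ι t)))) ⟩
      sum (λ t → χ ((ι t ℤ.+ s) ℤ.* d))
        ≈⟨ sum-reindex (λ t → χ (t ℤ.* d)) (λ h → χ-cong (*-≋ h ≋-refl)) (ℤ._+ s) (ℤ._- s)
             (λ h → +-≋ h ≋-refl) (λ h → +-≋ h ≋-refl)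
             (λ t → ≋-reflexive (solve 2 (λ t s → (t :- s) :+ s := t) ≡.refl t s))
             (λ t → ≋-reflexive (solve 2 (λ t s → (t :+ s) :- s := t) ≡.refl t s)) ⟩
      sum (λ t → χ (ι t ℤ.* d))            ∎)
      where
      d = a - b
      j = proj₁ nontrivial
      s = j ℤ.* inv d
      shift : ∀ t → j ℤ.+ t ℤ.* d ≋ (t ℤ.+ s) ℤ.* d
      shift t = ≋-trans
        (+-≋ {j} (≋-trans (≋-reflexive (≡.sym (ℤ.*-identityʳ j)))
          (*-≋ (≋-refl {j}) (≋-sym (*-inv (a≢b ∘ ≋-intro))))) (≋-refl {t ℤ.* d}))
        (≋-reflexive (solve 4 (λ j t d v → j :* (d :* v) :+ t :* d := (t :+ j :* v) :* d)
          ≡.refl j t d (inv d)))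

    term : ℤ → ℤ → ℤ → Carrier
    term t w m = indicator (good? w m) ·ℕ χ (t ℤ.* phase w m)

    -- For the exponential character this is S(tx, ty, w; p), taken over all residues with weight 0
    -- on the excluded ones.
    corr : ℤ → ℤ → Carrier
    corr t w = sum (λ m → term t w (ι m))

    -- The ring has no conjugation; `corr` at - t takes the place of the conjugate of `corr` at t.
    moment : ℤ → Carrier
    moment t = sum (λ w → corr t (ι w) * corr (ℤ.- t) (ι w))

    -- Phases need comparing only at good arguments: elsewhere an inverse takes its default value,
    -- and the indicator removes the term.
    term-cong : ∀ t t′ {w w′ m m′} → (Good w m → Good w′ m′) → (Good w′ m′ → Good w m) →
      (Good w m → t ℤ.* phase w m ≋ t′ ℤ.* phase w′ m′) → term t w m ≈ term t′ w′ m′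
    term-cong t t′ {w} {w′} {m} {m′} f g h with good? w m | good? w′ m′
    ... | yes a | yes _ = ×-congʳ 1 (χ-cong (h a))
    ... | no _  | no _  = refl
    ... | yes a | no ¬b = contradiction (f a) ¬b
    ... | no ¬a | yes b = contradiction (g b) ¬a

    Good-resp-≋ : ∀ {w w′ m m′} → w ≋ w′ → m ≋ m′ → Good w m → Good w′ m′
    Good-resp-≋ h k (a , b) = a ∘ ∣-resp-≋ (≋-sym k) , b ∘ ∣-resp-≋ (≋-sym (+-≋ k h))

    inv-cong : ∀ {a b} → a ≋ b → inv a ≋ inv b
    inv-cong h = ≋-reflexive (≡.cong +_ (inverse-cong h))

    term-resp-≋ : ∀ t {w w′ m m′} → w ≋ w′ → m ≋ m′ → term t w m ≈ term t w′ m′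
    term-resp-≋ t h k = term-cong t t (Good-resp-≋ h k) (Good-resp-≋ (≋-sym h) (≋-sym k))
      (λ _ → *-≋ (≋-refl {t}) (+-≋ (*-≋ (≋-refl {x}) (inv-cong k))
                                    (*-≋ (≋-refl {y}) (inv-cong (+-≋ k h)))))

    module _ {t s : ℤ} (ts≋1 : t ℤ.* s ≋ 1ℤ) where

      p∤s : ¬ + p ∣ s
      p∤s h = ∤1 (∣-resp-≋ ts≋1 (∣n⇒∣m*n t h))

      inv-scale : ∀ {a} → ¬ + p ∣ a → t ℤ.* inv a ≋ inv (s ℤ.* a)
      inv-scale {a} p∤a = inverse-unique {s ℤ.* a} (≋-trans
        (≋-reflexive (solve 4 (λ s a t v → (s :* a) :* (t :* v) := (t :* s) :* (a :* v))
          ≡.refl s a t (inv a)))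
        (*-≋ ts≋1 (*-inv p∤a)))
        (*-inv ([ p∤s , p∤a ]′ ∘ ∣-euclid s a))

      term-scale : ∀ u w m → term (u ℤ.* t) w m ≈ term u (s ℤ.* w) (s ℤ.* m)
      term-scale u w m = term-cong (u ℤ.* t) u
        (λ { (a , b) → scaled a , scaled b ∘ ∣-resp (≡.sym (ℤ.*-distribˡ-+ s m w)) })
        (λ { (a , b) → a ∘ ∣n⇒∣m*n s , b ∘ ∣-resp (ℤ.*-distribˡ-+ s m w) ∘ ∣n⇒∣m*n s })
        (λ { (a , b) → ≋-trans
          (≋-reflexive (solve 6 (λ u t x v y z → u :* t :* (x :* v :+ y :* z)
              := u :* (x :* (t :* v) :+ y :* (t :* z))) ≡.refl u t x (inv m) y (inv (m ℤ.+ w))))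
          (*-≋ (≋-refl {u}) (+-≋ (*-≋ (≋-refl {x}) (inv-scale a))
            (*-≋ (≋-refl {y}) (≋-trans (inv-scale b)
              (≋-reflexive (≡.cong inv (ℤ.*-distribˡ-+ s m w))))))) })
        where
        scaled : ∀ {a} → ¬ + p ∣ a → ¬ + p ∣ (s ℤ.* a)
        scaled {a} p∤a = [ p∤s , p∤a ]′ ∘ ∣-euclid s a

      sum-scale : (F : ℤ → Carrier) → (∀ {a b} → a ≋ b → F a ≈ F b) →
        sum (λ i → F (s ℤ.* ι i)) ≈ sum (λ i → F (ι i))
      sum-scale F F-cong = sum-reindex F F-cong (s ℤ.*_) (t ℤ.*_)
        (*-≋ (≋-refl {s})) (*-≋ (≋-refl {t}))
        (λ a → undo (solve 3 (λ s t a → s :* (t :* a) := (t :* s) :* a) ≡.refl s t a))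
        (λ a → undo (≡.sym (ℤ.*-assoc t s a)))
        where
        undo : ∀ {a b} → b ≡ (t ℤ.* s) ℤ.* a → b ≋ a
        undo {a} e = ≋-trans (≋-reflexive e) (≋-trans (*-≋ ts≋1 (≋-refl {a}))
          (≋-reflexive (ℤ.*-identityˡ a)))

      -- The factor `u` allows the same substitution in both factors of `moment`, with u = 1 and u =
      -- - 1.
      corr-scale : ∀ u w → corr (u ℤ.* t) w ≈ corr u (s ℤ.* w)
      corr-scale u w = trans (sum-cong-≋ (λ m → term-scale u w (ι m)))
        (sum-scale (λ m → term u (s ℤ.* w) m) (term-resp-≋ u (≋-refl {s ℤ.* w})))

      corr-cong : ∀ u {w w′} → w ≋ w′ → corr u w ≈ corr u w′
      corr-cong u h = sum-cong-≋ (λ m → term-resp-≋ u h (≋-refl {ι m}))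

      moment-scale : moment t ≈ moment 1ℤ
      moment-scale = trans
        (sum-cong-≋ (λ w → *-cong
          (trans (reflexive (≡.cong (λ u → corr u (ι w)) (≡.sym (ℤ.*-identityˡ t))))
                 (corr-scale 1ℤ (ι w)))
          (trans (reflexive (≡.cong (λ u → corr u (ι w)) (≡.sym (ℤ.-1*i≡-i t))))
                 (corr-scale (ℤ.- 1ℤ) (ι w)))))
        (sum-scale (λ w → corr 1ℤ w * corr (ℤ.- 1ℤ) w)
          (λ h → *-cong (corr-cong 1ℤ h) (corr-cong (ℤ.- 1ℤ) h)))

    term-*-term : ∀ t w m n → term t w m * term (ℤ.- t) w n
      ≈ (indicator (good? w m) ℕ.* indicator (good? w n)) ·ℕ χ (t ℤ.* (phase w m - phase w n))
    term-*-term t w m n = trans (·ℕ-* (indicator (good? w m)) (indicator (good? w n)) _ _)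
      (×-congʳ (indicator (good? w m) ℕ.* indicator (good? w n))
        (trans (sym (homo (t ℤ.* phase w m) (ℤ.- t ℤ.* phase w n)))
          (reflexive (≡.cong χ (solve 3 (λ t a b → t :* a :+ (:- t) :* b := t :* (a :- b))
            ≡.refl t (phase w m) (phase w n))))))

    sum-term-*-term : ∀ w m n → sum (λ t → term (ι t) w m * term (ℤ.- ι t) w n)
      ≈ indicator (collision? w m n) ·ℕ (p ·ℕ 1#)
    sum-term-*-term w m n = begin
      sum (λ t → term (ι t) w m * term (ℤ.- ι t) w n)
        ≈⟨ sum-cong-≋ (λ t → term-*-term (ι t) w m n) ⟩
      sum (λ t → k ·ℕ χ (ι t ℤ.* (phase w m - phase w n)))
        ≈⟨ sum-·ℕˡ k (λ t → χ (ι t ℤ.* (phase w m - phase w n))) ⟩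
      k ·ℕ sum (λ t → χ (ι t ℤ.* (phase w m - phase w n)))
        ≈⟨ ×-congʳ k (orthogonality (phase w m) (phase w n)) ⟩
      k ·ℕ (l ·ℕ (p ·ℕ 1#))      ≈⟨ ×-assocˡ (p ·ℕ 1#) k l ⟩
      (k ℕ.* l) ·ℕ (p ·ℕ 1#)
        ≡⟨ ≡.cong (_·ℕ (p ·ℕ 1#)) (≡.trans (ℕ.*-assoc g _ l)
             (≡.sym (≡.trans (indicator-×-dec (good? w m) _)
               (≡.cong (g ℕ.*_) (indicator-×-dec (good? w n) (phase w m ≋? phase w n)))))) ⟩
      indicator (collision? w m n) ·ℕ (p ·ℕ 1#)   ∎
      where
      g = indicator (good? w m)
      k = g ℕ.* indicator (good? w n)
      l = indicator (phase w m ≋? phase w n)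

    sum-moment : sum (λ t → moment (ι t)) ≈ sumℕ (λ w → collisions (ι w)) ·ℕ (p ·ℕ 1#)
    sum-moment = begin
      sum (λ t → sum (λ w → corr (ι t) (ι w) * corr (ℤ.- ι t) (ι w)))
        ≈⟨ ∑-comm (λ t w → corr (ι t) (ι w) * corr (ℤ.- ι t) (ι w)) ⟩
      sum (λ w → sum (λ t → corr (ι t) (ι w) * corr (ℤ.- ι t) (ι w)))
        ≈⟨ sum-cong-≋ (λ w → trans
             (sum-cong-≋ (λ t → sum-* (λ m → term (ι t) (ι w) (ι m)) (λ n → term (ℤ.- ι t) (ι w) (ι n))))
             (∑-comm (λ t m → sum (λ n → term (ι t) (ι w) (ι m) * term (ℤ.- ι t) (ι w) (ι n))))) ⟩
      sum (λ w → sum (λ m → sum (λ t → sum (λ n → term (ι t) (ι w) (ι m) * term (ℤ.- ι t) (ι w) (ι n)))))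
        ≈⟨ sum-cong-≋ (λ w → sum-cong-≋ (λ m → trans
             (∑-comm (λ t n → term (ι t) (ι w) (ι m) * term (ℤ.- ι t) (ι w) (ι n)))
             (sum-cong-≋ (λ n → sum-term-*-term (ι w) (ι m) (ι n))))) ⟩
      sum (λ w → sum (λ m → sum (λ n → indicator (collision? (ι w) (ι m) (ι n)) ·ℕ c)))
        ≈⟨ sum-cong-≋ (λ w → trans
             (sum-cong-≋ (λ m → sum-·ℕʳ (λ n → indicator (collision? (ι w) (ι m) (ι n))) c))
             (sum-·ℕʳ (λ m → sumℕ (λ n → indicator (collision? (ι w) (ι m) (ι n)))) c)) ⟩
      sum (λ w → collisions (ι w) ·ℕ c)
        ≈⟨ sum-·ℕʳ (λ w → collisions (ι w)) c ⟩
      sumℕ (λ w → collisions (ι w)) ·ℕ c   ∎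
      where
      c = p ·ℕ 1#

    second-moment : moment 0ℤ + ℕ.pred p ·ℕ moment 1ℤ
      ≈ sumℕ (λ w → collisions (ι w)) ·ℕ (p ·ℕ 1#)
    second-moment = trans (sym (trans
      (sum-constant-tail p (λ t → moment (ι t)) z z≡0 (λ t t≢0 →
        moment-scale {ι t} {inv (ι t)} (*-inv (λ h → t≢0 (<∧∣⇒≡0 (toℕ<n t) h)))))
      (+-congʳ (reflexive (≡.cong (λ k → moment (+ k)) z≡0)))))
      sum-moment
      where
      z = residue 0ℤ
      z≡0 : toℕ z ≡ 0
      z≡0 = <∧∣⇒≡0 (toℕ<n z)
        (∣-resp-≋ (≋-sym (ι-residue 0ℤ)) (divides 0ℤ ≡.refl))

-- The field ℚ(i), as a ring with the ℓ¹ norm.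

module GaussianRationals where

  open import Algebra.Solver.Ring.AlmostCommutativeRing using (fromCommutativeRing)
  import Algebra.Solver.Ring.Simple as RingSolver
  open import Data.Nat.Base using (suc)
  open import Data.Product.Base using (_,_)
  open import Data.Rational
  open import Data.Rational.Properties
  open import Data.Rational.Solver using (module +-*-Solver)
  open import Data.Sum.Base using (inj₁; inj₂)
  open import Relation.Binary.Definitions using (DecidableEquality)
  open import Relation.Binary.PropositionalEquality
  open import Relation.Nullary.Decidable using (map′; _×-dec_)
  open +-*-Solver using (solve; _:=_; _:+_; _:*_; :-_; _:-_; con)

  0ᵍ 1ᵍ 𝕚 : ℚ[i]
  0ᵍ = 0ℚ +i 0ℚ
  1ᵍ = 1ℚ +i 0ℚ
  𝕚  = 0ℚ +i 1ℚ

  ⊝_ : ℚ[i] → ℚ[i]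
  ⊝ (a +i b) = (- a) +i (- b)

  conj : ℚ[i] → ℚ[i]
  conj (a +i b) = a +i (- b)

  normSq : ℚ[i] → ℚ
  normSq (a +i b) = a * a + b * b

  commutativeRing : CommutativeRing 0ℓ 0ℓ
  commutativeRing = record
    { Carrier = ℚ[i] ; _≈_ = _≡_ ; _+_ = _⊕_ ; _*_ = _⊗_ ; -_ = ⊝_ ; 0# = 0ᵍ ; 1# = 1ᵍ
    ; isCommutativeRing = record
      { isRing = record
        { +-isAbelianGroup = record
          { isGroup = record
            { isMonoid = record
              { isSemigroup = record
                { isMagma = record { isEquivalence = isEquivalence ; ∙-cong = cong₂ _⊕_ }
                ; assoc = λ { (a +i b) (c +i d) (e +i f) →
                    cong₂ _+i_ (+-assoc a c e) (+-assoc b d f) } }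
              ; identity = (λ { (a +i b) → cong₂ _+i_ (+-identityˡ a) (+-identityˡ b) })
                         , (λ { (a +i b) → cong₂ _+i_ (+-identityʳ a) (+-identityʳ b) }) }
            ; inverse = (λ { (a +i b) → cong₂ _+i_ (+-inverseˡ a) (+-inverseˡ b) })
                      , (λ { (a +i b) → cong₂ _+i_ (+-inverseʳ a) (+-inverseʳ b) })
            ; ⁻¹-cong = cong ⊝_ }
          ; comm = λ { (a +i b) (c +i d) → cong₂ _+i_ (+-comm a c) (+-comm b d) } }
        ; *-cong = cong₂ _⊗_
        ; *-assoc = assoc
        ; *-identity = (λ { (a +i b) → cong₂ _+i_
              (solve 2 (λ a b → con 1ℚ :* a :- con 0ℚ :* b := a) refl a b)
              (solve 2 (λ a b → con 1ℚ :* b :+ con 0ℚ :* a := b) refl a b) })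
            , (λ { (a +i b) → cong₂ _+i_
              (solve 2 (λ a b → a :* con 1ℚ :- b :* con 0ℚ := a) refl a b)
              (solve 2 (λ a b → a :* con 0ℚ :+ b :* con 1ℚ := b) refl a b) })
        ; distrib = (λ { (a +i b) (c +i d) (e +i f) → cong₂ _+i_
              (solve 6 (λ a b c d e f → a :* (c :+ e) :- b :* (d :+ f)
                := (a :* c :- b :* d) :+ (a :* e :- b :* f)) refl a b c d e f)
              (solve 6 (λ a b c d e f → a :* (d :+ f) :+ b :* (c :+ e)
                := (a :* d :+ b :* c) :+ (a :* f :+ b :* e)) refl a b c d e f) })
            , (λ { (a +i b) (c +i d) (e +i f) → cong₂ _+i_
              (solve 6 (λ a b c d e f → (c :+ e) :* a :- (d :+ f) :* b
                := (c :* a :- d :* b) :+ (e :* a :- f :* b)) refl a b c d e f)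
              (solve 6 (λ a b c d e f → (c :+ e) :* b :+ (d :+ f) :* a
                := (c :* b :+ d :* a) :+ (e :* b :+ f :* a)) refl a b c d e f) }) }
      ; *-comm = λ { (a +i b) (c +i d) → cong₂ _+i_
              (solve 4 (λ a b c d → a :* c :- b :* d := c :* a :- d :* b) refl a b c d)
              (solve 4 (λ a b c d → a :* d :+ b :* c := c :* b :+ d :* a) refl a b c d) } } }
    where
    assoc : ∀ u v w → (u ⊗ v) ⊗ w ≡ u ⊗ (v ⊗ w)
    assoc (a +i b) (c +i d) (e +i f) = cong₂ _+i_
      (solve 6 (λ a b c d e f → (a :* c :- b :* d) :* e :- (a :* d :+ b :* c) :* f
        := a :* (c :* e :- d :* f) :- b :* (c :* f :+ d :* e)) refl a b c d e f)
      (solve 6 (λ a b c d e f → (a :* c :- b :* d) :* f :+ (a :* d :+ b :* c) :* e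
        := a :* (c :* f :+ d :* e) :+ b :* (c :* e :- d :* f)) refl a b c d e f)

  _≟ᵍ_ : DecidableEquality ℚ[i]
  (a +i b) ≟ᵍ (c +i d) = map′ (λ { (refl , refl) → refl }) (λ { refl → refl , refl })
    ((a ≟ c) ×-dec (b ≟ d))

  module ℚ[i]-Solver = RingSolver (fromCommutativeRing commutativeRing) _≟ᵍ_
  open ℚ[i]-Solver using () renaming (_:=_ to _≐_; _:*_ to _⊛_)

  fromℕ-2 : fromℕ 2 ≡ 1ℚ + 1ℚ
  fromℕ-2 = trans (fromℕ-+ 1 1) (cong₂ _+_ fromℕ-1 fromℕ-1)

  fromℕ-4 : fromℕ 4 ≡ 1ℚ + 1ℚ + (1ℚ + 1ℚ)
  fromℕ-4 = trans (fromℕ-+ 2 2) (cong₂ _+_ fromℕ-2 fromℕ-2)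

  1/suc-1 : 1/suc 1 ≡ ½
  1/suc-1 = begin
    1/suc 1                     ≡⟨ solve 1 (λ r → r := con ½ :* ((con 1ℚ :+ con 1ℚ) :* r)) refl (1/suc 1) ⟩
    ½ * ((1ℚ + 1ℚ) * 1/suc 1)   ≡⟨ cong (λ t → ½ * (t * 1/suc 1)) fromℕ-2 ⟨
    ½ * (fromℕ 2 * 1/suc 1)     ≡⟨ cong (½ *_) (1/suc-inverse 1) ⟩
    ½ * 1ℚ                      ≡⟨ *-identityʳ ½ ⟩
    ½                           ∎
    where open ≡-Reasoning

  ‖⊝‖ : ∀ u → ‖ ⊝ u ‖ ≡ ‖ u ‖
  ‖⊝‖ (a +i b) = cong₂ _+_ (∣-p∣≡∣p∣ a) (∣-p∣≡∣p∣ b)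

  ‖⊖‖-sym : ∀ u v → ‖ u ⊖ v ‖ ≡ ‖ v ⊖ u ‖
  ‖⊖‖-sym (a +i b) (c +i d) = cong₂ _+_ (∣-∣-sym a c) (∣-∣-sym b d)

  ‖⊖‖ : ∀ u v → ‖ u ⊖ v ‖ ≤ ‖ u ‖ + ‖ v ‖
  ‖⊖‖ u v = ≤-trans (‖⊕‖ u (⊝ v)) (≤-reflexive (cong (λ t → ‖ u ‖ + t) (‖⊝‖ v)))

  ‖⊖‖-triangle : ∀ u v w → ‖ u ⊖ w ‖ ≤ ‖ u ⊖ v ‖ + ‖ v ⊖ w ‖
  ‖⊖‖-triangle u v w = ≤-trans (≤-reflexive (cong ‖_‖ (⊖-telescope u v w))) (‖⊕‖ (u ⊖ v) (v ⊖ w))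

  ‖⊗‖-mono : ∀ u v {B C} → 0ℚ ≤ C → ‖ u ‖ ≤ B → ‖ v ‖ ≤ C → ‖ u ⊗ v ‖ ≤ B * C
  ‖⊗‖-mono u v 0≤C hu hv = ≤-trans (‖⊗‖ u v) (*-mono (0≤‖ u ‖) hu 0≤C hv)

  0≤square : ∀ a → 0ℚ ≤ a * a
  0≤square a with ≤-total 0ℚ a
  ... | inj₁ 0≤a = 0≤* 0≤a 0≤a
  ... | inj₂ a≤0 = subst (0ℚ ≤_) (solve 1 (λ a → (:- a) :* (:- a) := a :* a) refl a)
    (0≤* (neg-antimono-≤ a≤0) (neg-antimono-≤ a≤0))

  ∣p∣*∣p∣ : ∀ p → ∣ p ∣ * ∣ p ∣ ≡ p * p
  ∣p∣*∣p∣ p with ∣p∣≡p∨∣p∣≡-p p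
  ... | inj₁ e = cong₂ _*_ e e
  ... | inj₂ e = trans (cong₂ _*_ e e) (solve 1 (λ p → (:- p) :* (:- p) := p :* p) refl p)

  0≤normSq : ∀ u → 0ℚ ≤ normSq u
  0≤normSq (a +i b) = 0≤+ (0≤square a) (0≤square b)

  ‖‖²≤2normSq : ∀ u → ‖ u ‖ * ‖ u ‖ ≤ normSq u + normSq u
  ‖‖²≤2normSq (a +i b) = subst (λ t → (∣ a ∣ + ∣ b ∣) * (∣ a ∣ + ∣ b ∣) ≤ t)
    (cong (λ t → t + t) (cong₂ _+_ (∣p∣*∣p∣ a) (∣p∣*∣p∣ b)))
    (subst ((∣ a ∣ + ∣ b ∣) * (∣ a ∣ + ∣ b ∣) ≤_)
      (solve 2 (λ a b → (a :+ b) :* (a :+ b) :+ (a :- b) :* (a :- b)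
        := (a :* a :+ b :* b) :+ (a :* a :+ b :* b)) refl (∣ a ∣) (∣ b ∣))
      (p≤p+q (0≤square (∣ a ∣ - ∣ b ∣))))

  ‖conj‖ : ∀ u → ‖ conj u ‖ ≡ ‖ u ‖
  ‖conj‖ (a +i b) = cong (λ t → ∣ a ∣ + t) (∣-p∣≡∣p∣ b)

  normSq-as-conj : ∀ u → u ⊗ conj u ≡ (normSq u +i 0ℚ)
  normSq-as-conj (a +i b) = cong₂ _+i_
    (solve 2 (λ a b → a :* a :- b :* (:- b) := a :* a :+ b :* b) refl a b)
    (solve 2 (λ a b → a :* (:- b) :+ b :* a := con 0ℚ) refl a b)

  conj-⊕ : ∀ u v → conj (u ⊕ v) ≡ conj u ⊕ conj v
  conj-⊕ (a +i b) (c +i d) = cong (λ t → (a + c) +i t) (neg-distrib-+ b d)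

  conj-⊗ : ∀ u v → conj (u ⊗ v) ≡ conj u ⊗ conj v
  conj-⊗ (a +i b) (c +i d) = cong₂ _+i_
    (solve 4 (λ a b c d → a :* c :- b :* d := a :* c :- (:- b) :* (:- d)) refl a b c d)
    (solve 4 (λ a b c d → :- (a :* d :+ b :* c) := a :* (:- d) :+ (:- b) :* c) refl a b c d)

  conj-· : ∀ q u → conj (q · u) ≡ q · conj u
  conj-· q (a +i b) = cong (λ t → (q * a) +i t) (neg-distribʳ-* q b)

  conj-expTerm : ∀ z k → conj (expTerm z k) ≡ expTerm (conj z) k
  conj-expTerm z 0       = refl
  conj-expTerm z (suc k) = trans (conj-· (1/suc k) (z ⊗ expTerm z k))
    (cong (1/suc k ·_) (trans (conj-⊗ z (expTerm z k)) (cong (conj z ⊗_) (conj-expTerm z k))))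

  conj-expSum : ∀ n z → conj (expSum n z) ≡ expSum n (conj z)
  conj-expSum 0       z = refl
  conj-expSum (suc n) z = trans (conj-⊕ (expSum n z) (expTerm z (suc n)))
    (cong₂ _⊕_ (conj-expSum n z) (conj-expTerm z (suc n)))

  -- The ℓ¹ norm is multiplicative up to a factor 2, as it differs from the
  -- modulus by a factor of at most √2.
  ‖‖*‖‖≤ : ∀ a u → ‖ a ‖ * ‖ a ‖ * ‖ u ‖ ≤ (1ℚ + 1ℚ) * (‖ a ‖ * ‖ a ⊗ u ‖)
  ‖‖*‖‖≤ a u = begin
    ‖ a ‖ * ‖ a ‖ * ‖ u ‖             ≤⟨ *-monoʳ (0≤‖ u ‖) (‖‖²≤2normSq a) ⟩
    (normSq a + normSq a) * ‖ u ‖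
      ≡⟨ solve 2 (λ s t → (s :+ s) :* t := (con 1ℚ :+ con 1ℚ) :* (s :* t)) refl (normSq a) (‖ u ‖) ⟩
    (1ℚ + 1ℚ) * (normSq a * ‖ u ‖)
      ≤⟨ *-monoˡ (0≤+ (<⇒≤ 0<1) (<⇒≤ 0<1)) (begin
        normSq a * ‖ u ‖                ≡⟨ ‖·‖ (0≤normSq a) u ⟨
        ‖ normSq a · u ‖                ≡⟨ cong ‖_‖ (·-⊗ (normSq a) u) ⟩
        ‖ (normSq a +i 0ℚ) ⊗ u ‖        ≡⟨ cong (λ t → ‖ t ⊗ u ‖) (normSq-as-conj a) ⟨
        ‖ (a ⊗ conj a) ⊗ u ‖
          ≡⟨ cong ‖_‖ (ℚ[i]-Solver.solve 3 (λ a c u → (a ⊛ c) ⊛ u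
               ≐ c ⊛ (a ⊛ u)) refl a (conj a) u) ⟩
        ‖ conj a ⊗ (a ⊗ u) ‖            ≤⟨ ‖⊗‖ (conj a) (a ⊗ u) ⟩
        ‖ conj a ‖ * ‖ a ⊗ u ‖          ≡⟨ cong (_* ‖ a ⊗ u ‖) (‖conj‖ a) ⟩
        ‖ a ‖ * ‖ a ⊗ u ‖               ∎) ⟩
    (1ℚ + 1ℚ) * (‖ a ‖ * ‖ a ⊗ u ‖)   ∎
    where
    open ≤-Reasoning
    ·-⊗ : ∀ q u → q · u ≡ (q +i 0ℚ) ⊗ u
    ·-⊗ q (c +i d) = cong₂ _+i_
      (solve 3 (λ q c d → q :* c := q :* c :- con 0ℚ :* d) refl q c d)
      (solve 3 (λ q c d → q :* d := q :* d :+ con 0ℚ :* c) refl q c d)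

  -- A quantitative cancellation law: it remains valid in the limit, and so shows that a sequence
  -- bounded away from 0 is no zero divisor modulo null sequences.
  ‖u‖≤4‖a⊗u‖ : ∀ a u → ½ ≤ ‖ a ‖ → ‖ u ‖ ≤ fromℕ 4 * ‖ a ⊗ u ‖
  ‖u‖≤4‖a⊗u‖ a u ½≤a = ≤-trans (begin
    ‖ u ‖                         ≡⟨ solve 1 (λ u → u := (con 1ℚ :+ con 1ℚ) :* (con ½ :* u)) refl (‖ u ‖) ⟩
    (1ℚ + 1ℚ) * (½ * ‖ u ‖)
      ≤⟨ *-monoˡ 0≤2 (*-monoʳ (0≤‖ u ‖) ½≤a) ⟩
    (1ℚ + 1ℚ) * (‖ a ‖ * ‖ u ‖)
      ≤⟨ *-monoˡ 0≤2 (*-cancelˡ-≤-pos (‖ a ‖) {{positive (<-≤-trans 0<½ ½≤a)}} (begin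
        ‖ a ‖ * (‖ a ‖ * ‖ u ‖)             ≡⟨ *-assoc (‖ a ‖) (‖ a ‖) (‖ u ‖) ⟨
        ‖ a ‖ * ‖ a ‖ * ‖ u ‖               ≤⟨ ‖‖*‖‖≤ a u ⟩
        (1ℚ + 1ℚ) * (‖ a ‖ * ‖ a ⊗ u ‖)
          ≡⟨ solve 3 (λ t a b → t :* (a :* b) := a :* (t :* b)) refl (1ℚ + 1ℚ) (‖ a ‖) (‖ a ⊗ u ‖) ⟩
        ‖ a ‖ * ((1ℚ + 1ℚ) * ‖ a ⊗ u ‖)     ∎)) ⟩
    (1ℚ + 1ℚ) * ((1ℚ + 1ℚ) * ‖ a ⊗ u ‖)   ∎)
    (≤-reflexive (trans (sym (*-assoc (1ℚ + 1ℚ) (1ℚ + 1ℚ) (‖ a ⊗ u ‖)))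
      (cong (_* ‖ a ⊗ u ‖) (sym fromℕ-4))))
    where
    open ≤-Reasoning
    0≤2 : 0ℚ ≤ 1ℚ + 1ℚ
    0≤2 = 0≤+ (<⇒≤ 0<1) (<⇒≤ 0<1)

-- The law of exponents for partial sums, with an explicit error.

module ExponentialLaw where

  open GaussianRationals
  open import Data.Nat.Base as ℕ using (suc)
  import Data.Nat.Properties as ℕ
  open import Data.Product.Base using (_,_)
  open import Data.Rational
  open import Data.Rational.Properties
  open import Data.Rational.Solver using (module +-*-Solver)
  open import Data.Sum.Base using (inj₁; inj₂)
  open import Function.Base using (_∘_)
  open import Relation.Binary.PropositionalEquality
  module ℚSolver = +-*-Solver
  open ℚSolver using () renaming (_:=_ to _≐_; _:+_ to _⊞_; _:*_ to _⊛_; _:-_ to _⊟_)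
  open ℚ[i]-Solver using (solve; _:=_; _:+_; _:*_; _:-_; con)

  ν : ℕ → ℚ[i]
  ν n = fromℕ n +i 0ℚ

  ν-suc : ∀ n → ν (suc n) ≡ ν n ⊕ 1ᵍ
  ν-suc n = cong (_+i 0ℚ) (fromℕ-suc n)

  ν-1 : ν 1 ≡ 1ᵍ
  ν-1 = cong (_+i 0ℚ) fromℕ-1

  ν-suc-⊗-1/suc : ∀ n u → ν (suc n) ⊗ (1/suc n · u) ≡ u
  ν-suc-⊗-1/suc n (a +i b) = cong₂ _+i_
    (trans (lemma a b) (trans (cong (_* a) (1/suc-inverse n)) (*-identityˡ a)))
    (trans (lemma′ a b) (trans (cong (_* b) (1/suc-inverse n)) (*-identityˡ b)))
    where
    lemma : ∀ a b → fromℕ (suc n) * (1/suc n * a) - 0ℚ * (1/suc n * b) ≡ fromℕ (suc n) * 1/suc n * a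
    lemma a b = ℚSolver.solve 4 (λ m r a b → m ⊛ (r ⊛ a)
      ⊟ ℚSolver.con 0ℚ ⊛ (r ⊛ b) ≐ m ⊛ r ⊛ a)
      refl (fromℕ (suc n)) (1/suc n) a b
    lemma′ : ∀ a b → fromℕ (suc n) * (1/suc n * b) + 0ℚ * (1/suc n * a) ≡ fromℕ (suc n) * 1/suc n * b
    lemma′ a b = ℚSolver.solve 4 (λ m r a b → m ⊛ (r ⊛ b)
      ⊞ ℚSolver.con 0ℚ ⊛ (r ⊛ a) ≐ m ⊛ r ⊛ b)
      refl (fromℕ (suc n)) (1/suc n) a b

  ·-⊗-assoc : ∀ q u v → q · (u ⊗ v) ≡ u ⊗ (q · v)
  ·-⊗-assoc q (a +i b) (c +i d) = cong₂ _+i_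
    (ℚSolver.solve 5 (λ q a b c d → q ⊛ (a ⊛ c ⊟ b ⊛ d)
      ≐ a ⊛ (q ⊛ c) ⊟ b ⊛ (q ⊛ d)) refl q a b c d)
    (ℚSolver.solve 5 (λ q a b c d → q ⊛ (a ⊛ d ⊞ b ⊛ c)
      ≐ a ⊛ (q ⊛ d) ⊞ b ⊛ (q ⊛ c)) refl q a b c d)

  -- The n-th coefficient of the Cauchy product of two power series.
  conv : (ℕ → ℚ[i]) → (ℕ → ℚ[i]) → ℕ → ℚ[i]
  conv f g 0       = f 0 ⊗ g 0
  conv f g (suc n) = f 0 ⊗ g (suc n) ⊕ conv (f ∘ suc) g n

  conv-cong : ∀ {f f′ g g′} → f ≗ f′ → g ≗ g′ → ∀ n → conv f g n ≡ conv f′ g′ n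
  conv-cong h k 0       = cong₂ _⊗_ (h 0) (k 0)
  conv-cong h k (suc n) = cong₂ _⊕_ (cong₂ _⊗_ (h 0) (k (suc n))) (conv-cong (h ∘ suc) k n)

  conv-⊕ : ∀ f f′ g n → conv (λ k → f k ⊕ f′ k) g n ≡ conv f g n ⊕ conv f′ g n
  conv-⊕ f f′ g 0       = solve 3 (λ a b c → (a :+ b) :* c := a :* c :+ b :* c) refl (f 0) (f′ 0) (g 0)
  conv-⊕ f f′ g (suc n) = trans (cong ((f 0 ⊕ f′ 0) ⊗ g (suc n) ⊕_) (conv-⊕ (f ∘ suc) (f′ ∘ suc) g n))
    (solve 5 (λ a b c d e → (a :+ b) :* c :+ (d :+ e) := (a :* c :+ d) :+ (b :* c :+ e)) refl
      (f 0) (f′ 0) (g (suc n)) (conv (f ∘ suc) g n) (conv (f′ ∘ suc) g n))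

  conv-⊖ʳ : ∀ f g h n → conv f (λ k → g k ⊖ h k) n ≡ conv f g n ⊖ conv f h n
  conv-⊖ʳ f g h 0       = solve 3 (λ a b c → a :* (b :- c) := a :* b :- a :* c) refl (f 0) (g 0) (h 0)
  conv-⊖ʳ f g h (suc n) = trans (cong (f 0 ⊗ (g (suc n) ⊖ h (suc n)) ⊕_) (conv-⊖ʳ (f ∘ suc) g h n))
    (solve 5 (λ a b c d e → a :* (b :- c) :+ (d :- e) := (a :* b :+ d) :- (a :* c :+ e)) refl
      (f 0) (g (suc n)) (h (suc n)) (conv (f ∘ suc) g n) (conv (f ∘ suc) h n))

  conv-⊗ˡ : ∀ c f g n → conv (λ k → c ⊗ f k) g n ≡ c ⊗ conv f g n
  conv-⊗ˡ c f g 0       = solve 3 (λ c a b → (c :* a) :* b := c :* (a :* b)) refl c (f 0) (g 0)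
  conv-⊗ˡ c f g (suc n) = trans (cong ((c ⊗ f 0) ⊗ g (suc n) ⊕_) (conv-⊗ˡ c (f ∘ suc) g n))
    (solve 4 (λ c a b d → (c :* a) :* b :+ c :* d := c :* (a :* b :+ d)) refl
      c (f 0) (g (suc n)) (conv (f ∘ suc) g n))

  conv-⊗ʳ : ∀ c f g n → conv f (λ k → c ⊗ g k) n ≡ c ⊗ conv f g n
  conv-⊗ʳ c f g 0       = solve 3 (λ c a b → a :* (c :* b) := c :* (a :* b)) refl c (f 0) (g 0)
  conv-⊗ʳ c f g (suc n) = trans (cong (f 0 ⊗ (c ⊗ g (suc n)) ⊕_) (conv-⊗ʳ c (f ∘ suc) g n))
    (solve 4 (λ c a b d → a :* (c :* b) :+ c :* d := c :* (a :* b :+ d)) refl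
      c (f 0) (g (suc n)) (conv (f ∘ suc) g n))

  -- The derivation f ↦ f ′ of formal power series: Leibniz's rule shows that
  -- the convolution of two exponential series solves the same differential
  -- equation as the exponential series of the sum.
  _′ : (ℕ → ℚ[i]) → ℕ → ℚ[i]
  (f ′) k = ν (suc k) ⊗ f (suc k)

  -- In the inductive step one of the n + 2 copies of the tail is split off. It makes up for the
  -- difference between the shifted derivative of `f` and the derivative of the shifted `f`, which
  -- is `f` shifted twice.
  leibniz : ∀ f g n → ν (suc n) ⊗ conv f g (suc n) ≡ conv (f ′) g n ⊕ conv f (g ′) n
  leibniz f g 0 = solve 5 (λ n a b c d → n :* (a :* d :+ b :* c) := (n :* b) :* c :+ a :* (n :* d))
    refl (ν 1) (f 0) (f 1) (g 0) (g 1)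
  leibniz f g (suc n) = begin
    ν (suc (suc n)) ⊗ (f 0 ⊗ g (suc (suc n)) ⊕ c)
      ≡⟨ solve 3 (λ m a c → m :* (a :+ c) := m :* a :+ m :* c) refl (ν (suc (suc n))) a c ⟩
    ν (suc (suc n)) ⊗ a ⊕ ν (suc (suc n)) ⊗ c
      ≡⟨ cong (λ t → ν (suc (suc n)) ⊗ a ⊕ t ⊗ c) (ν-suc (suc n)) ⟩
    ν (suc (suc n)) ⊗ a ⊕ (ν (suc n) ⊕ 1ᵍ) ⊗ c
      ≡⟨ solve 4 (λ m a n c → m :* a :+ (n :+ con 1ᵍ) :* c := m :* a :+ (n :* c :+ c)) refl
           (ν (suc (suc n))) a (ν (suc n)) c ⟩
    ν (suc (suc n)) ⊗ a ⊕ (ν (suc n) ⊗ c ⊕ c)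
      ≡⟨ cong (λ t → ν (suc (suc n)) ⊗ a ⊕ (t ⊕ c)) (leibniz (f ∘ suc) g n) ⟩
    ν (suc (suc n)) ⊗ a ⊕ ((d ⊕ l) ⊕ (f 1 ⊗ g (suc n) ⊕ k))
      ≡⟨ solve 8 (λ m x y d e z w k → m :* (x :* y) :+ ((d :+ e) :+ (z :* w :+ k))
           := ((con 1ᵍ :* z) :* w :+ (d :+ k)) :+ (x :* (m :* y) :+ e)) refl
           (ν (suc (suc n))) (f 0) (g (suc (suc n))) d l (f 1) (g (suc n)) k ⟩
    ((1ᵍ ⊗ f 1) ⊗ g (suc n) ⊕ (d ⊕ k)) ⊕ (f 0 ⊗ (g ′) (suc n) ⊕ l)
      ≡⟨ cong₂ (λ s t → ((s ⊗ f 1) ⊗ g (suc n) ⊕ t) ⊕ (f 0 ⊗ (g ′) (suc n) ⊕ l)) (sym ν-1) (sym shift) ⟩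
    conv (f ′) g (suc n) ⊕ conv f (g ′) (suc n) ∎
    where
    open ≡-Reasoning
    a = f 0 ⊗ g (suc (suc n))
    c = conv (f ∘ suc) g (suc n)
    d = conv ((f ∘ suc) ′) g n
    l = conv (f ∘ suc) (g ′) n
    k = conv (f ∘ suc ∘ suc) g n
    shift : conv ((f ′) ∘ suc) g n ≡ d ⊕ k
    shift = trans (conv-cong {g = g} (λ j → trans (cong (_⊗ f (suc (suc j))) (ν-suc (suc j)))
        (solve 2 (λ m a → (m :+ con 1ᵍ) :* a := m :* a :+ a) refl (ν (suc j)) (f (suc (suc j)))))
        (λ _ → refl) n)
      (conv-⊕ ((f ∘ suc) ′) (f ∘ suc ∘ suc) g n)

  -- Both sides start with 1 and obey (n + 1) c(n + 1) = (z + w) c(n); this avoids binomial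
  -- coefficients.
  conv-expTerm : ∀ z w n → conv (expTerm z) (expTerm w) n ≡ expTerm (z ⊕ w) n
  conv-expTerm z w 0       = solve 0 (con 1ᵍ :* con 1ᵍ := con 1ᵍ) refl
  conv-expTerm z w (suc n) = begin
    conv t s (suc n)
      ≡⟨ ν-suc-⊗-1/suc n (conv t s (suc n)) ⟨
    ν (suc n) ⊗ (1/suc n · conv t s (suc n))
      ≡⟨ ·-⊗-assoc (1/suc n) (ν (suc n)) (conv t s (suc n)) ⟨
    1/suc n · (ν (suc n) ⊗ conv t s (suc n))
      ≡⟨ cong (1/suc n ·_) (begin
        ν (suc n) ⊗ conv t s (suc n)         ≡⟨ leibniz t s n ⟩
        conv (t ′) s n ⊕ conv t (s ′) n
          ≡⟨ cong₂ _⊕_ (trans (conv-cong {g = s} (derivative z) (λ _ → refl) n) (conv-⊗ˡ z t s n))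
                       (trans (conv-cong {f = t} (λ _ → refl) (derivative w) n) (conv-⊗ʳ w t s n)) ⟩
        z ⊗ conv t s n ⊕ w ⊗ conv t s n
          ≡⟨ solve 3 (λ z w c → z :* c :+ w :* c := (z :+ w) :* c) refl z w (conv t s n) ⟩
        (z ⊕ w) ⊗ conv t s n                 ≡⟨ cong ((z ⊕ w) ⊗_) (conv-expTerm z w n) ⟩
        (z ⊕ w) ⊗ expTerm (z ⊕ w) n          ∎) ⟩
    expTerm (z ⊕ w) (suc n) ∎
    where
    open ≡-Reasoning
    t = expTerm z
    s = expTerm w
    derivative : ∀ z k → (expTerm z ′) k ≡ z ⊗ expTerm z k
    derivative z k = ν-suc-⊗-1/suc k (z ⊗ expTerm z k)

  psum : (ℕ → ℚ[i]) → ℕ → ℚ[i]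
  psum f 0       = f 0
  psum f (suc n) = psum f n ⊕ f (suc n)

  psum-cong : ∀ {f g} → f ≗ g → psum f ≗ psum g
  psum-cong h 0       = h 0
  psum-cong h (suc n) = cong₂ _⊕_ (psum-cong h n) (h (suc n))

  psum-expTerm : ∀ z n → psum (expTerm z) n ≡ expSum n z
  psum-expTerm z 0       = refl
  psum-expTerm z (suc n) = cong (_⊕ expTerm z (suc n)) (psum-expTerm z n)

  -- Partial summation is convolution with the series 1 + 1 + ..., so this is an instance of
  -- associativity.
  psum-conv : ∀ f g n → psum (conv f g) n ≡ conv f (psum g) n
  psum-conv f g 0       = refl
  psum-conv f g (suc n) = trans (cong (_⊕ conv f g (suc n)) (psum-conv f g n)) (sym (step f n))
    where
    step : ∀ f n → conv f (psum g) (suc n) ≡ conv f (psum g) n ⊕ conv f g (suc n)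
    step f 0       = solve 4 (λ a b c d → a :* (c :+ d) :+ b :* c := a :* c :+ (a :* d :+ b :* c)) refl
      (f 0) (f 1) (g 0) (g 1)
    step f (suc n) = trans
      (cong (f 0 ⊗ (psum g (suc n) ⊕ g (suc (suc n))) ⊕_) (step (f ∘ suc) n))
      (solve 5 (λ a b c d e → a :* (b :+ c) :+ (d :+ e) := (a :* b :+ d) :+ (a :* c :+ e)) refl
        (f 0) (psum g (suc n)) (g (suc (suc n)))
        (conv (f ∘ suc) (psum g) n) (conv (f ∘ suc) g (suc n)))

  conv-constant : ∀ f c n → conv f (λ _ → c) n ≡ psum f n ⊗ c
  conv-constant f c 0       = refl
  conv-constant f c (suc n) = trans (cong (f 0 ⊗ c ⊕_) (conv-constant (f ∘ suc) c n))
    (trans (solve 3 (λ a c s → a :* c :+ s :* c := (a :+ s) :* c) refl (f 0) c (psum (f ∘ suc) n))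
      (cong (_⊗ c) (sym (front f n))))
    where
    front : ∀ f n → psum f (suc n) ≡ f 0 ⊕ psum (f ∘ suc) n
    front f 0       = refl
    front f (suc n) = trans (cong (_⊕ f (suc (suc n))) (front f n))
      (solve 3 (λ a b c → (a :+ b) :+ c := a :+ (b :+ c)) refl (f 0) (psum (f ∘ suc) n) (f (suc (suc n))))

  -- The partial sums of the product series are sums of z^k/k! times the partial sum of exp w of
  -- order n - k. The error thus pairs the terms of exp z with tails of exp w: for small k the tail
  -- is small, for large k the term is.
  expSum-law-error : ∀ z w n → (expSum n z ⊗ expSum n w) ⊖ expSum n (z ⊕ w)
    ≡ conv (expTerm z) (λ j → expSum n w ⊖ expSum j w) n
  expSum-law-error z w n = sym (begin
    conv t (λ j → expSum n w ⊖ expSum j w) n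
      ≡⟨ conv-⊖ʳ t (λ _ → expSum n w) (λ j → expSum j w) n ⟩
    conv t (λ _ → expSum n w) n ⊖ conv t (λ j → expSum j w) n
      ≡⟨ cong₂ _⊖_
           (trans (conv-constant t (expSum n w) n) (cong (_⊗ expSum n w) (psum-expTerm z n)))
           (trans (conv-cong {f = t} (λ _ → refl) (λ j → sym (psum-expTerm w j)) n)
           (trans (sym (psum-conv t (expTerm w) n))
           (trans (psum-cong (conv-expTerm z w) n) (psum-expTerm (z ⊕ w) n)))) ⟩
    (expSum n z ⊗ expSum n w) ⊖ expSum n (z ⊕ w) ∎)
    where
    open ≡-Reasoning
    t = expTerm z

  -- Uniform estimates on the ball of radius B.

  module Estimates (B : ℕ) where

    open ExpBound B
    open ≤-Reasoning

    0≤P : ∀ n → 0ℚ ≤ P n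
    0≤P 0       = ≤-refl
    0≤P (suc n) = 0≤+ (0≤P n) (0≤T n)

    P-mono : ∀ d n → P n ≤ P (d ℕ.+ n)
    P-mono 0       n = ≤-refl
    P-mono (suc d) n = ≤-trans (P-mono d n) (p≤p+q (0≤T (d ℕ.+ n)))

    P≤M-all : ∀ n → P n ≤ M
    P≤M-all n = ≤-trans (subst (λ t → P n ≤ P t) (ℕ.+-comm K n) (P-mono K n)) (P≤M (ℕ.m≤n+m K n))

    0≤M : 0ℚ ≤ M
    0≤M = P≤M-all 0

    ‖expSum‖≤M : ∀ {z} → ‖ z ‖ ≤ b → ∀ n → ‖ expSum n z ‖ ≤ M
    ‖expSum‖≤M {z} hz n = ≤-trans (partial n) (P≤M-all (suc n))
      where
      partial : ∀ n → ‖ expSum n z ‖ ≤ P (suc n)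
      partial 0       = ≤-trans (‖expTerm‖ {z} hz 0) (≤-reflexive (sym (+-identityˡ (T 0))))
      partial (suc n) = ≤-trans (‖⊕‖ (expSum n z) (expTerm z (suc n)))
        (+-mono-≤ (partial n) (‖expTerm‖ {z} hz (suc n)))

    -- The bound is β (T i + ... + T (n + i)), written without subtraction. The offset `i` records
    -- how many coefficients the induction has already removed.
    ‖conv‖ : ∀ {f g β} n i → 0ℚ ≤ β → (∀ k → ‖ f k ‖ ≤ T (k ℕ.+ i)) → (∀ j → ‖ g j ‖ ≤ β) →
      ‖ conv f g n ‖ + P i * β ≤ P (suc (n ℕ.+ i)) * β
    ‖conv‖ {f} {g} {β} 0 i 0≤β hf hg = begin
      ‖ f 0 ⊗ g 0 ‖ + P i * β   ≤⟨ +-monoˡ-≤ (P i * β) (‖⊗‖-mono (f 0) (g 0) 0≤β (hf 0) (hg 0)) ⟩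
      T i * β + P i * β
        ≡⟨ ℚSolver.solve 3 (λ t p b → t ⊛ b ⊞ p ⊛ b
             ≐ (p ⊞ t) ⊛ b) refl (T i) (P i) β ⟩
      P (suc i) * β             ∎
    ‖conv‖ {f} {g} {β} (suc n) i 0≤β hf hg = begin
      ‖ f 0 ⊗ g (suc n) ⊕ c ‖ + P i * β
        ≤⟨ +-monoˡ-≤ (P i * β) (≤-trans (‖⊕‖ (f 0 ⊗ g (suc n)) c)
             (+-monoˡ-≤ (‖ c ‖) (‖⊗‖-mono (f 0) (g (suc n)) 0≤β (hf 0) (hg (suc n))))) ⟩
      (T i * β + ‖ c ‖) + P i * β
        ≡⟨ ℚSolver.solve 4 (λ t p b c → (t ⊛ b ⊞ c) ⊞ p ⊛ b
             ≐ c ⊞ (p ⊞ t) ⊛ b) refl (T i) (P i) β (‖ c ‖) ⟩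
      ‖ c ‖ + P (suc i) * β
        ≤⟨ ‖conv‖ {f ∘ suc} {g} n (suc i) 0≤β
             (λ k → subst (λ t → ‖ f (suc k) ‖ ≤ T t) (sym (ℕ.+-suc k i)) (hf (suc k))) hg ⟩
      P (suc (n ℕ.+ suc i)) * β   ≡⟨ cong (λ t → P (suc t) * β) (ℕ.+-suc n i) ⟩
      P (suc (suc n ℕ.+ i)) * β   ∎
      where c = conv (f ∘ suc) g n

    -- The first `m` products meet `g` only at indices above `h`, where the small bound η applies;
    -- the remaining h + 1 use β, but involve only coefficients of `f` from `m` on.
    ‖conv‖-split : ∀ {f g η β} h m i → 0ℚ ≤ η → 0ℚ ≤ β → (∀ k → ‖ f k ‖ ≤ T (k ℕ.+ i)) →
      (∀ j → ‖ g j ‖ ≤ β) → (∀ j → ‖ g (j ℕ.+ h) ‖ ≤ η) →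
      ‖ conv f g (m ℕ.+ h) ‖ + P i * η + P (m ℕ.+ i) * β
        ≤ P (m ℕ.+ i) * η + P (suc (h ℕ.+ (m ℕ.+ i))) * β
    ‖conv‖-split {f} {g} {η} {β} h 0 i 0≤η 0≤β hf hg hg′ = begin
      ‖ conv f g h ‖ + P i * η + P i * β
        ≡⟨ ℚSolver.solve 3 (λ a b c → a ⊞ b ⊞ c ≐ b ⊞ (a ⊞ c))
             refl (‖ conv f g h ‖) (P i * η) (P i * β) ⟩
      P i * η + (‖ conv f g h ‖ + P i * β)   ≤⟨ +-monoʳ-≤ (P i * η) (‖conv‖ {f} {g} h i 0≤β hf hg) ⟩
      P i * η + P (suc (h ℕ.+ i)) * β        ∎
    ‖conv‖-split {f} {g} {η} {β} h (suc m) i 0≤η 0≤β hf hg hg′ = begin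
      ‖ f 0 ⊗ g (suc (m ℕ.+ h)) ⊕ c ‖ + P i * η + p * β
        ≤⟨ +-monoˡ-≤ (p * β) (+-monoˡ-≤ (P i * η) (≤-trans (‖⊕‖ (f 0 ⊗ g (suc (m ℕ.+ h))) c)
             (+-monoˡ-≤ (‖ c ‖) (‖⊗‖-mono (f 0) (g (suc (m ℕ.+ h))) 0≤η (hf 0) (hg′ (suc m)))))) ⟩
      (T i * η + ‖ c ‖) + P i * η + p * β
        ≡⟨ ℚSolver.solve 5 (λ t q e c r → (t ⊛ e ⊞ c) ⊞ q ⊛ e ⊞ r
             ≐ c ⊞ (q ⊞ t) ⊛ e ⊞ r) refl (T i) (P i) η (‖ c ‖) (p * β) ⟩
      ‖ c ‖ + P (suc i) * η + p * β
        ≡⟨ cong (λ t → ‖ c ‖ + P (suc i) * η + P t * β) (sym (ℕ.+-suc m i)) ⟩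
      ‖ c ‖ + P (suc i) * η + P (m ℕ.+ suc i) * β
        ≤⟨ ‖conv‖-split {f ∘ suc} {g} h m (suc i) 0≤η 0≤β
             (λ k → subst (λ t → ‖ f (suc k) ‖ ≤ T t) (sym (ℕ.+-suc k i)) (hf (suc k))) hg hg′ ⟩
      P (m ℕ.+ suc i) * η + P (suc (h ℕ.+ (m ℕ.+ suc i))) * β
        ≡⟨ cong (λ t → P t * η + P (suc (h ℕ.+ t)) * β) (ℕ.+-suc m i) ⟩
      p * η + P (suc (h ℕ.+ (suc m ℕ.+ i))) * β ∎
      where
      c = conv (f ∘ suc) g (m ℕ.+ h)
      p = P (suc m ℕ.+ i)

    5M = M + (M + M + (M + M))

    -- Of the 5M, one M comes from the products with small tails of exp w. The other four are 2 ·
    -- 2M: a sum of late terms of exp z, at most 2 T h, times the trivial bound 2M for a tail.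
    expSum-law : ∀ {z w} → ‖ z ‖ ≤ b → ‖ w ‖ ≤ b → ∀ h m → K ℕ.≤ h → h ℕ.≤ m →
      ‖ (expSum (m ℕ.+ h) z ⊗ expSum (m ℕ.+ h) w) ⊖ expSum (m ℕ.+ h) (z ⊕ w) ‖ ≤ 5M * T h
    expSum-law {z} {w} hz hw h m K≤h h≤m = subst (λ u → ‖ u ‖ ≤ 5M * T h)
      (sym (expSum-law-error z w (m ℕ.+ h)))
      (+-cancel-≤ (P m * β) (begin
        ‖ c ‖ + P m * β
          ≡⟨ ℚSolver.solve 3 (λ c r e → c ⊞ r ≐ c ⊞ ℚSolver.con 0ℚ ⊛ e ⊞ r)
               refl (‖ c ‖) (P m * β) η ⟩
        ‖ c ‖ + P 0 * η + P m * β
          ≡⟨ cong (λ t → ‖ c ‖ + P 0 * η + P t * β) (ℕ.+-identityʳ m) ⟨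
        ‖ c ‖ + P 0 * η + P (m ℕ.+ 0) * β
          ≤⟨ ‖conv‖-split {expTerm z} {g} h m 0 (0≤T h) (0≤+ 0≤M 0≤M)
               (λ k → subst (λ t → ‖ expTerm z k ‖ ≤ T t) (sym (ℕ.+-identityʳ k)) (‖expTerm‖ {z} hz k))
               small smaller ⟩
        P (m ℕ.+ 0) * η + P (suc (h ℕ.+ (m ℕ.+ 0))) * β
          ≡⟨ cong (λ t → P t * η + P (suc (h ℕ.+ t)) * β) (ℕ.+-identityʳ m) ⟩
        P m * η + P (suc (h ℕ.+ m)) * β
          ≤⟨ +-mono-≤ (*-monoʳ (0≤T h) (P≤M-all m)) (*-monoʳ (0≤+ 0≤M 0≤M) tail) ⟩
        M * η + (P m + η + η) * β
          ≡⟨ ℚSolver.solve 3 (λ M e p → M ⊛ e ⊞ (p ⊞ e ⊞ e) ⊛ (M ⊞ M)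
               ≐ p ⊛ (M ⊞ M) ⊞ (M ⊞ (M ⊞ M ⊞ (M ⊞ M))) ⊛ e)
               refl M η (P m) ⟩
        P m * β + 5M * η ∎))
      where
      n = m ℕ.+ h
      η = T h
      β = M + M
      g : ℕ → ℚ[i]
      g j = expSum n w ⊖ expSum j w
      c = conv (expTerm z) g n
      small : ∀ j → ‖ g j ‖ ≤ β
      small j = ≤-trans (‖⊖‖ (expSum n w) (expSum j w))
        (+-mono-≤ (‖expSum‖≤M {w} hw n) (‖expSum‖≤M {w} hw j))
      near : ∀ {i j} → h ℕ.≤ i → i ℕ.≤ j → ‖ expSum j w ⊖ expSum i w ‖ ≤ η
      near {i} {j} h≤i i≤j = ≤-trans (‖expSum-tail‖≤T {w} hw (ℕ.≤-trans K≤h h≤i) i≤j)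
        (subst (λ t → T t ≤ T h) (ℕ.m∸n+n≡m h≤i) (T-antitone (i ℕ.∸ h) K≤h))
      smaller : ∀ j → ‖ g (j ℕ.+ h) ‖ ≤ η
      smaller j with ℕ.≤-total (j ℕ.+ h) n
      ... | inj₁ j≤n = near (ℕ.m≤n+m h j) j≤n
      ... | inj₂ n≤j = ≤-trans (≤-reflexive (‖⊖‖-sym (expSum n w) (expSum (j ℕ.+ h) w)))
                               (near (ℕ.m≤n+m h m) n≤j)
      Tm≤η : T m ≤ η
      Tm≤η = subst (λ t → T t ≤ T h) (ℕ.m∸n+n≡m h≤m) (T-antitone (m ℕ.∸ h) K≤h)
      tail : P (suc (h ℕ.+ m)) ≤ P m + η + η
      tail = begin
        P (suc (h ℕ.+ m))                  ≤⟨ p≤p+q (0≤T (h ℕ.+ m)) ⟩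
        P (suc (h ℕ.+ m)) + T (h ℕ.+ m)    ≤⟨ P+T-antitone h (ℕ.≤-trans K≤h h≤m) ⟩
        P m + T m + T m                    ≤⟨ +-mono-≤ (+-monoʳ-≤ (P m) Tm≤η) Tm≤η ⟩
        P m + η + η                        ∎

    -- The index `N` serves all z and w of the ball at once, as it must when the arguments
    -- themselves vary with n.
    expSum-law-limit : ∀ {ε} → 0ℚ < ε → ∃[ N ] (∀ n → N ℕ.≤ n → ∀ {z w} → ‖ z ‖ ≤ b → ‖ w ‖ ≤ b →
      ‖ (expSum n z ⊗ expSum n w) ⊖ expSum n (z ⊕ w) ‖ ≤ ε)
    expSum-law-limit {ε} 0<ε with 1/suc-small′ (5M * (b * T K))
      (0≤* (0≤+ 0≤M (0≤+ (0≤+ 0≤M 0≤M) (0≤+ 0≤M 0≤M))) (0≤* (0≤fromℕ B) (0≤T K))) 0<ε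
    -- From 2h on, n splits as (n - h) + h with both parts at least `h`.
    ... | N , hN = h ℕ.+ h , λ n h+h≤n {z} {w} hz hw →
      subst (λ n → ‖ (expSum n z ⊗ expSum n w) ⊖ expSum n (z ⊕ w) ‖ ≤ ε)
        (ℕ.m∸n+n≡m (ℕ.m+n≤o⇒n≤o h h+h≤n))
        (≤-trans (expSum-law {z} {w} hz hw h (n ℕ.∸ h)
          (ℕ.≤-trans (ℕ.m≤m⊔n K N) (ℕ.n≤1+n (K ℕ.⊔ N)))
          (ℕ.m+n≤o⇒m≤o∸n h h+h≤n)) 5M*Th≤ε)
      where
      h = suc (K ℕ.⊔ N)
      5M*Th≤ε : 5M * T h ≤ ε
      5M*Th≤ε = begin
        5M * T h
          ≤⟨ *-monoˡ (0≤+ 0≤M (0≤+ (0≤+ 0≤M 0≤M) (0≤+ 0≤M 0≤M)))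
               (≤-trans (T-small (ℕ.m≤m⊔n K N))
                 (*-monoˡ (0≤* (0≤fromℕ B) (0≤T K)) (1/suc-antimono (ℕ.m≤n⊔m K N)))) ⟩
        5M * (b * T K * 1/suc N)     ≡⟨ *-assoc 5M (b * T K) (1/suc N) ⟨
        5M * (b * T K) * 1/suc N     ≤⟨ hN ⟩
        ε                            ∎

-- Bounded sequences modulo null sequences.

module BoundedSequences where

  open GaussianRationals
  open import Algebra.Structures using (IsCommutativeRing)
  open import Data.Nat.Base as ℕ using ()
  import Data.Nat.Properties as ℕ
  open import Data.Product.Base using (_,_)
  open import Data.Rational
  open import Data.Rational.Properties
  open import Relation.Binary.PropositionalEquality
  open ℚ[i]-Solver using (solve; _:=_; _:+_; _:*_; :-_; _:-_; con)
  module ℚi = CommutativeRing commutativeRing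

  Eventually : (ℕ → Set) → Set
  Eventually P = ∃[ N ] (∀ n → N ℕ.≤ n → P n)

  eventually-map : ∀ {P Q : ℕ → Set} → (∀ {n} → P n → Q n) → Eventually P → Eventually Q
  eventually-map f (N , h) = N , λ n N≤n → f (h n N≤n)

  eventually-× : ∀ {P Q : ℕ → Set} → Eventually P → Eventually Q → Eventually (λ n → P n × Q n)
  eventually-× (M , h) (N , k) = M ℕ.⊔ N , λ n M⊔N≤n →
    h n (ℕ.m⊔n≤o⇒m≤o M N M⊔N≤n) , k n (ℕ.m⊔n≤o⇒n≤o M N M⊔N≤n)

  -- Boundedness is what makes null sequences an ideal, so convergence is not carried along.
  record Sequence : Set where
    no-eta-equality
    field
      at       : ℕ → ℚ[i]
      at-bound : ∃[ B ] (0ℚ ≤ B × (∀ n → ‖ at n ‖ ≤ B))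

  open Sequence public

  infix 4 _≈ˢ_

  record _≈ˢ_ (u v : Sequence) : Set where
    constructor ≈ˢ-intro
    field close : ∀ ε → 0ℚ < ε → Eventually (λ n → ‖ at u n ⊖ at v n ‖ ≤ ε)

  open _≈ˢ_ public

  ≗⇒≈ˢ : ∀ {u v} → (∀ n → at u n ≡ at v n) → u ≈ˢ v
  ≗⇒≈ˢ {u} {v} h = ≈ˢ-intro λ ε 0<ε → 0 , λ n _ → ≤-trans
    (≤-reflexive (trans (cong (λ t → ‖ t ⊖ at v n ‖) (h n)) (‖u⊖u‖ (at v n)))) (<⇒≤ 0<ε)

  ≈ˢ-sym : ∀ {u v} → u ≈ˢ v → v ≈ˢ u
  ≈ˢ-sym {u} {v} (≈ˢ-intro h) = ≈ˢ-intro λ ε 0<ε → eventually-map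
    (λ {n} → ≤-trans (≤-reflexive (‖⊖‖-sym (at v n) (at u n)))) (h ε 0<ε)

  ≈ˢ-trans : ∀ {u v w} → u ≈ˢ v → v ≈ˢ w → u ≈ˢ w
  ≈ˢ-trans {u} {v} {w} (≈ˢ-intro h) (≈ˢ-intro k) = ≈ˢ-intro λ ε 0<ε → eventually-map
    (λ { {n} (p , q) → ≤-trans (‖⊖‖-triangle (at u n) (at v n) (at w n))
      (≤-trans (+-mono-≤ p q) (≤-reflexive (half+half ε))) })
    (eventually-× (h (½ * ε) (half 0<ε)) (k (½ * ε) (half 0<ε)))

  constant : ℚ[i] → Sequence
  constant u = record { at = λ _ → u ; at-bound = ‖ u ‖ , 0≤‖ u ‖ , λ _ → ≤-refl }

  opaque
    _+ˢ_ _*ˢ_ : Sequence → Sequence → Sequence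
    u +ˢ v = record
      { at = λ n → at u n ⊕ at v n
      ; at-bound = let B , 0≤B , h = at-bound u ; C , 0≤C , k = at-bound v in
          B + C , 0≤+ 0≤B 0≤C , λ n → ≤-trans (‖⊕‖ (at u n) (at v n)) (+-mono-≤ (h n) (k n)) }
    u *ˢ v = record
      { at = λ n → at u n ⊗ at v n
      ; at-bound = let B , 0≤B , h = at-bound u ; C , 0≤C , k = at-bound v in
          B * C , 0≤* 0≤B 0≤C , λ n → ‖⊗‖-mono (at u n) (at v n) 0≤C (h n) (k n) }

    -ˢ_ : Sequence → Sequence
    -ˢ u = record
      { at = λ n → ⊝ at u n
      ; at-bound = let B , 0≤B , h = at-bound u in
          B , 0≤B , λ n → ≤-trans (≤-reflexive (‖⊝‖ (at u n))) (h n) }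

    at-+ˢ : ∀ u v n → at (u +ˢ v) n ≡ at u n ⊕ at v n
    at-+ˢ u v n = refl

    at-*ˢ : ∀ u v n → at (u *ˢ v) n ≡ at u n ⊗ at v n
    at-*ˢ u v n = refl

    +ˢ-cong : ∀ {u u′ v v′} → u ≈ˢ u′ → v ≈ˢ v′ → (u +ˢ v) ≈ˢ (u′ +ˢ v′)
    +ˢ-cong {u} {u′} {v} {v′} (≈ˢ-intro h) (≈ˢ-intro k) = ≈ˢ-intro λ ε 0<ε → eventually-map
      (λ { {n} (p , q) → ≤-trans
        (≤-reflexive (cong ‖_‖ (⊕-⊖-comm (at u n) (at v n) (at u′ n) (at v′ n))))
        (≤-trans (‖⊕‖ (at u n ⊖ at u′ n) (at v n ⊖ at v′ n))
          (≤-trans (+-mono-≤ p q) (≤-reflexive (half+half ε)))) })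
      (eventually-× (h (½ * ε) (half 0<ε)) (k (½ * ε) (half 0<ε)))

    *ˢ-cong : ∀ {u u′ v v′} → u ≈ˢ u′ → v ≈ˢ v′ → (u *ˢ v) ≈ˢ (u′ *ˢ v′)
    *ˢ-cong {u} {u′} {v} {v′} (≈ˢ-intro h) (≈ˢ-intro k) = ≈ˢ-intro λ ε 0<ε →
      let B , 0≤B , hu  = at-bound u
          C , 0≤C , hv′ = at-bound v′
          δ , 0<δ , Bδ  = shrink B (half 0<ε)
          γ , 0<γ , Cγ  = shrink C (half 0<ε)
      in eventually-map
        (λ { {n} (p , q) → ≤-trans
          (≤-reflexive (cong ‖_‖ (split (at u n) (at u′ n) (at v n) (at v′ n))))
          (≤-trans (‖⊕‖ (at u n ⊗ (at v n ⊖ at v′ n)) (at v′ n ⊗ (at u n ⊖ at u′ n)))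
          (≤-trans (+-mono-≤
            (‖⊗‖-mono (at u n) (at v n ⊖ at v′ n) (<⇒≤ 0<δ) (hu n) q)
            (‖⊗‖-mono (at v′ n) (at u n ⊖ at u′ n) (<⇒≤ 0<γ) (hv′ n) p))
          (≤-trans (+-mono-≤ Bδ Cγ) (≤-reflexive (half+half ε))))) })
        (eventually-× (h γ 0<γ) (k δ 0<δ))
      where
      split : ∀ a a′ b b′ → (a ⊗ b) ⊖ (a′ ⊗ b′) ≡ (a ⊗ (b ⊖ b′)) ⊕ (b′ ⊗ (a ⊖ a′))
      split = solve 4 (λ a a′ b b′ → a :* b :- a′ :* b′ := a :* (b :- b′) :+ b′ :* (a :- a′)) refl

    -ˢ-cong : ∀ {u v} → u ≈ˢ v → (-ˢ u) ≈ˢ (-ˢ v)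
    -ˢ-cong {u} {v} (≈ˢ-intro h) = ≈ˢ-intro λ ε 0<ε → eventually-map
      (λ {n} → ≤-trans (≤-reflexive (trans
        (cong ‖_‖ (solve 2 (λ a b → (:- a) :- (:- b) := :- (a :- b)) refl (at u n) (at v n)))
        (‖⊝‖ (at u n ⊖ at v n)))))
      (h ε 0<ε)

    isCommutativeRing : IsCommutativeRing _≈ˢ_ _+ˢ_ _*ˢ_ -ˢ_ (constant 0ᵍ) (constant 1ᵍ)
    isCommutativeRing = record
      { isRing = record
        { +-isAbelianGroup = record
          { isGroup = record
            { isMonoid = record
              { isSemigroup = record
                { isMagma = record
                  { isEquivalence = record
                    { refl = λ {u} → ≗⇒≈ˢ {u} {u} (λ _ → refl)
                    ; sym = ≈ˢ-sym ; trans = ≈ˢ-trans }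
                  ; ∙-cong = +ˢ-cong }
                ; assoc = λ u v w → ≗⇒≈ˢ λ n → ℚi.+-assoc (at u n) (at v n) (at w n) }
              ; identity = (λ u → ≗⇒≈ˢ λ n → ℚi.+-identityˡ (at u n))
                         , (λ u → ≗⇒≈ˢ λ n → ℚi.+-identityʳ (at u n)) }
            ; inverse = (λ u → ≗⇒≈ˢ λ n → ℚi.-‿inverseˡ (at u n))
                      , (λ u → ≗⇒≈ˢ λ n → ℚi.-‿inverseʳ (at u n))
            ; ⁻¹-cong = -ˢ-cong }
          ; comm = λ u v → ≗⇒≈ˢ λ n → ℚi.+-comm (at u n) (at v n) }
        ; *-cong = *ˢ-cong
        ; *-assoc = λ u v w → ≗⇒≈ˢ λ n → ℚi.*-assoc (at u n) (at v n) (at w n)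
        ; *-identity = (λ u → ≗⇒≈ˢ λ n → ℚi.*-identityˡ (at u n))
                     , (λ u → ≗⇒≈ˢ λ n → ℚi.*-identityʳ (at u n))
        ; distrib = (λ u v w → ≗⇒≈ˢ λ n → ℚi.distribˡ (at u n) (at v n) (at w n))
                  , (λ u v w → ≗⇒≈ˢ λ n → ℚi.distribʳ (at u n) (at v n) (at w n)) }
      ; *-comm = λ u v → ≗⇒≈ˢ λ n → ℚi.*-comm (at u n) (at v n) }

  sequenceRing : CommutativeRing 0ℓ 0ℓ
  sequenceRing = record { isCommutativeRing = isCommutativeRing }

  -- If c u - u is null, so is (c - 1) u, and the factor c - 1, eventually bounded away from 0, can
  -- be cancelled.
  apart-from-1⇒no-fixed-point : ∀ c → Eventually (λ n → ½ ≤ ‖ at c n ⊖ 1ᵍ ‖) →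
    ∀ u → (c *ˢ u) ≈ˢ u → u ≈ˢ constant 0ᵍ
  apart-from-1⇒no-fixed-point c apart u (≈ˢ-intro fixed) = ≈ˢ-intro λ ε 0<ε →
    let δ , 0<δ , 4δ≤ε = shrink (fromℕ 4) 0<ε in
    eventually-map
      (λ { {n} (p , q) → begin
        ‖ at u n ⊖ 0ᵍ ‖
          ≡⟨ cong ‖_‖ (solve 1 (λ u → u :- con 0ᵍ := u) refl (at u n)) ⟩
        ‖ at u n ‖                               ≤⟨ ‖u‖≤4‖a⊗u‖ (at c n ⊖ 1ᵍ) (at u n) p ⟩
        fromℕ 4 * ‖ (at c n ⊖ 1ᵍ) ⊗ at u n ‖
          ≡⟨ cong (λ t → fromℕ 4 * ‖ t ‖) (solve 2 (λ c u → (c :- con 1ᵍ) :* u := c :* u :- u)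
               refl (at c n) (at u n)) ⟩
        fromℕ 4 * ‖ (at c n ⊗ at u n) ⊖ at u n ‖
          ≡⟨ cong (λ t → fromℕ 4 * ‖ t ⊖ at u n ‖) (at-*ˢ c u n) ⟨
        fromℕ 4 * ‖ at (c *ˢ u) n ⊖ at u n ‖     ≤⟨ *-monoˡ (0≤fromℕ 4) q ⟩
        fromℕ 4 * δ                              ≤⟨ 4δ≤ε ⟩
        ε ∎ })
      (eventually-× apart (fixed δ 0<δ))
    where open ≤-Reasoning

-- A first-order Taylor estimate, and the algebra of a single turn.

module QuarterTurn where

  open GaussianRationals
  open ExponentialLaw
  open BoundedSequences
  open import Data.Nat.Base using (suc; s≤s; z≤n)
  open import Data.Rational
  open import Data.Rational.Properties
  open import Data.Rational.Solver using (module +-*-Solver)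
  open import Relation.Binary.PropositionalEquality
  open +-*-Solver using (solve; _:=_; _:+_; _:*_; con)
  open ℚ[i]-Solver using () renaming (_:=_ to _≐_; _:+_ to _⊞_; _:*_ to _⊛_; _:-_ to _⊟_)

  imaginary : ℚ → ℚ[i]
  imaginary a = 0ℚ +i a

  ‖imaginary‖ : ∀ a → ‖ imaginary a ‖ ≡ ∣ a ∣
  ‖imaginary‖ a = +-identityˡ (∣ a ∣)

  expSum-1+z : ∀ {z} → ‖ z ‖ ≤ 1ℚ → ∀ n → ‖ expSum (suc n) z ⊖ (1ᵍ ⊕ z) ‖ ≤ ‖ z ‖ * ‖ z ‖
  expSum-1+z {z} z≤1 n = ≤-trans (p≤p+q (0≤* (0≤* (0≤‖ z ‖) (0≤‖ z ‖)) (0≤2⁻ n))) (go n)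
    where
    open ≤-Reasoning
    c = ‖ z ‖ * ‖ z ‖
    0≤c : 0ℚ ≤ c
    0≤c = 0≤* (0≤‖ z ‖) (0≤‖ z ‖)
    2⁻ : ℕ → ℚ
    2⁻ 0       = 1ℚ
    2⁻ (suc n) = ½ * 2⁻ n
    0≤2⁻ : ∀ n → 0ℚ ≤ 2⁻ n
    0≤2⁻ 0       = <⇒≤ 0<1
    0≤2⁻ (suc n) = 0≤* (<⇒≤ 0<½) (0≤2⁻ n)
    1/suc≤½ : ∀ n → 1/suc (suc n) ≤ ½
    1/suc≤½ n = ≤-trans (1/suc-antimono (s≤s (z≤n {n}))) (≤-reflexive 1/suc-1)
    term≤ : ∀ n → ‖ expTerm z (suc (suc n)) ‖ ≤ c * 2⁻ (suc n)
    expTerm-suc : ∀ n {β} → ‖ expTerm z (suc n) ‖ ≤ β → ‖ expTerm z (suc (suc n)) ‖ ≤ ½ * (‖ z ‖ * β)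
    expTerm-suc n {β} h = begin
      ‖ 1/suc (suc n) · (z ⊗ expTerm z (suc n)) ‖   ≡⟨ ‖·‖ (0≤1/suc (suc n)) (z ⊗ expTerm z (suc n)) ⟩
      1/suc (suc n) * ‖ z ⊗ expTerm z (suc n) ‖
        ≤⟨ *-mono (0≤1/suc (suc n)) (1/suc≤½ n) (0≤* (0≤‖ z ‖) (≤-trans (0≤‖ expTerm z (suc n) ‖) h))
             (‖⊗‖-mono z (expTerm z (suc n)) (≤-trans (0≤‖ expTerm z (suc n) ‖) h) ≤-refl h) ⟩
      ½ * (‖ z ‖ * β)                               ∎
    expTerm-1 : expTerm z 1 ≡ z
    expTerm-1 = trans (·-⊗-assoc (1/suc 0) z 1ᵍ) (trans
      (cong (z ⊗_) (cong₂ _+i_ (trans (*-identityʳ (1/suc 0)) 1/1) (*-zeroʳ (1/suc 0))))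
      (ℚi.*-identityʳ z))
      where
      1/1 : 1/suc 0 ≡ 1ℚ
      1/1 = trans (sym (*-identityˡ (1/suc 0))) (trans (cong (_* 1/suc 0) (sym fromℕ-1)) (1/suc-inverse 0))
    term≤ 0       = ≤-trans (expTerm-suc 0 {‖ z ‖} (≤-reflexive (cong ‖_‖ expTerm-1)))
      (≤-reflexive (solve 1 (λ c → con ½ :* c := c :* (con ½ :* con 1ℚ)) refl c))
    term≤ (suc n) = ≤-trans (expTerm-suc (suc n) (term≤ n)) (≤-trans
      (*-monoˡ (<⇒≤ 0<½) (≤-trans (*-monoʳ (0≤* 0≤c (0≤2⁻ (suc n))) z≤1)
        (≤-reflexive (*-identityˡ (c * 2⁻ (suc n))))))
      (≤-reflexive (solve 2 (λ c t → con ½ :* (c :* t) := c :* (con ½ :* t)) refl c (2⁻ (suc n)))))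
    go : ∀ n → ‖ expSum (suc n) z ⊖ (1ᵍ ⊕ z) ‖ + c * 2⁻ n ≤ c
    go 0       = ≤-reflexive (trans (cong (λ t → ‖ t ⊖ (1ᵍ ⊕ z) ‖ + c * 1ℚ) (cong (1ᵍ ⊕_) expTerm-1))
      (trans (cong (_+ c * 1ℚ) (‖u⊖u‖ (1ᵍ ⊕ z))) (solve 1 (λ c → con 0ℚ :+ c :* con 1ℚ := c) refl c)))
    go (suc n) = begin
      ‖ (s ⊕ t) ⊖ (1ᵍ ⊕ z) ‖ + c * (½ * 2⁻ n)
        ≡⟨ cong (λ u → ‖ u ‖ + c * (½ * 2⁻ n)) (⊕-⊖-assoc s t (1ᵍ ⊕ z)) ⟩
      ‖ (s ⊖ (1ᵍ ⊕ z)) ⊕ t ‖ + c * (½ * 2⁻ n)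
        ≤⟨ +-monoˡ-≤ (c * (½ * 2⁻ n)) (≤-trans (‖⊕‖ (s ⊖ (1ᵍ ⊕ z)) t)
             (+-monoʳ-≤ (‖ s ⊖ (1ᵍ ⊕ z) ‖) (term≤ n))) ⟩
      ‖ s ⊖ (1ᵍ ⊕ z) ‖ + c * (½ * 2⁻ n) + c * (½ * 2⁻ n)
        ≡⟨ solve 3 (λ s c h → s :+ c :* (con ½ :* h) :+ c :* (con ½ :* h) := s :+ c :* h)
             refl (‖ s ⊖ (1ᵍ ⊕ z) ‖) c (2⁻ n) ⟩
      ‖ s ⊖ (1ᵍ ⊕ z) ‖ + c * 2⁻ n     ≤⟨ go n ⟩
      c                               ∎
      where
      s = expSum (suc n) z
      t = expTerm z (suc (suc n))

  -- With a = n - ik and A = n + ik, this says that passing from k to k + 1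
  -- turns a / A by an angle close to the k-th term of the Riemann sum.
  module _ (a A ρ ρ′ : ℚ[i]) where

    private
      b = a ⊖ 𝕚
      B = A ⊕ 𝕚
      U = ρ ⊗ (a ⊗ a)
      U′ = ρ′ ⊗ (b ⊗ b)

    turn-identity : ρ ⊗ (a ⊗ A) ≡ 1ᵍ → ρ′ ⊗ (b ⊗ B) ≡ 1ᵍ →
      ((1ᵍ ⊕ 𝕚 ⊗ ((a ⊕ A) ⊗ ρ′)) ⊗ U′) ⊖ U ≡ ρ′ ⊗ (U′ ⊗ (1ᵍ ⊕ U))
    turn-identity h h′ = begin
      ((1ᵍ ⊕ 𝕚 ⊗ ((a ⊕ A) ⊗ ρ′)) ⊗ U′) ⊖ U
        ≡⟨ cong (λ t → ((1ᵍ ⊕ 𝕚 ⊗ ((a ⊕ A) ⊗ ρ′)) ⊗ U′) ⊖ t) U≡ ⟩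
      ((1ᵍ ⊕ 𝕚 ⊗ ((a ⊕ A) ⊗ ρ′)) ⊗ U′) ⊖ (ρ′ ⊗ (U′ ⊗ (B ⊗ (B ⊗ U))))
        ≡⟨ cong (λ t → ((t ⊕ 𝕚 ⊗ ((a ⊕ A) ⊗ ρ′)) ⊗ U′) ⊖ (ρ′ ⊗ (U′ ⊗ (B ⊗ (B ⊗ U))))) (sym h′) ⟩
      ((ρ′ ⊗ (b ⊗ B) ⊕ 𝕚 ⊗ ((a ⊕ A) ⊗ ρ′)) ⊗ U′) ⊖ (ρ′ ⊗ (U′ ⊗ (B ⊗ (B ⊗ U))))
        ≡⟨ ℚ[i]-Solver.solve 6 (λ r c j s u t → (r ⊛ c ⊞ j ⊛ (s ⊛ r)) ⊛ u ⊟ r ⊛ (u ⊛ t)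
             ≐ r ⊛ (u ⊛ (c ⊞ j ⊛ s ⊟ t))) refl ρ′ (b ⊗ B) 𝕚 (a ⊕ A) U′ (B ⊗ (B ⊗ U)) ⟩
      ρ′ ⊗ (U′ ⊗ ((b ⊗ B ⊕ 𝕚 ⊗ (a ⊕ A)) ⊖ (B ⊗ (B ⊗ U))))
        ≡⟨ cong (λ t → ρ′ ⊗ (U′ ⊗ t)) bracket ⟩
      ρ′ ⊗ (U′ ⊗ (1ᵍ ⊕ U)) ∎
      where
      open ≡-Reasoning
      -- That is, U = a / A, without a division.
      AU : A ⊗ U ≡ a
      AU = trans (ℚ[i]-Solver.solve 3 (λ A r a → A ⊛ (r ⊛ (a ⊛ a)) ≐ (r ⊛ (a ⊛ A)) ⊛ a) refl A ρ a)
        (trans (cong (_⊗ a) h) (ℚi.*-identityˡ a))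
      BU′ : B ⊗ U′ ≡ b
      BU′ = trans (ℚ[i]-Solver.solve 3 (λ A r a → A ⊛ (r ⊛ (a ⊛ a)) ≐ (r ⊛ (a ⊛ A)) ⊛ a) refl B ρ′ b)
        (trans (cong (_⊗ b) h′) (ℚi.*-identityˡ b))
      U≡ : U ≡ ρ′ ⊗ (U′ ⊗ (B ⊗ (B ⊗ U)))
      U≡ = trans (sym (ℚi.*-identityˡ U)) (trans (cong (_⊗ U) (sym h′))
        (trans (cong (λ t → (ρ′ ⊗ (t ⊗ B)) ⊗ U) (sym BU′))
        (ℚ[i]-Solver.solve 4 (λ r B u v → (r ⊛ ((B ⊛ u) ⊛ B)) ⊛ v ≐ r ⊛ (u ⊛ (B ⊛ (B ⊛ v)))) refl ρ′ B U′ U)))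
      -- The solver treats 𝕚 as a variable j; it only isolates j j, which then evaluates to - 1.
      bracket : (b ⊗ B ⊕ 𝕚 ⊗ (a ⊕ A)) ⊖ (B ⊗ (B ⊗ U)) ≡ 1ᵍ ⊕ U
      bracket = begin
        (b ⊗ B ⊕ 𝕚 ⊗ (a ⊕ A)) ⊖ (B ⊗ (B ⊗ U))
          ≡⟨ ℚ[i]-Solver.solve 4 (λ a A j u →
               ((a ⊟ j) ⊛ (A ⊞ j) ⊞ j ⊛ (a ⊞ A)) ⊟ (A ⊞ j) ⊛ ((A ⊞ j) ⊛ u)
               ≐ ((a ⊛ A ⊞ j ⊛ a ⊞ j ⊛ a) ⊟ j ⊛ j)
                 ⊟ (A ⊛ (A ⊛ u) ⊞ j ⊛ (A ⊛ u) ⊞ j ⊛ (A ⊛ u) ⊞ (j ⊛ j) ⊛ u)) refl a A 𝕚 U ⟩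
        ((a ⊗ A ⊕ 𝕚 ⊗ a ⊕ 𝕚 ⊗ a) ⊖ (⊝ 1ᵍ))
          ⊖ (A ⊗ (A ⊗ U) ⊕ 𝕚 ⊗ (A ⊗ U) ⊕ 𝕚 ⊗ (A ⊗ U) ⊕ (⊝ 1ᵍ) ⊗ U)
          ≡⟨ cong (λ t → ((a ⊗ A ⊕ 𝕚 ⊗ a ⊕ 𝕚 ⊗ a) ⊖ (⊝ 1ᵍ)) ⊖ (A ⊗ t ⊕ 𝕚 ⊗ t ⊕ 𝕚 ⊗ t ⊕ (⊝ 1ᵍ) ⊗ U)) AU ⟩
        ((a ⊗ A ⊕ 𝕚 ⊗ a ⊕ 𝕚 ⊗ a) ⊖ (⊝ 1ᵍ)) ⊖ (A ⊗ a ⊕ 𝕚 ⊗ a ⊕ 𝕚 ⊗ a ⊕ (⊝ 1ᵍ) ⊗ U)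
          ≡⟨ ℚ[i]-Solver.solve 4 (λ a A j u →
               ((a ⊛ A ⊞ j ⊛ a ⊞ j ⊛ a) ⊟ ℚ[i]-Solver.con (⊝ 1ᵍ))
               ⊟ (A ⊛ a ⊞ j ⊛ a ⊞ j ⊛ a ⊞ ℚ[i]-Solver.con (⊝ 1ᵍ) ⊛ u)
               ≐ ℚ[i]-Solver.con 1ᵍ ⊞ u) refl a A 𝕚 U ⟩
        1ᵍ ⊕ U ∎

-- Composing n = N + 1 turns into a quarter turn.

module TurnProduct (N : ℕ) where

  open GaussianRationals
  open ExponentialLaw
  open BoundedSequences
  open QuarterTurn
  open import Data.Nat.Base as ℕ using (suc; s≤s; z≤n)
  import Data.Nat.Properties as ℕ
  open import Data.Rational
  open import Data.Rational.Properties
  open import Data.Rational.Solver using (module +-*-Solver)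
  open import Relation.Binary.PropositionalEquality
  open +-*-Solver using (solve; _:=_; _:+_; _:*_; :-_; _:-_; con)
  open ℚ[i]-Solver using () renaming (_:=_ to _≐_; _:+_ to _⊞_; _:*_ to _⊛_; _:-_ to _⊟_)

  n̄ h : ℚ
  n̄ = fromℕ (suc N)
  h = 1/suc N

  -- n² + k² is the successor of sqSum k.
  sqSum : ℕ → ℕ
  sqSum k = N ℕ.+ N ℕ.* suc N ℕ.+ k ℕ.* k

  r τ : ℕ → ℚ
  r k = 1/suc (sqSum k)
  τ k = (n̄ + n̄) * r k

  0≤n̄ : 0ℚ ≤ n̄
  0≤n̄ = 0≤fromℕ (suc N)

  0≤h : 0ℚ ≤ h
  0≤h = 0≤1/suc N

  n̄*h : n̄ * h ≡ 1ℚ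
  n̄*h = 1/suc-inverse N

  0≤r : ∀ k → 0ℚ ≤ r k
  0≤r k = 0≤1/suc (sqSum k)

  r-inverse : ∀ k → r k * (n̄ * n̄ + fromℕ k * fromℕ k) ≡ 1ℚ
  r-inverse k = trans (*-comm (r k) _) (trans (cong (_* r k) (sym d≡)) (1/suc-inverse (sqSum k)))
    where
    d≡ : fromℕ (suc (sqSum k)) ≡ n̄ * n̄ + fromℕ k * fromℕ k
    d≡ = trans (fromℕ-+ (suc N ℕ.* suc N) (k ℕ.* k)) (cong₂ _+_ (fromℕ-* (suc N) (suc N)) (fromℕ-* k k))

  riemannTerm≡ : ∀ k → riemannTerm N k ≡ τ k + τ k
  riemannTerm≡ k = begin
    riemannTerm N k                                  ≡⟨ riemannTerm≡frac N k ⟩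
    frac (4 ℕ.* suc N) (sqSum k)
      ≡⟨ cong₂ frac (ℕ.*-identityʳ (4 ℕ.* suc N)) (ℕ.+-identityʳ (sqSum k)) ⟨
    frac (4 ℕ.* suc N ℕ.* 1) (sqSum k ℕ.+ 0)         ≡⟨ frac-* (4 ℕ.* suc N) 0 1 (sqSum k) ⟨
    frac (4 ℕ.* suc N) 0 * frac 1 (sqSum k)
      ≡⟨ cong₂ _*_ (fromℕ≡frac (4 ℕ.* suc N)) (1/suc≡frac (sqSum k)) ⟨
    fromℕ (4 ℕ.* suc N) * r k
      ≡⟨ cong (_* r k) (trans (fromℕ-* 4 (suc N)) (cong (_* n̄) fromℕ-4)) ⟩
    (1ℚ + 1ℚ + (1ℚ + 1ℚ)) * n̄ * r k
      ≡⟨ solve 2 (λ n r → (con 1ℚ :+ con 1ℚ :+ (con 1ℚ :+ con 1ℚ)) :* n :* r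
           := (n :+ n) :* r :+ (n :+ n) :* r) refl n̄ (r k) ⟩
    τ k + τ k                                        ∎
    where open ≡-Reasoning

  0≤τ : ∀ k → 0ℚ ≤ τ k
  0≤τ k = 0≤* (0≤+ 0≤n̄ 0≤n̄) (0≤r k)

  r≤h² : ∀ k → r k ≤ h * h
  r≤h² k = begin
    r k
      ≡⟨ solve 1 (λ r → r := con 1ℚ :* con 1ℚ :* r) refl (r k) ⟩
    1ℚ * 1ℚ * r k                      ≡⟨ cong (λ t → t * t * r k) n̄*h ⟨
    (n̄ * h) * (n̄ * h) * r k
      ≡⟨ solve 3 (λ n h r → (n :* h) :* (n :* h) :* r := h :* h :* (r :* (n :* n))) refl n̄ h (r k) ⟩
    h * h * (r k * (n̄ * n̄))
      ≤⟨ *-monoˡ (0≤* 0≤h 0≤h) (*-monoˡ (0≤r k) (p≤p+q (0≤square (fromℕ k)))) ⟩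
    h * h * (r k * (n̄ * n̄ + fromℕ k * fromℕ k))   ≡⟨ cong (h * h *_) (r-inverse k) ⟩
    h * h * 1ℚ                         ≡⟨ *-identityʳ (h * h) ⟩
    h * h                              ∎
    where open ≤-Reasoning

  τ≤2h : ∀ k → τ k ≤ h + h
  τ≤2h k = begin
    (n̄ + n̄) * r k         ≤⟨ *-monoˡ (0≤+ 0≤n̄ 0≤n̄) (r≤h² k) ⟩
    (n̄ + n̄) * (h * h)
      ≡⟨ solve 2 (λ n h → (n :+ n) :* (h :* h) := (n :* h) :* h :+ (n :* h) :* h) refl n̄ h ⟩
    n̄ * h * h + n̄ * h * h ≡⟨ cong (λ t → t * h + t * h) n̄*h ⟩
    1ℚ * h + 1ℚ * h       ≡⟨ cong (λ t → t + t) (*-identityˡ h) ⟩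
    h + h                 ∎
    where open ≤-Reasoning

  -- U k = (n - ik) / (n + ik), so that exp (i s k) U k stays close to 1 for the
  -- partial sums s k of the τ k, while U n = - i.
  a A ρ U : ℕ → ℚ[i]
  a k = n̄ +i (- fromℕ k)
  A k = n̄ +i fromℕ k
  ρ k = r k +i 0ℚ
  U k = ρ k ⊗ (a k ⊗ a k)

  ρ-inverse : ∀ k → ρ k ⊗ (a k ⊗ A k) ≡ 1ᵍ
  ρ-inverse k = cong₂ _+i_
    (trans (solve 3 (λ r n k → r :* (n :* n :- (:- k) :* k) :- con 0ℚ :* (n :* k :+ (:- k) :* n)
      := r :* (n :* n :+ k :* k)) refl (r k) n̄ (fromℕ k)) (r-inverse k))
    (solve 3 (λ r n k → r :* (n :* k :+ (:- k) :* n) :+ con 0ℚ :* (n :* n :- (:- k) :* k)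
      := con 0ℚ) refl (r k) n̄ (fromℕ k))

  a-suc : ∀ k → a (suc k) ≡ a k ⊖ 𝕚
  a-suc k = cong₂ _+i_ (sym (+-identityʳ n̄))
    (trans (cong -_ (fromℕ-suc k)) (neg-distrib-+ (fromℕ k) 1ℚ))

  A-suc : ∀ k → A (suc k) ≡ A k ⊕ 𝕚
  A-suc k = cong₂ _+i_ (sym (+-identityʳ n̄)) (fromℕ-suc k)

  turn : ∀ k → ((1ᵍ ⊕ imaginary (τ (suc k))) ⊗ U (suc k)) ⊖ U k
    ≡ ρ (suc k) ⊗ (U (suc k) ⊗ (1ᵍ ⊕ U k))
  turn k = subst (λ t → ((1ᵍ ⊕ t) ⊗ U (suc k)) ⊖ U k ≡ ρ (suc k) ⊗ (U (suc k) ⊗ (1ᵍ ⊕ U k))) (sym iτ≡)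
    (subst (λ b → ((1ᵍ ⊕ 𝕚 ⊗ ((a k ⊕ A k) ⊗ ρ (suc k))) ⊗ (ρ (suc k) ⊗ (b ⊗ b))) ⊖ U k
        ≡ ρ (suc k) ⊗ ((ρ (suc k) ⊗ (b ⊗ b)) ⊗ (1ᵍ ⊕ U k))) (sym (a-suc k))
      (turn-identity (a k) (A k) (ρ k) (ρ (suc k)) (ρ-inverse k)
        (trans (cong₂ (λ s t → ρ (suc k) ⊗ (s ⊗ t)) (sym (a-suc k)) (sym (A-suc k))) (ρ-inverse (suc k)))))
    where
    iτ≡ : imaginary (τ (suc k)) ≡ 𝕚 ⊗ ((a k ⊕ A k) ⊗ ρ (suc k))
    iτ≡ = cong₂ _+i_
      (solve 3 (λ n k r → con 0ℚ := con 0ℚ :* ((n :+ n) :* r :- ((:- k) :+ k) :* con 0ℚ)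
        :- con 1ℚ :* ((n :+ n) :* con 0ℚ :+ ((:- k) :+ k) :* r)) refl n̄ (fromℕ k) (r (suc k)))
      (solve 3 (λ n k r → (n :+ n) :* r := con 0ℚ :* ((n :+ n) :* con 0ℚ :+ ((:- k) :+ k) :* r)
        :+ con 1ℚ :* ((n :+ n) :* r :- ((:- k) :+ k) :* con 0ℚ)) refl n̄ (fromℕ k) (r (suc k)))

  ‖ρ‖ : ∀ k → ‖ ρ k ‖ ≡ r k
  ‖ρ‖ k = trans (+-identityʳ (∣ r k ∣)) (0≤p⇒∣p∣≡p (0≤r k))

  2ℚ = 1ℚ + 1ℚ

  0≤2 : 0ℚ ≤ 2ℚ
  0≤2 = 0≤+ (<⇒≤ 0<1) (<⇒≤ 0<1)

  ‖U‖≤2 : ∀ k → ‖ U k ‖ ≤ 2ℚ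
  ‖U‖≤2 k = begin
    ‖ ρ k ⊗ (a k ⊗ a k) ‖
      ≤⟨ ‖⊗‖-mono (ρ k) (a k ⊗ a k) (0≤* (0≤‖ a k ‖) (0≤‖ a k ‖)) (≤-reflexive (‖ρ‖ k)) (‖⊗‖ (a k) (a k)) ⟩
    r k * (‖ a k ‖ * ‖ a k ‖)             ≤⟨ *-monoˡ (0≤r k) (‖‖²≤2normSq (a k)) ⟩
    r k * (normSq (a k) + normSq (a k))
      ≡⟨ solve 3 (λ r n k → r :* ((n :* n :+ (:- k) :* (:- k)) :+ (n :* n :+ (:- k) :* (:- k)))
           := r :* (n :* n :+ k :* k) :+ r :* (n :* n :+ k :* k)) refl (r k) n̄ (fromℕ k) ⟩
    r k * (n̄ * n̄ + fromℕ k * fromℕ k) + r k * (n̄ * n̄ + fromℕ k * fromℕ k)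
      ≡⟨ cong (λ t → t + t) (r-inverse k) ⟩
    2ℚ                                    ∎
    where open ≤-Reasoning

  U-0 : U 0 ≡ 1ᵍ
  U-0 = trans (cong (λ t → ρ 0 ⊗ (a 0 ⊗ t)) (cong (n̄ +i_) (trans (cong -_ fromℕ-0) (sym fromℕ-0))))
    (ρ-inverse 0)

  -- At k = n the quotient is (1 - i) / (1 + i).
  U-last : U (suc N) ≡ ⊝ 𝕚
  U-last = trans
    (cong (ρ (suc N) ⊗_) (cong₂ _+i_
      (solve 1 (λ n → n :* n :- (:- n) :* (:- n) := con 0ℚ :* (n :* n :- (:- n) :* n)
        :- (con (- 1ℚ)) :* (n :* n :+ (:- n) :* n)) refl n̄)
      (solve 1 (λ n → n :* (:- n) :+ (:- n) :* n := con 0ℚ :* (n :* n :+ (:- n) :* n)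
        :+ con (- 1ℚ) :* (n :* n :- (:- n) :* n)) refl n̄)))
    (trans (ℚ[i]-Solver.solve 3 (λ r j c → r ⊛ (j ⊛ c) ≐ j ⊛ (r ⊛ c)) refl
        (ρ (suc N)) (⊝ 𝕚) (a (suc N) ⊗ A (suc N)))
      (trans (cong (⊝ 𝕚 ⊗_) (ρ-inverse (suc N))) (ℚi.*-identityʳ (⊝ 𝕚))))

  s : ℕ → ℚ
  s k = Σ< k (λ j → τ (suc j))

  0≤s : ∀ k → 0ℚ ≤ s k
  0≤s 0       = ≤-refl
  0≤s (suc k) = 0≤+ (0≤s k) (0≤τ (suc k))

  -- This keeps all partial angles in the ball of radius 2, for which the estimates are instantiated
  -- below.
  s≤2 : ∀ {k} → k ℕ.≤ suc N → s k ≤ fromℕ 2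
  s≤2 {k} k≤n = begin
    s k                         ≤⟨ Σ<-mono {λ j → τ (suc j)} {λ _ → h + h} k (λ j _ → τ≤2h (suc j)) ⟩
    Σ< k (λ _ → h + h)          ≡⟨ Σ<-const k (h + h) ⟩
    fromℕ k * (h + h)           ≤⟨ *-monoʳ (0≤+ 0≤h 0≤h) (fromℕ-mono k≤n) ⟩
    n̄ * (h + h)                 ≡⟨ *-distribˡ-+ n̄ h h ⟩
    n̄ * h + n̄ * h               ≡⟨ cong (λ t → t + t) n̄*h ⟩
    2ℚ                          ≡⟨ fromℕ-2 ⟨
    fromℕ 2                     ∎
    where open ≤-Reasoning

  s-last : s (suc N) ≡ ½ * riemannSum N
  s-last = go (suc N)
    where
    go : ∀ k → s k ≡ ½ * Σ< k (λ j → riemannTerm N (suc j))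
    go 0       = refl
    go (suc k) = trans (cong₂ _+_ (go k)
      (trans (sym (half+half (τ (suc k)))) (trans (sym (*-distribˡ-+ ½ (τ (suc k)) (τ (suc k))))
        (cong (½ *_) (sym (riemannTerm≡ (suc k)))))))
      (sym (*-distribˡ-+ ½ (Σ< k (λ j → riemannTerm N (suc j))) (riemannTerm N (suc k))))

  open Estimates 2
  open ExpBound 2 using (M; b)

  -- At a fixed degree the law of exponents is only approximate. Precision h² is required of it
  -- because the errors of n = 1/h steps add up.
  module _ (h≤½ : h ≤ ½) (m : ℕ)
    (law : ∀ {z w} → ‖ z ‖ ≤ b → ‖ w ‖ ≤ b →
      ‖ (expSum (suc m) z ⊗ expSum (suc m) w) ⊖ expSum (suc m) (z ⊕ w) ‖ ≤ h * h) where

    open ≤-Reasoning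

    E : ℚ → ℚ[i]
    E t = expSum (suc m) (imaginary t)

    h+h≤1 : h + h ≤ 1ℚ
    h+h≤1 = +-mono-≤ h≤½ h≤½

    ‖imaginary‖≤ : ∀ {t c} → 0ℚ ≤ t → t ≤ c → ‖ imaginary t ‖ ≤ c
    ‖imaginary‖≤ {t} 0≤t t≤c = ≤-trans (≤-reflexive (trans (‖imaginary‖ t) (0≤p⇒∣p∣≡p 0≤t))) t≤c

    -- The error of one step. The 2 is the bound for ‖ U ‖ multiplying the error of the law; 14 = 4
    -- · 2 + 2 · 3 collects the Taylor error (2h)² times ‖ U ‖ and the error of the turn.
    κ : ℚ
    κ = (h * h) * (2ℚ + M * fromℕ 14)

    fromℕ-14 : fromℕ 14 ≡ 2ℚ * 2ℚ * 2ℚ + 2ℚ * (1ℚ + 2ℚ)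
    fromℕ-14 = trans (fromℕ-+ (2 ℕ.* 2 ℕ.* 2) (2 ℕ.* 3)) (cong₂ _+_
      (trans (fromℕ-* (2 ℕ.* 2) 2) (cong₂ _*_ (trans (fromℕ-* 2 2) (cong₂ _*_ fromℕ-2 fromℕ-2)) fromℕ-2))
      (trans (fromℕ-* 2 3) (cong₂ _*_ fromℕ-2 (trans (fromℕ-+ 1 2) (cong₂ _+_ fromℕ-1 fromℕ-2)))))

    -- Three errors of order h² occur: in the law of exponents, in replacing exp(iτ) by 1 + iτ, and
    -- in (1 + iτ) U (k + 1) against U k.
    step : ∀ k → k ℕ.≤ N → ‖ (E (s (suc k)) ⊗ U (suc k)) ⊖ (E (s k) ⊗ U k) ‖ ≤ κ
    step k k≤N = begin
      ‖ (E (s (suc k)) ⊗ U′) ⊖ (E (s k) ⊗ U k) ‖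
        ≡⟨ cong ‖_‖ (ℚ[i]-Solver.solve 6 (λ e′ e x y u′ u → e′ ⊛ u′ ⊟ e ⊛ u
             ≐ (e′ ⊟ e ⊛ x) ⊛ u′ ⊞ e ⊛ ((x ⊟ y) ⊛ u′ ⊞ (y ⊛ u′ ⊟ u))) refl
             (E (s (suc k))) (E (s k)) x y U′ (U k)) ⟩
      ‖ (E (s (suc k)) ⊖ E (s k) ⊗ x) ⊗ U′ ⊕ E (s k) ⊗ ((x ⊖ y) ⊗ U′ ⊕ ((y ⊗ U′) ⊖ U k)) ‖
        ≤⟨ ‖⊕‖ ((E (s (suc k)) ⊖ E (s k) ⊗ x) ⊗ U′) (E (s k) ⊗ ((x ⊖ y) ⊗ U′ ⊕ ((y ⊗ U′) ⊖ U k))) ⟩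
      ‖ (E (s (suc k)) ⊖ E (s k) ⊗ x) ⊗ U′ ‖ + ‖ E (s k) ⊗ ((x ⊖ y) ⊗ U′ ⊕ ((y ⊗ U′) ⊖ U k)) ‖
        ≤⟨ +-mono-≤
             (‖⊗‖-mono (E (s (suc k)) ⊖ E (s k) ⊗ x) U′ 0≤2 law-error (‖U‖≤2 (suc k)))
             (‖⊗‖-mono (E (s k)) ((x ⊖ y) ⊗ U′ ⊕ ((y ⊗ U′) ⊖ U k)) 0≤bound
               (‖expSum‖≤M {imaginary (s k)} (‖imaginary‖≤ (0≤s k) (s≤2 (ℕ.m≤n⇒m≤1+n k≤N))) (suc m))
               (≤-trans (‖⊕‖ ((x ⊖ y) ⊗ U′) ((y ⊗ U′) ⊖ U k)) (+-mono-≤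
                 (‖⊗‖-mono (x ⊖ y) U′ 0≤2 taylor (‖U‖≤2 (suc k))) turn-error))) ⟩
      (h * h) * 2ℚ + M * ((h + h) * (h + h) * 2ℚ + (h * h) * (2ℚ * (1ℚ + 2ℚ)))
        ≡⟨ solve 2 (λ h M → h :* h :* con 2ℚ :+ M :* ((h :+ h) :* (h :+ h) :* con 2ℚ
               :+ h :* h :* (con 2ℚ :* (con 1ℚ :+ con 2ℚ)))
             := h :* h :* (con 2ℚ :+ M :* (con 2ℚ :* con 2ℚ :* con 2ℚ :+ con 2ℚ :* (con 1ℚ :+ con 2ℚ)))) refl h M ⟩
      (h * h) * (2ℚ + M * (2ℚ * 2ℚ * 2ℚ + 2ℚ * (1ℚ + 2ℚ)))
        ≡⟨ cong (λ t → (h * h) * (2ℚ + M * t)) fromℕ-14 ⟨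
      κ ∎
      where
      U′ = U (suc k)
      t = τ (suc k)
      x = E t
      y = 1ᵍ ⊕ imaginary t
      0≤bound : 0ℚ ≤ (h + h) * (h + h) * 2ℚ + (h * h) * (2ℚ * (1ℚ + 2ℚ))
      0≤bound = 0≤+ (0≤* (0≤square (h + h)) 0≤2) (0≤* (0≤square h) (0≤* 0≤2 (0≤+ (<⇒≤ 0<1) 0≤2)))
      ‖t‖≤ : ‖ imaginary t ‖ ≤ h + h
      ‖t‖≤ = ‖imaginary‖≤ (0≤τ (suc k)) (τ≤2h (suc k))
      1≤b : 1ℚ ≤ b
      1≤b = ≤-trans (≤-reflexive (sym fromℕ-1)) (fromℕ-mono (s≤s (z≤n {1})))
      law-error : ‖ E (s (suc k)) ⊖ E (s k) ⊗ x ‖ ≤ h * h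
      law-error = ≤-trans
        (≤-reflexive (trans (‖⊖‖-sym (E (s (suc k))) (E (s k) ⊗ x))
          (cong (λ z → ‖ (E (s k) ⊗ x) ⊖ expSum (suc m) z ‖) {imaginary (s (suc k))}
            {imaginary (s k) ⊕ imaginary t} (cong₂ _+i_ (sym (+-identityʳ 0ℚ)) refl))))
        (law {imaginary (s k)} {imaginary t}
          (‖imaginary‖≤ (0≤s k) (s≤2 (ℕ.m≤n⇒m≤1+n k≤N))) (≤-trans ‖t‖≤ (≤-trans h+h≤1 1≤b)))
      taylor : ‖ x ⊖ y ‖ ≤ (h + h) * (h + h)
      taylor = ≤-trans (expSum-1+z {imaginary t} (≤-trans ‖t‖≤ h+h≤1) m)
        (square-mono (0≤‖ imaginary t ‖) ‖t‖≤)
      turn-error : ‖ (y ⊗ U′) ⊖ U k ‖ ≤ (h * h) * (2ℚ * (1ℚ + 2ℚ))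
      turn-error = ≤-trans (≤-reflexive (cong ‖_‖ (turn k)))
        (‖⊗‖-mono (ρ (suc k)) (U′ ⊗ (1ᵍ ⊕ U k)) (0≤* 0≤2 (0≤+ (<⇒≤ 0<1) 0≤2))
          (≤-trans (≤-reflexive (‖ρ‖ (suc k))) (r≤h² (suc k)))
          (‖⊗‖-mono U′ (1ᵍ ⊕ U k) (0≤+ (<⇒≤ 0<1) 0≤2) (‖U‖≤2 (suc k))
            (≤-trans (‖⊕‖ 1ᵍ (U k)) (+-mono-≤ (≤-refl {1ℚ}) (‖U‖≤2 k)))))

    product : ∀ k → k ℕ.≤ suc N → ‖ (E (s k) ⊗ U k) ⊖ 1ᵍ ‖ ≤ fromℕ k * κ
    product 0 _ = begin
      ‖ (E 0ℚ ⊗ U 0) ⊖ 1ᵍ ‖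
        ≡⟨ cong (λ t → ‖ t ⊖ 1ᵍ ‖) (trans (cong (E 0ℚ ⊗_) U-0) (ℚi.*-identityʳ (E 0ℚ))) ⟩
      ‖ E 0ℚ ⊖ 1ᵍ ‖      ≤⟨ expSum-1+z {imaginary 0ℚ} (<⇒≤ 0<1) m ⟩
      0ℚ                 ≡⟨ trans (cong (_* κ) fromℕ-0) (*-zeroˡ κ) ⟨
      fromℕ 0 * κ        ∎
    product (suc k) (s≤s k≤N) = begin
      ‖ (E (s (suc k)) ⊗ U (suc k)) ⊖ 1ᵍ ‖
        ≤⟨ ‖⊖‖-triangle (E (s (suc k)) ⊗ U (suc k)) (E (s k) ⊗ U k) 1ᵍ ⟩
      ‖ (E (s (suc k)) ⊗ U (suc k)) ⊖ (E (s k) ⊗ U k) ‖ + ‖ (E (s k) ⊗ U k) ⊖ 1ᵍ ‖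
        ≤⟨ +-mono-≤ (step k k≤N) (product k (ℕ.m≤n⇒m≤1+n k≤N)) ⟩
      κ + fromℕ k * κ
        ≡⟨ solve 2 (λ c k → c :+ k :* c := (k :+ con 1ℚ) :* c) refl κ (fromℕ k) ⟩
      (fromℕ k + 1ℚ) * κ     ≡⟨ cong (_* κ) (fromℕ-suc k) ⟨
      fromℕ (suc k) * κ      ∎

    -- After n steps the total error n κ is of order h; since U n = - i, the exponential itself is
    -- close to i.
    quarter : ‖ E (½ * riemannSum N) ⊖ 𝕚 ‖ ≤ h * (2ℚ + M * fromℕ 14)
    quarter = begin
      ‖ E (½ * riemannSum N) ⊖ 𝕚 ‖      ≡⟨ cong (λ t → ‖ E t ⊖ 𝕚 ‖) s-last ⟨
      ‖ E (s (suc N)) ⊖ 𝕚 ‖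
        ≡⟨ cong ‖_‖ (rotate (E (s (suc N)))) ⟩
      ‖ 𝕚 ⊗ ((E (s (suc N)) ⊗ ⊝ 𝕚) ⊖ 1ᵍ) ‖
        ≤⟨ ‖⊗‖ 𝕚 ((E (s (suc N)) ⊗ ⊝ 𝕚) ⊖ 1ᵍ) ⟩
      1ℚ * ‖ (E (s (suc N)) ⊗ ⊝ 𝕚) ⊖ 1ᵍ ‖
        ≡⟨ *-identityˡ _ ⟩
      ‖ (E (s (suc N)) ⊗ ⊝ 𝕚) ⊖ 1ᵍ ‖
        ≡⟨ cong (λ t → ‖ (E (s (suc N)) ⊗ t) ⊖ 1ᵍ ‖) U-last ⟨
      ‖ (E (s (suc N)) ⊗ U (suc N)) ⊖ 1ᵍ ‖    ≤⟨ product (suc N) ℕ.≤-refl ⟩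
      n̄ * κ
        ≡⟨ solve 3 (λ n h c → n :* (h :* h :* c) := (n :* h) :* (h :* c)) refl n̄ h (2ℚ + M * fromℕ 14) ⟩
      (n̄ * h) * (h * (2ℚ + M * fromℕ 14))     ≡⟨ cong (_* (h * (2ℚ + M * fromℕ 14))) n̄*h ⟩
      1ℚ * (h * (2ℚ + M * fromℕ 14))          ≡⟨ *-identityˡ _ ⟩
      h * (2ℚ + M * fromℕ 14)                 ∎
      where
      rotate : ∀ u → u ⊖ 𝕚 ≡ 𝕚 ⊗ ((u ⊗ ⊝ 𝕚) ⊖ 1ᵍ)
      rotate = ℚ[i]-Solver.solve 1 (λ u → u ⊟ ℚ[i]-Solver.con 𝕚
        ≐ ℚ[i]-Solver.con 𝕚 ⊛ (u ⊛ ℚ[i]-Solver.con (⊝ 𝕚) ⊟ ℚ[i]-Solver.con 1ᵍ)) refl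

-- The character t ↦ e(t) as a family of bounded sequences.

module UnitCircle where

  open GaussianRationals
  open ExponentialLaw
  open BoundedSequences
  open QuarterTurn
  open import Data.Integer.Base as ℤ using (ℤ; +_)
  import Data.Integer.Properties as ℤ
  open import Data.Nat.Base as ℕ using (suc; s≤s; z≤n; NonZero)
  open import Data.Nat.DivMod using (m≡m%n+[m/n]*n; m%n<n; m≥n⇒m/n>0)
  import Data.Nat.Properties as ℕ
  open import Data.Product.Base using (_,_; proj₁; proj₂)
  open import Data.Rational hiding (NonZero)
  open import Data.Rational.Properties
  import Data.Rational.Unnormalised.Base as ℚᵘ
  import Data.Rational.Unnormalised.Properties as ℚᵘ
  open import Data.Rational.Solver using (module +-*-Solver)
  open import Relation.Binary.PropositionalEquality
  open import Relation.Nullary.Decidable using (from-yes)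
  open ℚ[i]-Solver using () renaming (_:=_ to _≐_; _:+_ to _⊞_; _:*_ to _⊛_; _:-_ to _⊟_)
  open +-*-Solver using (solve; _:=_; _:+_; _:*_; _:-_; con)

  toSequence : ℂ → Sequence
  toSequence z = record
    { at = λ n → seq (re z) n +i seq (im z) n
    ; at-bound = let B , 0≤B , h = bounded {seq (re z)} (cauchy (re z))
                     C , 0≤C , k = bounded {seq (im z)} (cauchy (im z)) in
        B + C , 0≤+ 0≤B 0≤C , λ n → +-mono-≤ (h n) (k n) }

  angle : ℕ → ℚ → ℚ
  angle n q = + 2 / 1 * riemannSum n * q

  -- Opaque only to keep the type checker from comparing the Cauchy proofs
  -- inside exp.
  opaque
    circle : ℚ → Sequence
    circle q = toSequence (exp (mkℂ 0ʳ (fromℚ (+ 2 / 1) *ʳ π *ʳ fromℚ q)))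

    at-circle : ∀ q n → at (circle q) n ≡ expSum n (imaginary (angle n q))
    at-circle q n = refl

  0≤½riemannSum : ∀ n → 0ℚ ≤ ½ * riemannSum n
  0≤½riemannSum n = subst (0ℚ ≤_) (TurnProduct.s-last n) (TurnProduct.0≤s n (suc n))

  ½riemannSum≤2 : ∀ n → ½ * riemannSum n ≤ fromℕ 2
  ½riemannSum≤2 n = subst (_≤ fromℕ 2) (TurnProduct.s-last n) (TurnProduct.s≤2 n ℕ.≤-refl)

  -- The 8 bounds the approximations to 2π, those to π/2 being at most 2.
  ∣angle∣≤ : ∀ n q → ‖ imaginary (angle n q) ‖ ≤ fromℕ 8 * ∣ q ∣
  ∣angle∣≤ n q = begin
    ‖ imaginary (angle n q) ‖                   ≡⟨ ‖imaginary‖ (angle n q) ⟩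
    ∣ + 2 / 1 * riemannSum n * q ∣
      ≡⟨ cong ∣_∣ (solve 2 (λ s q → con (+ 2 / 1) :* s :* q
           := (con (+ 4 / 1) :* (con ½ :* s)) :* q) refl (riemannSum n) q) ⟩
    ∣ + 4 / 1 * (½ * riemannSum n) * q ∣        ≡⟨ ∣p*q∣≡∣p∣*∣q∣ (+ 4 / 1 * (½ * riemannSum n)) q ⟩
    ∣ + 4 / 1 * (½ * riemannSum n) ∣ * ∣ q ∣
      ≡⟨ cong (_* ∣ q ∣) (0≤p⇒∣p∣≡p (0≤* 0≤4 (0≤½riemannSum n))) ⟩
    + 4 / 1 * (½ * riemannSum n) * ∣ q ∣
      ≤⟨ *-monoʳ (0≤∣p∣ q) (*-monoˡ 0≤4 (½riemannSum≤2 n)) ⟩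
    + 4 / 1 * fromℕ 2 * ∣ q ∣
      ≡⟨ cong (_* ∣ q ∣) (trans (cong (_* fromℕ 2) (sym fromℕ-4)) (sym (fromℕ-* 4 2))) ⟩
    fromℕ 8 * ∣ q ∣                             ∎
    where
    open ≤-Reasoning
    0≤4 : 0ℚ ≤ + 4 / 1
    0≤4 = from-yes (0ℚ ≤? + 4 / 1)

  -- The angles for all n lie in one ball, whose radius depends on q and r only; hence the uniform
  -- law applies.
  circle-+ : ∀ q r → circle (q + r) ≈ˢ (circle q *ˢ circle r)
  circle-+ q r = ≈ˢ-intro λ ε 0<ε →
    let N , law = Estimates.expSum-law-limit B 0<ε in
    N , λ n N≤n → ≤-trans
      (≤-reflexive (trans
        (cong₂ (λ u v → ‖ u ⊖ v ‖)
          (trans (at-circle (q + r) n) (cong (expSum n) (imaginary-angle n)))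
          (trans (at-*ˢ (circle q) (circle r) n) (cong₂ _⊗_ (at-circle q n) (at-circle r n))))
        (‖⊖‖-sym (expSum n (imaginary (angle n q) ⊕ imaginary (angle n r)))
                 (expSum n (imaginary (angle n q)) ⊗ expSum n (imaginary (angle n r))))))
      (law n N≤n {imaginary (angle n q)} {imaginary (angle n r)} (bound₁ n) (bound₂ n))
    where
    c = fromℕ 8 * ∣ q ∣ + fromℕ 8 * ∣ r ∣
    B = ℤ.∣ ↥ c ∣
    bound₁ : ∀ n → ‖ imaginary (angle n q) ‖ ≤ fromℕ B
    bound₁ n = ≤-trans (∣angle∣≤ n q) (≤-trans (p≤p+q (0≤* (0≤fromℕ 8) (0≤∣p∣ r))) (≤fromℕ c))
    bound₂ : ∀ n → ‖ imaginary (angle n r) ‖ ≤ fromℕ B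
    bound₂ n = ≤-trans (∣angle∣≤ n r) (≤-trans (p≤q+p (0≤* (0≤fromℕ 8) (0≤∣p∣ q))) (≤fromℕ c))
    imaginary-angle : ∀ n → imaginary (angle n (q + r)) ≡ imaginary (angle n q) ⊕ imaginary (angle n r)
    imaginary-angle n = cong₂ _+i_ (sym (+-identityʳ 0ℚ))
      (*-distribˡ-+ (+ 2 / 1 * riemannSum n) q r)

  ¼ : ℚ
  ¼ = + 1 / 4

  -- In `circle` one index is both the degree of the partial sum and the fineness of the Riemann
  -- sum, whereas `quarter` needs a degree that is large in terms of `N`. So `N` is fixed first, and
  -- the Lipschitz bound for partial sums moves the angle from the n-th to the N-th approximation.
  circle-¼ : circle ¼ ≈ˢ constant 𝕚
  circle-¼ = ≈ˢ-intro λ ε 0<ε → eventually-map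
    (λ {n} → subst (λ t → ‖ t ⊖ 𝕚 ‖ ≤ ε)
      (sym (trans (at-circle ¼ n) (cong (λ t → expSum n (imaginary t)) (angle-¼ n))))) (limit ε 0<ε)
    where
    open Estimates 2
    open ExpBound 2 using (M; P; ‖expSum-difference‖)
    c = 1ℚ + 1ℚ + M * fromℕ 14
    0≤c : 0ℚ ≤ c
    0≤c = 0≤+ (0≤+ (<⇒≤ 0<1) (<⇒≤ 0<1)) (0≤* 0≤M (0≤fromℕ 14))
    angle-¼ : ∀ n → angle n ¼ ≡ ½ * riemannSum n
    angle-¼ n = solve 1 (λ s → con (+ 2 / 1) :* s :* con ¼ := con ½ :* s) refl (riemannSum n)
    z : ℕ → ℚ[i]
    z n = imaginary (½ * riemannSum n)
    ‖z‖≤2 : ∀ n → ‖ z n ‖ ≤ fromℕ 2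
    ‖z‖≤2 n = ≤-trans (≤-reflexive (trans (‖imaginary‖ _) (0≤p⇒∣p∣≡p (0≤½riemannSum n)))) (½riemannSum≤2 n)
    module _ (ε : ℚ) (N₁ : ℕ) (small : c * 1/suc N₁ ≤ ½ * ε) (δ : ℚ) (0<δ : 0ℚ < δ)
      (Mδ≤ : M * δ ≤ ½ * ε) (N₂ : ℕ)
      (close-π : ∀ m n → N₂ ℕ.≤ m → N₂ ℕ.≤ n → ∣ riemannSum m - riemannSum n ∣ ≤ δ) where
      N = suc (N₁ ℕ.⊔ N₂)
      h = 1/suc N
      open ≤-Reasoning
      h≤½ : h ≤ ½
      h≤½ = ≤-trans (1/suc-antimono (s≤s (z≤n {N₁ ℕ.⊔ N₂}))) (≤-reflexive 1/suc-1)
      module _ (N₃ : ℕ) (law : ∀ n → N₃ ℕ.≤ n → ∀ {z w} → ‖ z ‖ ≤ fromℕ 2 → ‖ w ‖ ≤ fromℕ 2 →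
          ‖ (expSum n z ⊗ expSum n w) ⊖ expSum n (z ⊕ w) ‖ ≤ h * h) where
        main : ∀ n → suc (N₃ ℕ.⊔ N) ℕ.≤ n → ‖ expSum n (z n) ⊖ 𝕚 ‖ ≤ ε
        main (suc m) (s≤s N₃⊔N≤m) = begin
          ‖ expSum n (z n) ⊖ 𝕚 ‖
            ≤⟨ ‖⊖‖-triangle (expSum n (z n)) (expSum n (z N)) 𝕚 ⟩
          ‖ expSum n (z n) ⊖ expSum n (z N) ‖ + ‖ expSum n (z N) ⊖ 𝕚 ‖
            ≤⟨ +-mono-≤ (≤-trans (‖expSum-difference‖ {z n} {z N} (‖z‖≤2 n) (‖z‖≤2 N) n)
                 (*-mono (0≤‖ z n ⊖ z N ‖) Δ≤δ 0≤M (P≤M-all n)))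
                 (TurnProduct.quarter N h≤½ m (λ {z} {w} → law n N₃≤n {z} {w})) ⟩
          δ * M + h * c      ≡⟨ cong₂ _+_ (*-comm δ M) (*-comm h c) ⟩
          M * δ + c * h
            ≤⟨ +-mono-≤ Mδ≤ (≤-trans (*-monoˡ 0≤c (1/suc-antimono
                 (ℕ.≤-trans (ℕ.m≤m⊔n N₁ N₂) (ℕ.n≤1+n (N₁ ℕ.⊔ N₂))))) small) ⟩
          ½ * ε + ½ * ε      ≡⟨ half+half ε ⟩
          ε                  ∎
          where
          n = suc m
          N₃≤n : N₃ ℕ.≤ n
          N₃≤n = ℕ.m≤n⇒m≤1+n (ℕ.m⊔n≤o⇒m≤o N₃ N N₃⊔N≤m)
          N₂≤N : N₂ ℕ.≤ N
          N₂≤N = ℕ.≤-trans (ℕ.m≤n⊔m N₁ N₂) (ℕ.n≤1+n (N₁ ℕ.⊔ N₂))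
          N₂≤n : N₂ ℕ.≤ n
          N₂≤n = ℕ.≤-trans N₂≤N (ℕ.m≤n⇒m≤1+n (ℕ.m⊔n≤o⇒n≤o N₃ N N₃⊔N≤m))
          Δ≤δ : ‖ z n ⊖ z N ‖ ≤ δ
          Δ≤δ = begin
            ‖ z n ⊖ z N ‖
              ≡⟨ cong ‖_‖ {z n ⊖ z N} {imaginary (½ * (riemannSum n - riemannSum N))} (cong₂ _+i_ refl
                   (solve 2 (λ s t → con ½ :* s :- con ½ :* t := con ½ :* (s :- t)) refl
                     (riemannSum n) (riemannSum N))) ⟩
            ‖ imaginary (½ * (riemannSum n - riemannSum N)) ‖
              ≡⟨ ‖imaginary‖ (½ * (riemannSum n - riemannSum N)) ⟩
            ∣ ½ * (riemannSum n - riemannSum N) ∣   ≡⟨ ∣p*q∣≡∣p∣*∣q∣ ½ (riemannSum n - riemannSum N) ⟩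
            ½ * ∣ riemannSum n - riemannSum N ∣
              ≤⟨ *-monoˡ (<⇒≤ 0<½) (close-π n N N₂≤n N₂≤N) ⟩
            ½ * δ                                   ≤⟨ p≤p+q (<⇒≤ (half 0<δ)) ⟩
            ½ * δ + ½ * δ                           ≡⟨ half+half δ ⟩
            δ                                       ∎
    limit : ∀ ε → 0ℚ < ε → Eventually (λ n → ‖ expSum n (z n) ⊖ 𝕚 ‖ ≤ ε)
    limit ε 0<ε =
      let N₁ , small     = 1/suc-small′ c 0≤c (half 0<ε)
          δ , 0<δ , Mδ≤  = shrink M (half 0<ε)
          N₂ , close-π   = cauchy-riemannSum δ 0<δ
          0<h            = 0<1/suc (suc (N₁ ℕ.⊔ N₂))
          N₃ , law       = expSum-law-limit (0<* 0<h 0<h)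
      in suc (N₃ ℕ.⊔ suc (N₁ ℕ.⊔ N₂)) , main ε N₁ small δ 0<δ Mδ≤ N₂ close-π N₃ law

  circle-double : ∀ q r {u v} → q + q ≡ r → circle q ≈ˢ constant u → u ⊗ u ≡ v → circle r ≈ˢ constant v
  circle-double q r {u} {v} q+q≡r h u²≡v = subst (λ t → circle t ≈ˢ constant v) q+q≡r
    (≈ˢ-trans {circle (q + q)} {circle q *ˢ circle q} {constant v} (circle-+ q q)
      (≈ˢ-trans {circle q *ˢ circle q} {constant u *ˢ constant u} {constant v}
        (*ˢ-cong {circle q} {constant u} {circle q} {constant u} h h)
        (≗⇒≈ˢ {constant u *ˢ constant u} {constant v}
          (λ n → trans (at-*ˢ (constant u) (constant u) n) u²≡v))))

  circle-½ : circle ½ ≈ˢ constant (⊝ 1ᵍ)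
  circle-½ = circle-double ¼ ½ {𝕚} {⊝ 1ᵍ} refl circle-¼ refl

  circle-1 : circle 1ℚ ≈ˢ constant 1ᵍ
  circle-1 = circle-double ½ 1ℚ {⊝ 1ᵍ} {1ᵍ} refl circle-½ refl

  circle-½-apart : Eventually (λ n → ½ ≤ ‖ at (circle ½) n ⊖ 1ᵍ ‖)
  circle-½-apart = eventually-map (λ {n} → apart n) (close circle-½ 1ℚ 0<1)
    where
    open ≤-Reasoning
    apart : ∀ n → ‖ at (circle ½) n ⊖ ⊝ 1ᵍ ‖ ≤ 1ℚ → ½ ≤ ‖ at (circle ½) n ⊖ 1ᵍ ‖
    apart n h = ≤-trans (from-yes (½ ≤? 1ℚ)) (+-cancel-≤ 1ℚ (begin
      1ℚ + 1ℚ                          ≡⟨⟩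
      ‖ ⊝ 1ᵍ ⊖ 1ᵍ ‖                    ≤⟨ ‖⊖‖-triangle (⊝ 1ᵍ) (at (circle ½) n) 1ᵍ ⟩
      ‖ ⊝ 1ᵍ ⊖ at (circle ½) n ‖ + ‖ at (circle ½) n ⊖ 1ᵍ ‖
        ≤⟨ +-monoˡ-≤ _ (≤-trans (≤-reflexive (‖⊖‖-sym (⊝ 1ᵍ) (at (circle ½) n))) h) ⟩
      1ℚ + ‖ at (circle ½) n ⊖ 1ᵍ ‖    ∎))

  -- At an angle within 2π/12 ≤ 2/3 (as π ≤ 4) of π/2, the exponential differs
  -- from i by at most 2/3 + (2/3)² < 2 = ‖ i - 1 ‖.
  circle-apart : ∀ q → ∣ q - ¼ ∣ ≤ + 1 / 12 → Eventually (λ n → ½ ≤ ‖ at (circle q) n ⊖ 1ᵍ ‖)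
  circle-apart q h = eventually-map
    (λ { {n} (h₁ , h₂) → apart n h₁ (subst (λ t → ‖ at (circle q) n ⊖ t ‖ ≤ + 1 / 6)
      (at-*ˢ (constant 𝕚) (circle d) n) h₂) })
    (eventually-× (1 , λ { (suc n) _ → near-1 n })
      (close near-quarter (+ 1 / 6) (from-yes (0ℚ <? + 1 / 6))))
    where
    open ≤-Reasoning
    d = q - ¼
    near-quarter : circle q ≈ˢ (constant 𝕚 *ˢ circle d)
    near-quarter = subst (λ t → circle t ≈ˢ (constant 𝕚 *ˢ circle d))
      (solve 2 (λ q c → c :+ (q :- c) := q) refl q ¼)
      (≈ˢ-trans {circle (¼ + d)} {circle ¼ *ˢ circle d} {constant 𝕚 *ˢ circle d} (circle-+ ¼ d)
        (*ˢ-cong {circle ¼} {constant 𝕚} {circle d} {circle d} circle-¼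
          (≗⇒≈ˢ {circle d} {circle d} (λ _ → refl))))
    ‖z‖≤ : ∀ n → ‖ imaginary (angle n d) ‖ ≤ + 2 / 3
    ‖z‖≤ n = begin
      ‖ imaginary (angle n d) ‖   ≤⟨ ∣angle∣≤ n d ⟩
      fromℕ 8 * ∣ d ∣             ≤⟨ *-monoˡ (0≤fromℕ 8) h ⟩
      fromℕ 8 * (+ 1 / 12)
        ≡⟨ cong (_* (+ 1 / 12)) (trans (fromℕ-+ 4 4) (cong (λ t → t + t) (trans (fromℕ-+ 2 2)
             (cong (λ t → t + t) fromℕ-2)))) ⟩
      + 2 / 3                     ∎
    near-1 : ∀ n → ‖ at (circle d) (suc n) ⊖ 1ᵍ ‖ ≤ + 10 / 9
    near-1 n = begin
      ‖ at (circle d) (suc n) ⊖ 1ᵍ ‖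
        ≡⟨ cong (λ t → ‖ t ⊖ 1ᵍ ‖) (at-circle d (suc n)) ⟩
      ‖ expSum (suc n) z ⊖ 1ᵍ ‖
        ≤⟨ ‖⊖‖-triangle (expSum (suc n) z) (1ᵍ ⊕ z) 1ᵍ ⟩
      ‖ expSum (suc n) z ⊖ (1ᵍ ⊕ z) ‖ + ‖ (1ᵍ ⊕ z) ⊖ 1ᵍ ‖
        ≤⟨ +-mono-≤ (≤-trans (expSum-1+z {z} (≤-trans (‖z‖≤ (suc n)) (from-yes (+ 2 / 3 ≤? 1ℚ))) n)
             (square-mono (0≤‖ z ‖) (‖z‖≤ (suc n))))
           (≤-trans (≤-reflexive (cong ‖_‖ (ℚ[i]-Solver.solve 1 (λ z →
             (ℚ[i]-Solver.con 1ᵍ ⊞ z) ⊟ ℚ[i]-Solver.con 1ᵍ ≐ z)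
             refl z))) (‖z‖≤ (suc n))) ⟩
      + 2 / 3 * (+ 2 / 3) + + 2 / 3   ≡⟨⟩
      + 10 / 9                        ∎
      where z = imaginary (angle (suc n) d)
    apart : ∀ n → ‖ at (circle d) n ⊖ 1ᵍ ‖ ≤ + 10 / 9 →
      ‖ at (circle q) n ⊖ (𝕚 ⊗ at (circle d) n) ‖ ≤ + 1 / 6 → ½ ≤ ‖ at (circle q) n ⊖ 1ᵍ ‖
    -- From ‖ i - 1 ‖ = 2 are taken 10/9 = 2/3 + 4/9 for the deviation of `circle d` from 1 and 1/6
    -- for the chosen tolerance; 13/18 remains.
    apart n near close = ≤-trans (from-yes (½ ≤? + 13 / 18)) (+-cancel-≤ (+ 23 / 18) (begin
      + 13 / 18 + + 23 / 18   ≡⟨⟩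
      ‖ 𝕚 ⊖ 1ᵍ ‖              ≤⟨ ‖⊖‖-triangle 𝕚 (𝕚 ⊗ v) 1ᵍ ⟩
      ‖ 𝕚 ⊖ (𝕚 ⊗ v) ‖ + ‖ (𝕚 ⊗ v) ⊖ 1ᵍ ‖
        ≤⟨ +-mono-≤ first (≤-trans (‖⊖‖-triangle (𝕚 ⊗ v) u 1ᵍ)
             (+-monoˡ-≤ (‖ u ⊖ 1ᵍ ‖) (≤-trans (≤-reflexive (‖⊖‖-sym (𝕚 ⊗ v) u)) close))) ⟩
      + 10 / 9 + (+ 1 / 6 + ‖ u ⊖ 1ᵍ ‖)   ≡⟨ +-assoc (+ 10 / 9) (+ 1 / 6) (‖ u ⊖ 1ᵍ ‖) ⟨
      + 23 / 18 + ‖ u ⊖ 1ᵍ ‖              ∎))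
      where
      u = at (circle q) n
      v = at (circle d) n
      first : ‖ 𝕚 ⊖ (𝕚 ⊗ v) ‖ ≤ + 10 / 9
      first = begin
        ‖ 𝕚 ⊖ (𝕚 ⊗ v) ‖
          ≡⟨ trans (‖⊖‖-sym 𝕚 (𝕚 ⊗ v)) (cong ‖_‖ (ℚ[i]-Solver.solve 1 (λ v →
               ℚ[i]-Solver.con 𝕚 ⊛ v ⊟ ℚ[i]-Solver.con 𝕚
               ≐ ℚ[i]-Solver.con 𝕚 ⊛ (v ⊟ ℚ[i]-Solver.con 1ᵍ)) refl v)) ⟩
        ‖ 𝕚 ⊗ (v ⊖ 1ᵍ) ‖        ≤⟨ ‖⊗‖ 𝕚 (v ⊖ 1ᵍ) ⟩
        1ℚ * ‖ v ⊖ 1ᵍ ‖         ≡⟨ *-identityˡ (‖ v ⊖ 1ᵍ ‖) ⟩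
        ‖ v ⊖ 1ᵍ ‖              ≤⟨ near ⟩
        + 10 / 9                ∎

  /-+ : ∀ a b p .{{_ : NonZero p}} → (a ℤ.+ b) / p ≡ a / p + b / p
  /-+ a b (suc p) = toℚᵘ-injective (begin
    toℚᵘ ((a ℤ.+ b) / suc p)                  ≈⟨ toℚᵘ-fromℚᵘ (ℚᵘ.mkℚᵘ (a ℤ.+ b) p) ⟩
    ℚᵘ.mkℚᵘ (a ℤ.+ b) p                       ≈⟨ ℚᵘ.*≡* same ⟩
    ℚᵘ.mkℚᵘ a p ℚᵘ.+ ℚᵘ.mkℚᵘ b p
      ≈⟨ ℚᵘ.+-cong (toℚᵘ-fromℚᵘ (ℚᵘ.mkℚᵘ a p)) (toℚᵘ-fromℚᵘ (ℚᵘ.mkℚᵘ b p)) ⟨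
    toℚᵘ (a / suc p) ℚᵘ.+ toℚᵘ (b / suc p)    ≈⟨ toℚᵘ-homo-+ (a / suc p) (b / suc p) ⟨
    toℚᵘ (a / suc p + b / suc p)              ∎)
    where
    open ℚᵘ.≃-Reasoning
    same : (a ℤ.+ b) ℤ.* + (suc p ℕ.* suc p) ≡ (a ℤ.* + suc p ℤ.+ b ℤ.* + suc p) ℤ.* + suc p
    same = trans (cong ((a ℤ.+ b) ℤ.*_) (ℤ.pos-* (suc p) (suc p)))
      (trans (sym (ℤ.*-assoc (a ℤ.+ b) (+ suc p) (+ suc p)))
        (cong (ℤ._* + suc p) (ℤ.*-distribʳ-+ (+ suc p) a b)))

  p/p : ∀ p .{{_ : NonZero p}} → + p / p ≡ 1ℚ
  p/p (suc p) = /-cong-ℕ {suc p} {p} {1} {0} (ℕ.*-comm (suc p) 1)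

  neg-/ : ∀ a p .{{_ : NonZero p}} → (ℤ.- a) / p ≡ - (a / p)
  neg-/ a p = begin
    (ℤ.- a) / p                         ≡⟨ solve 2 (λ s t → s := (s :+ t) :- t) refl ((ℤ.- a) / p) (a / p) ⟩
    (ℤ.- a) / p + a / p - a / p         ≡⟨ cong (_- a / p) (/-+ (ℤ.- a) a p) ⟨
    (ℤ.- a ℤ.+ a) / p - a / p           ≡⟨ cong (λ t → t / p - a / p) (ℤ.+-inverseˡ a) ⟩
    + 0 / p - a / p                     ≡⟨ cong (_- a / p) (0/n≡0 p) ⟩
    0ℚ - a / p                          ≡⟨ +-identityˡ (- (a / p)) ⟩
    - (a / p)                           ∎
    where
    open ≡-Reasoning

  χ : (p : ℕ) .{{_ : NonZero p}} → ℤ → Sequence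
  χ p t = circle (t / p)

  -- An equality at every index, because the coefficients of the power series are real. It turns
  -- `moment` into a sum of squared moduli already before the limit.
  χ-neg : ∀ p .{{_ : NonZero p}} t n → at (χ p (ℤ.- t)) n ≡ conj (at (χ p t) n)
  χ-neg p t n = begin
    at (circle ((ℤ.- t) / p)) n                       ≡⟨ at-circle ((ℤ.- t) / p) n ⟩
    expSum n (imaginary (angle n ((ℤ.- t) / p)))
      ≡⟨ cong (λ q → expSum n (imaginary q)) (trans (cong (angle n) (neg-/ t p))
           (sym (neg-distribʳ-* (+ 2 / 1 * riemannSum n) (t / p)))) ⟩
    expSum n (conj (imaginary (angle n (t / p))))     ≡⟨ conj-expSum n (imaginary (angle n (t / p))) ⟨
    conj (expSum n (imaginary (angle n (t / p))))     ≡⟨ cong conj (at-circle (t / p) n) ⟨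
    conj (at (circle (t / p)) n)                      ∎
    where open ≡-Reasoning

  -- As e(1) tends to 1 when p grows, a multiple j is taken with j/p within 1/12 of a quarter turn.
  -- No such j exists for p = 2, where e(1) = - 1 is used.
  nontrivial : ∀ p .{{_ : NonZero p}} → 2 ℕ.≤ p →
    ∃[ j ] Eventually (λ n → ½ ≤ ‖ at (χ p j) n ⊖ 1ᵍ ‖)
  nontrivial 1 (s≤s ())
  nontrivial 2 _ = + 1 , circle-½-apart
  -- The fraction j / p lies between 1/6 and 1/3.
  nontrivial p@(suc (suc (suc p-3))) _ = + j , circle-apart (+ j / p) (≤⇒∣∣≤ upper lower)
    where
    j = p ℕ./ 3
    p≡ : p ≡ p ℕ.% 3 ℕ.+ j ℕ.* 3
    p≡ = m≡m%n+[m/n]*n p 3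
    1≤j : 1 ℕ.≤ j
    1≤j = m≥n⇒m/n>0 {p} {3} (s≤s (s≤s (s≤s z≤n)))
    upper : + j / p ≤ ¼ + + 1 / 12
    upper = /-mono-≤ {j} {suc (suc p-3)} {1} {2}
      (subst (j ℕ.* 3 ℕ.≤_) (trans (sym p≡) (sym (ℕ.*-identityˡ p))) (ℕ.m≤n+m (j ℕ.* 3) (p ℕ.% 3)))
    lower : ¼ ≤ + j / p + + 1 / 12
    lower = ≤-trans (≤-reflexive {¼} {+ 1 / 6 + + 1 / 12} refl)
      (+-monoˡ-≤ (+ 1 / 12) (/-mono-≤ {1} {5} {j} {suc (suc p-3)} (begin
        1 ℕ.* p                     ≡⟨ ℕ.*-identityˡ p ⟩
        p                           ≡⟨ p≡ ⟩
        p ℕ.% 3 ℕ.+ j ℕ.* 3         ≤⟨ ℕ.+-monoˡ-≤ (j ℕ.* 3) (ℕ.<⇒≤ (m%n<n p 3)) ⟩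
        3 ℕ.+ j ℕ.* 3               ≤⟨ ℕ.+-monoˡ-≤ (j ℕ.* 3) (ℕ.*-monoˡ-≤ 3 1≤j) ⟩
        j ℕ.* 3 ℕ.+ j ℕ.* 3         ≡⟨ ℕ.*-distribˡ-+ j 3 3 ⟨
        j ℕ.* 6                     ∎)))
      where open ℕ.≤-Reasoning

  circle-+-≡ : ∀ q r s → s ≡ q + r → circle s ≈ˢ (circle q *ˢ circle r)
  circle-+-≡ q r s refl = circle-+ q r

  χ-+ : ∀ p .{{_ : NonZero p}} a b → χ p (a ℤ.+ b) ≈ˢ (χ p a *ˢ χ p b)
  χ-+ p a b = circle-+-≡ (a / p) (b / p) ((a ℤ.+ b) / p) (/-+ a b p)

  χ-p : ∀ p .{{_ : NonZero p}} → χ p (+ p) ≈ˢ constant 1ᵍ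
  χ-p p = subst (λ q → circle q ≈ˢ constant 1ᵍ) (sym (p/p p)) circle-1

  χ-isCharacter : ∀ p .{{_ : NonZero p}} → 2 ℕ.≤ p → CharacterSums.IsCharacter sequenceRing p (χ p)
  χ-isCharacter p 2≤p = record
    { homo = χ-+ p
    ; period = χ-p p
    ; nontrivial = proj₁ (nontrivial p 2≤p) ,
        apart-from-1⇒no-fixed-point (χ p (proj₁ (nontrivial p 2≤p))) (proj₂ (nontrivial p 2≤p)) }

-- Cauchy-Schwarz and approximate square roots over ℚ.

module Inequalities where

  open GaussianRationals using (0≤square; fromℕ-4)
  open import Data.Empty using (⊥-elim)
  open import Data.Fin.Base using (Fin; zero; suc; punchIn)
  open import Data.Fin.Properties using (punchInᵢ≢i) renaming (_≟_ to _≟ᶠ_)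
  open import Data.List.Base using (List; []; _∷_; length; map)
  open import Data.List.Properties using (map-cong-local)
  open import Data.List.Relation.Unary.All as All using (All)
  open import Data.List.Relation.Unary.AllPairs using (AllPairs; []; _∷_)
  open import Data.Nat.Base as ℕ using (s≤s; z≤n)
  import Data.Nat.Properties as ℕ
  open import Data.Rational
  open import Data.Rational.Properties
  open import Data.Rational.Solver using (module +-*-Solver)
  open import Data.Sum.Base using (_⊎_; inj₁; inj₂)
  open import Data.Vec.Functional using (updateAt)
  open import Data.Vec.Functional.Properties using (updateAt-updates; updateAt-minimal)
  open import Function.Base using (_∘_)
  open import Relation.Binary.PropositionalEquality
  open import Relation.Nullary using (yes; no)
  open import Relation.Nullary.Decidable using (from-yes)
  open +-*-Solver using (solve; _:=_; _:+_; _:*_; _:-_; con)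

  open import Algebra.Properties.CommutativeMonoid.Sum
    +-0-commutativeMonoid public
    using () renaming (sum to sumℚ; sum-cong-≗ to sumℚ-cong; sum-remove to sumℚ-remove)

  sumᴸ : List ℚ → ℚ
  sumᴸ []       = 0ℚ
  sumᴸ (q ∷ qs) = q + sumᴸ qs

  0≤sumℚ : ∀ {n} (h : Fin n → ℚ) → (∀ i → 0ℚ ≤ h i) → 0ℚ ≤ sumℚ h
  0≤sumℚ {0}       h 0≤h = ≤-refl
  0≤sumℚ {ℕ.suc n} h 0≤h = 0≤+ (0≤h zero) (0≤sumℚ (h ∘ suc) (0≤h ∘ suc))

  sumℚ-updateAt : ∀ {n} (h : Fin n → ℚ) i → sumℚ h ≡ h i + sumℚ (updateAt h i (λ _ → 0ℚ))
  sumℚ-updateAt {ℕ.suc n} h i = trans (sumℚ-remove {i = i} h) (cong (λ t → h i + t) (sym (begin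
    sumℚ h′                              ≡⟨ sumℚ-remove {i = i} h′ ⟩
    h′ i + sumℚ (h′ ∘ punchIn i)
      ≡⟨ cong₂ _+_ (updateAt-updates i h)
           (sumℚ-cong (λ j → updateAt-minimal (punchIn i j) i h (punchInᵢ≢i i j))) ⟩
    0ℚ + sumℚ (h ∘ punchIn i)            ≡⟨ +-identityˡ _ ⟩
    sumℚ (h ∘ punchIn i)                 ∎)))
    where
    open ≡-Reasoning
    h′ = updateAt h i (λ _ → 0ℚ)

  -- After an index has been counted its value is set to 0; as the indices are distinct, the rest of
  -- the list does not notice.
  sumᴸ≤sumℚ : ∀ {n} (h : Fin n → ℚ) → (∀ i → 0ℚ ≤ h i) → ∀ {is} → AllPairs _≢_ is →
    sumᴸ (map h is) ≤ sumℚ h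
  sumᴸ≤sumℚ h 0≤h []                        = 0≤sumℚ h 0≤h
  sumᴸ≤sumℚ h 0≤h {i ∷ is} (i∉is ∷ distinct) = begin
    h i + sumᴸ (map h is)
      ≡⟨ cong (λ t → h i + sumᴸ t)
           (map-cong-local (All.map (λ {j} i≢j → sym (updateAt-minimal j i h (i≢j ∘ sym))) i∉is)) ⟩
    h i + sumᴸ (map h′ is)      ≤⟨ +-monoʳ-≤ (h i) (sumᴸ≤sumℚ h′ 0≤h′ distinct) ⟩
    h i + sumℚ h′               ≡⟨ sumℚ-updateAt h i ⟨
    sumℚ h                      ∎
    where
    open ≤-Reasoning
    h′ = updateAt h i (λ _ → 0ℚ)
    0≤h′ : ∀ j → 0ℚ ≤ h′ j
    0≤h′ j with i ≟ᶠ j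
    ... | yes refl = ≤-reflexive (sym (updateAt-updates i h))
    ... | no i≢j   = ≤-trans (0≤h j) (≤-reflexive (sym (updateAt-minimal j i h (i≢j ∘ sym))))

  module _ {A : Set} (f : A → ℚ) where

    private
      Σf Σf² : List A → ℚ
      Σf  xs = sumᴸ (map f xs)
      Σf² xs = sumᴸ (map (λ x → f x * f x) xs)

    -- The sum of (c - f x)² over `xs` is nonnegative; with c the value at a new element this bounds
    -- the cross term in the induction for Cauchy-Schwarz.
    cauchy-schwarz-tangent : ∀ c xs → c * Σf xs + c * Σf xs ≤ fromℕ (length xs) * (c * c) + Σf² xs
    cauchy-schwarz-tangent c []       = ≤-reflexive (trans
      (solve 1 (λ c → c :* con 0ℚ :+ c :* con 0ℚ := con 0ℚ :* (c :* c) :+ con 0ℚ) refl c)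
      (cong (λ t → t * (c * c) + 0ℚ) (sym fromℕ-0)))
    cauchy-schwarz-tangent c (x ∷ xs) = begin
      c * (a + s) + c * (a + s)
        ≤⟨ p≤p+q (0≤square (c - a)) ⟩
      c * (a + s) + c * (a + s) + (c - a) * (c - a)
        ≡⟨ solve 3 (λ c a s → c :* (a :+ s) :+ c :* (a :+ s) :+ (c :- a) :* (c :- a)
             := (c :* s :+ c :* s) :+ (c :* c :+ a :* a)) refl c a s ⟩
      (c * s + c * s) + (c * c + a * a)
        ≤⟨ +-monoˡ-≤ (c * c + a * a) (cauchy-schwarz-tangent c xs) ⟩
      (l * (c * c) + q) + (c * c + a * a)
        ≡⟨ solve 4 (λ c a l q → (l :* (c :* c) :+ q) :+ (c :* c :+ a :* a)
             := (l :+ con 1ℚ) :* (c :* c) :+ (a :* a :+ q)) refl c a l q ⟩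
      (l + 1ℚ) * (c * c) + (a * a + q)
        ≡⟨ cong (λ t → t * (c * c) + (a * a + q)) (fromℕ-suc (length xs)) ⟨
      fromℕ (length (x ∷ xs)) * (c * c) + (a * a + q) ∎
      where
      open ≤-Reasoning
      a = f x
      s = Σf xs
      q = Σf² xs
      l = fromℕ (length xs)

    cauchy-schwarz : ∀ xs → Σf xs * Σf xs ≤ fromℕ (length xs) * Σf² xs
    cauchy-schwarz []       = ≤-reflexive (sym (*-zeroʳ (fromℕ 0)))
    cauchy-schwarz (x ∷ xs) = begin
      (a + s) * (a + s)
        ≡⟨ solve 2 (λ a s → (a :+ s) :* (a :+ s) := (a :* s :+ a :* s) :+ s :* s :+ a :* a) refl a s ⟩
      (a * s + a * s) + s * s + a * a
        ≤⟨ +-monoˡ-≤ (a * a) (+-mono-≤ (cauchy-schwarz-tangent a xs) (cauchy-schwarz xs)) ⟩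
      (l * (a * a) + q) + l * q + a * a
        ≡⟨ solve 3 (λ a l q → (l :* (a :* a) :+ q) :+ l :* q :+ a :* a
             := (l :+ con 1ℚ) :* (a :* a :+ q)) refl a l q ⟩
      (l + 1ℚ) * (a * a + q)                   ≡⟨ cong (_* (a * a + q)) (fromℕ-suc (length xs)) ⟨
      fromℕ (length (x ∷ xs)) * (a * a + q)    ∎
      where
      open ≤-Reasoning
      a = f x
      s = Σf xs
      q = Σf² xs
      l = fromℕ (length xs)

  square-cancel-≤ : ∀ {p q} → 0ℚ ≤ q → p * p ≤ q * q → p ≤ q
  square-cancel-≤ {p} {q} 0≤q p²≤q² with p ≤? q
  ... | yes p≤q = p≤q
  ... | no p≰q  = ⊥-elim (<-irrefl refl (begin-strict
    q * q   ≤⟨ *-monoˡ 0≤q (<⇒≤ q<p) ⟩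
    q * p   <⟨ *-monoˡ-<-pos p {{positive (≤-<-trans 0≤q q<p)}} q<p ⟩
    p * p   ≤⟨ p²≤q² ⟩
    q * q   ∎))
    where
    open ≤-Reasoning
    q<p : q < p
    q<p = ≰⇒> p≰q

  approx√²≤ : ∀ n {q} → 0ℚ ≤ q → approx√ n q * approx√ n q ≤ q
  approx√²≤ n {q} 0≤q = go (Approx√.lower n q)
    where
    go : approx√ n q ≡ 0ℚ ⊎ approx√ n q * approx√ n q ≤ q → approx√ n q * approx√ n q ≤ q
    go (inj₁ e) = ≤-trans (≤-reflexive (trans (cong (_* approx√ n q) e) (*-zeroˡ (approx√ n q)))) 0≤q
    go (inj₂ h) = h

  -- The square root of L is at most the fourth root of L³, here up to a factor
  -- 2 which absorbs the errors of the approximations.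
  ¾-power-lower : ∀ L n → 1 ℕ.≤ L → 3 ℕ.≤ n → fromℕ L ≤ fromℕ 4 * (seq (L ^¾) n * seq (L ^¾) n)
  ¾-power-lower L n 1≤L 3≤n = begin
    l
      ≡⟨ solve 1 (λ l → l := (con 1ℚ :+ con 1ℚ) :* (l :- con ½ :* l)) refl l ⟩
    2ℚ * (l - ½ * l)
      ≤⟨ *-monoˡ 0≤2 (+-monoʳ-≤ l (neg-antimono-≤ (*-monoˡ (<⇒≤ 0<½) 1≤l))) ⟩
    2ℚ * (l - ½ * 1ℚ)
      ≤⟨ *-monoˡ 0≤2 (+-monoˡ-≤ (- (½ * 1ℚ)) l≤2s²+½) ⟩
    2ℚ * (s * s + s * s + ½ * 1ℚ - ½ * 1ℚ)
      ≡⟨ solve 1 (λ s → (con 1ℚ :+ con 1ℚ) :* (s :* s :+ s :* s :+ con ½ :* con 1ℚ :- con ½ :* con 1ℚ)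
           := (con 1ℚ :+ con 1ℚ :+ (con 1ℚ :+ con 1ℚ)) :* (s :* s)) refl s ⟩
    (2ℚ + 2ℚ) * (s * s)
      ≡⟨ cong (_* (s * s)) fromℕ-4 ⟨
    fromℕ 4 * (s * s) ∎
    where
    open ≤-Reasoning
    2ℚ = 1ℚ + 1ℚ
    0≤2 : 0ℚ ≤ 2ℚ
    0≤2 = 0≤+ (<⇒≤ 0<1) (<⇒≤ 0<1)
    l = fromℕ L
    η = 1/suc n
    a = approx√ n (fromℕ (L ℕ.^ 3))
    s = approx√ n a
    0≤η : 0ℚ ≤ η
    0≤η = 0≤1/suc n
    1≤l : 1ℚ ≤ l
    1≤l = ≤-trans (≤-reflexive (sym fromℕ-1)) (fromℕ-mono 1≤L)
    -- The rounding errors η² + η² + η then stay below 1/2 ≤ l/2. Absorbing them doubles the bound 2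
    -- s², whence the factor 4.
    η≤¼ : η ≤ ½ * ½
    η≤¼ = ≤-trans (1/suc-antimono 3≤n) (≤-reflexive (trans
      (solve 1 (λ r → r := con ½ :* con ½ :* ((con 1ℚ :+ con 1ℚ :+ (con 1ℚ :+ con 1ℚ)) :* r)) refl (1/suc 3))
      (trans (cong (λ t → ½ * ½ * (t * 1/suc 3)) (sym fromℕ-4))
        (trans (cong (½ * ½ *_) (1/suc-inverse 3)) (*-identityʳ (½ * ½))))))
    l≤a+η : l ≤ a + η
    l≤a+η = square-cancel-≤ (0≤+ (Approx√.0≤r n (fromℕ (L ℕ.^ 3))) 0≤η) (begin
      l * l                      ≡⟨ fromℕ-* L L ⟨
      fromℕ (L ℕ.* L)            ≤⟨ fromℕ-mono L²≤L³ ⟩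
      fromℕ (L ℕ.^ 3)            ≤⟨ <⇒≤ (Approx√.upper n (fromℕ (L ℕ.^ 3))) ⟩
      (a + η) * (a + η)          ∎)
      where
      L²≤L³ : L ℕ.* L ℕ.≤ L ℕ.^ 3
      L²≤L³ = subst (λ t → L ℕ.* t ℕ.≤ L ℕ.^ 3) (ℕ.*-identityʳ L)
        (ℕ.*-monoʳ-≤ L (ℕ.*-monoʳ-≤ L (ℕ.≤-trans 1≤L (ℕ.≤-reflexive (sym (ℕ.*-identityʳ L))))))
    l≤2s²+½ : l ≤ s * s + s * s + ½ * 1ℚ
    l≤2s²+½ = begin
      l                                       ≤⟨ l≤a+η ⟩
      a + η                                   ≤⟨ +-monoˡ-≤ η (<⇒≤ (Approx√.upper n a)) ⟩
      (s + η) * (s + η) + η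
        ≤⟨ p≤p+q (0≤square (s - η)) ⟩
      (s + η) * (s + η) + η + (s - η) * (s - η)
        ≡⟨ solve 2 (λ s e → (s :+ e) :* (s :+ e) :+ e :+ (s :- e) :* (s :- e)
             := s :* s :+ s :* s :+ (e :* e :+ e :* e :+ e)) refl s η ⟩
      s * s + s * s + (η * η + η * η + η)
        ≤⟨ +-monoʳ-≤ (s * s + s * s) (≤-trans
             (+-mono-≤ (+-mono-≤ (square-mono 0≤η η≤¼) (square-mono 0≤η η≤¼)) η≤¼)
             (from-yes
               (½ * ½ * (½ * ½) + ½ * ½ * (½ * ½) + ½ * ½ ≤? ½ * 1ℚ))) ⟩
      s * s + s * s + ½ * 1ℚ ∎

  -- Squared, the claim needs 4 · 7 = 28 ≤ 36 = 6 · 6. The empty list is separate, since the lower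
  -- bound for the power requires L ≥ 1.
  sum-approx√-≤ : ∀ {A : Set} (g : A → ℚ) xs n {P} → (∀ x → 0ℚ ≤ g x) → 3 ℕ.≤ n → 0ℚ ≤ P →
    sumᴸ (map g xs) ≤ fromℕ 7 * (P * P) →
    sumᴸ (map (λ x → approx√ n (g x)) xs) ≤ fromℕ 6 * seq (length xs ^¾) n * P
  sum-approx√-≤ g [] n {P} 0≤g 3≤n 0≤P h =
    0≤* (0≤* (0≤fromℕ 6) (Approx√.0≤r n (seq (√ (fromℚ (fromℕ 0))) n))) 0≤P
  sum-approx√-≤ g xs@(_ ∷ _) n {P} 0≤g 3≤n 0≤P h =
    square-cancel-≤ (0≤* (0≤* (0≤fromℕ 6) 0≤s) 0≤P) (begin
      r * r                                     ≤⟨ cauchy-schwarz f xs ⟩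
      fromℕ L * sumᴸ (map (λ x → f x * f x) xs)
        ≤⟨ *-mono (0≤fromℕ L) (¾-power-lower L n (s≤s z≤n) 3≤n)
             (0≤* (0≤fromℕ 7) (0≤* 0≤P 0≤P)) (≤-trans (squares xs) h) ⟩
      fromℕ 4 * (s * s) * (fromℕ 7 * (P * P))
        ≡⟨ solve 4 (λ a b s P → a :* (s :* s) :* (b :* (P :* P)) := (a :* b) :* ((s :* P) :* (s :* P)))
             refl (fromℕ 4) (fromℕ 7) s P ⟩
      (fromℕ 4 * fromℕ 7) * ((s * P) * (s * P))
        ≤⟨ *-monoʳ (0≤square (s * P)) (≤-trans (≤-reflexive (sym (fromℕ-* 4 7)))
             (≤-trans (fromℕ-mono (ℕ.m≤m+n 28 8)) (≤-reflexive (fromℕ-* 6 6)))) ⟩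
      (fromℕ 6 * fromℕ 6) * ((s * P) * (s * P))
        ≡⟨ solve 3 (λ a s P → (a :* a) :* ((s :* P) :* (s :* P)) := (a :* s :* P) :* (a :* s :* P))
             refl (fromℕ 6) s P ⟩
      (fromℕ 6 * s * P) * (fromℕ 6 * s * P)     ∎)
    where
    open ≤-Reasoning
    L = length xs
    s = seq (L ^¾) n
    0≤s : 0ℚ ≤ s
    0≤s = Approx√.0≤r n (seq (√ (fromℚ (fromℕ (L ℕ.^ 3)))) n)
    f = λ x → approx√ n (g x)
    r = sumᴸ (map f xs)
    squares : ∀ xs → sumᴸ (map (λ x → f x * f x) xs) ≤ sumᴸ (map g xs)
    squares []       = ≤-refl
    squares (x ∷ xs) = +-mono-≤ (approx√²≤ n (0≤g x)) (squares xs)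

-- Evaluating sums of sequences at a fixed index.

module Componentwise where

  open GaussianRationals
  open BoundedSequences
  open Inequalities
  open CommutativeRing sequenceRing using () renaming (semiring to sequenceSemiring)
  open import Algebra.Properties.Semiring.Mult sequenceSemiring using () renaming (_×_ to _·ˢ_) public
  open import Algebra.Properties.Semiring.Sum sequenceSemiring using () renaming (sum to sumˢ) public
  open import Algebra.Properties.Semiring.Mult ℚi.semiring using () renaming (_×_ to _·ᵍ_) public
  open import Algebra.Properties.Semiring.Sum ℚi.semiring using ()
    renaming (sum to sumᵍ; sum-cong-≗ to sumᵍ-cong) public
  open import Data.Fin.Base using (Fin; zero; suc; toℕ)
  open import Data.List.Base using (List; []; _∷_; foldr; map; filter; applyUpTo)
  open import Data.Nat.Base using (suc)
  open import Data.Rational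
  open import Data.Rational.Properties
  open import Data.Rational.Solver using (module +-*-Solver)
  open import Function.Base using (_∘_)
  open import Relation.Binary.PropositionalEquality
  open import Relation.Nullary using (Dec; yes; no)
  open Counting using (indicator)
  open +-*-Solver using (solve; _:=_; _:+_; _:*_; con)

  at-·ˢ : ∀ k u n → at (k ·ˢ u) n ≡ k ·ᵍ at u n
  at-·ˢ 0       u n = refl
  at-·ˢ (suc k) u n = trans (at-+ˢ u (k ·ˢ u) n) (cong (at u n ⊕_) (at-·ˢ k u n))

  at-sumˢ : ∀ {m} (f : Fin m → Sequence) n → at (sumˢ f) n ≡ sumᵍ (λ i → at (f i) n)
  at-sumˢ {0}     f n = refl
  at-sumˢ {suc m} f n = trans (at-+ˢ (f zero) (sumˢ (f ∘ suc)) n)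
    (cong (at (f zero) n ⊕_) (at-sumˢ (f ∘ suc) n))

  conj-·ᵍ : ∀ k u → conj (k ·ᵍ u) ≡ k ·ᵍ conj u
  conj-·ᵍ 0       u = refl
  conj-·ᵍ (suc k) u = trans (conj-⊕ u (k ·ᵍ u)) (cong (conj u ⊕_) (conj-·ᵍ k u))

  conj-sumᵍ : ∀ {m} (f : Fin m → ℚ[i]) → conj (sumᵍ f) ≡ sumᵍ (conj ∘ f)
  conj-sumᵍ {0}     f = refl
  conj-sumᵍ {suc m} f = trans (conj-⊕ (f zero) (sumᵍ (f ∘ suc))) (cong (conj (f zero) ⊕_) (conj-sumᵍ (f ∘ suc)))

  re-⊕ : ∀ u v → reℚ (u ⊕ v) ≡ reℚ u + reℚ v
  re-⊕ (a +i b) (c +i d) = refl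

  re-·ᵍ : ∀ k u → reℚ (k ·ᵍ u) ≡ fromℕ k * reℚ u
  re-·ᵍ 0       u = sym (trans (cong (_* reℚ u) fromℕ-0) (*-zeroˡ (reℚ u)))
  re-·ᵍ (suc k) u = trans (re-⊕ u (k ·ᵍ u)) (trans (cong (λ t → reℚ u + t) (re-·ᵍ k u))
    (trans (solve 2 (λ a k → a :+ k :* a := (k :+ con 1ℚ) :* a) refl (reℚ u) (fromℕ k))
      (cong (_* reℚ u) (sym (fromℕ-suc k)))))

  re-sumᵍ : ∀ {m} (f : Fin m → ℚ[i]) → reℚ (sumᵍ f) ≡ sumℚ (reℚ ∘ f)
  re-sumᵍ {0}     f = refl
  re-sumᵍ {suc m} f = trans (re-⊕ (f zero) (sumᵍ (f ∘ suc))) (cong (λ t → reℚ (f zero) + t) (re-sumᵍ (f ∘ suc)))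

  nth : ℂ → ℕ → ℚ[i]
  nth z n = seq (re z) n +i seq (im z) n

  sumᴸᵍ : List ℚ[i] → ℚ[i]
  sumᴸᵍ = foldr _⊕_ 0ᵍ

  nth-sum : ∀ (F : ℕ → ℂ) n ms →
    nth (foldr _+ᶜ_ 0ᶜ (map F ms)) n ≡ sumᴸᵍ (map (λ m → nth (F m) n) ms)
  nth-sum F n []       = refl
  nth-sum F n (m ∷ ms) = cong (nth (F m) n ⊕_) (nth-sum F n ms)

  sum-filter : ∀ {P : ℕ → Set} (P? : ∀ m → Dec (P m)) (f : ℕ → ℚ[i]) (g : ℕ → ℕ) k →
    sumᴸᵍ (map f (filter P? (applyUpTo g k)))
      ≡ sumᵍ {k} (λ i → indicator (P? (g (toℕ i))) ·ᵍ f (g (toℕ i)))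
  sum-filter P? f g 0       = refl
  sum-filter P? f g (suc k) with P? (g 0)
  ... | yes _ = cong₂ _⊕_ (sym (ℚi.+-identityʳ (f (g 0)))) (sum-filter P? f (g ∘ suc) k)
  ... | no _  = trans (sum-filter P? f (g ∘ suc) k)
    (sym (ℚi.+-identityˡ (sumᵍ {k} (λ i → indicator (P? (g (suc (toℕ i)))) ·ᵍ f (g (suc (toℕ i)))))))

-- The n-th approximation to S in terms of the character.

module ExponentialSums where

  open BoundedSequences
  open Componentwise
  open UnitCircle using (χ; at-circle)
  open import Data.Integer.Base using (+_; _+_; _*_)
  open import Data.Integer.Divisibility.Signed using (_∣?_)
  open import Data.List.Base using (map; filter)
  open import Data.List.Properties using (map-cong)
  open import Data.Nat.Base using (NonZero)
  open import Data.Rational using (_/_)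
  open import Relation.Binary.PropositionalEquality
  open import Relation.Nullary.Decidable using (¬?)

  nth-e : ∀ p .{{_ : NonZero p}} t n → nth (e p t) n ≡ at (χ p t) n
  nth-e p t n = sym (at-circle (t / p) n)

  nth-S : ∀ x y w p .{{_ : NonZero p}} n → nth (S x y w p) n
    ≡ sumᴸᵍ (map (λ m → at (χ p (x * + inverse p (+ m) + y * + inverse p (+ m + w))) n)
        (filter (λ m → ¬? (+ p ∣? (+ m + w))) (units p)))
  nth-S x y w p n = trans
    (nth-sum (λ m → e p (x * + inverse p (+ m) + y * + inverse p (+ m + w))) n
      (filter (λ m → ¬? (+ p ∣? (+ m + w))) (units p)))
    (cong sumᴸᵍ (map-cong
      (λ m → nth-e p (x * + inverse p (+ m) + y * + inverse p (+ m + w)) n)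
      (filter (λ m → ¬? (+ p ∣? (+ m + w))) (units p))))

-- From the second moment to the bound for S.

module SecondMomentBound (p : ℕ) (p-prime : Prime p) where

  open Congruences
  open GaussianRationals
  open BoundedSequences
  open Componentwise
  open ExponentialSums
  open Counting using (indicator) renaming (sum to sumℕ)
  open Inequalities
  open Residues p p-prime
  open UnitCircle
  open import Data.Empty using (⊥-elim)
  open import Data.Fin.Base using (Fin; toℕ)
  open import Data.Fin.Properties using (toℕ<n)
  open import Data.Integer.Base as ℤ using (ℤ; +_; 0ℤ; 1ℤ)
  import Data.Integer.Properties as ℤ
  open import Data.Integer.Divisibility.Signed using (_∣_; divides; _∣?_)
  open import Data.List.Base using (List; []; _∷_; applyUpTo; filter; length; map)
  open import Data.List.Relation.Unary.AllPairs as AllPairs using (AllPairs)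
  import Data.List.Relation.Unary.AllPairs.Properties as AllPairs
  open import Data.Nat.Base as ℕ using (suc; s≤s; z≤n)
  open import Data.Nat.Primality using (prime⇒nonTrivial)
  import Data.Nat.Properties as ℕ
  open import Data.Product.Base using (_,_; proj₁; proj₂)
  open import Data.Rational
  open import Data.Rational.Properties
  open import Relation.Binary.PropositionalEquality
  open import Relation.Nullary using (Dec; yes; no)
  open import Relation.Nullary.Decidable using (¬?)
  open ℕSolver using () renaming (_:=_ to _≐_; _:+_ to _⊞_; _:*_ to _⊛_)

  2≤p : 2 ℕ.≤ p
  2≤p = ℕ.nonTrivial⇒n>1 p {{prime⇒nonTrivial p-prime}}

  indicator-cong : ∀ {P Q : Set} (d : Dec P) (e : Dec Q) → (P → Q) → (Q → P) →
    indicator d ≡ indicator e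
  indicator-cong (yes _) (yes _) _ _ = refl
  indicator-cong (no _)  (no _)  _ _ = refl
  indicator-cong (yes a) (no ¬b) f _ = ⊥-elim (¬b (f a))
  indicator-cong (no ¬a) (yes b) _ g = ⊥-elim (¬a (g b))

  module _ (x y : ℤ) (p∤y : ¬ + p ∣ y) where

    open Collisions p p-prime x y p∤y
    open CharacterSums.SecondMoment sequenceRing p p-prime x y p∤y (χ p) (χ-isCharacter p 2≤p)

    value : ℕ → ℤ → ℤ → ℚ[i]
    value n t w = at (corr t w) n

    value-sum : ∀ n t w →
      value n t w ≡ sumᵍ (λ m → indicator (good? w (ι m)) ·ᵍ at (χ p (t ℤ.* phase w (ι m))) n)
    value-sum n t w = trans (at-sumˢ (λ m → term t w (ι m)) n)
      (sumᵍ-cong (λ m → at-·ˢ (indicator (good? w (ι m))) (χ p (t ℤ.* phase w (ι m))) n))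

    value-neg : ∀ n t w → value n (ℤ.- t) w ≡ conj (value n t w)
    value-neg n t w = begin
      value n (ℤ.- t) w    ≡⟨ value-sum n (ℤ.- t) w ⟩
      sumᵍ (λ m → g m ·ᵍ at (χ p (ℤ.- t ℤ.* phase w (ι m))) n)
        ≡⟨ sumᵍ-cong (λ m → trans (cong (g m ·ᵍ_) (trans
             (cong (λ a → at (χ p a) n) (sym (ℤ.neg-distribˡ-* t (phase w (ι m)))))
             (χ-neg p (t ℤ.* phase w (ι m)) n)))
             (sym (conj-·ᵍ (g m) (at (χ p (t ℤ.* phase w (ι m))) n)))) ⟩
      sumᵍ (λ m → conj (g m ·ᵍ at (χ p (t ℤ.* phase w (ι m))) n))
        ≡⟨ conj-sumᵍ (λ m → g m ·ᵍ at (χ p (t ℤ.* phase w (ι m))) n) ⟨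
      conj (sumᵍ (λ m → g m ·ᵍ at (χ p (t ℤ.* phase w (ι m))) n))
        ≡⟨ cong conj (value-sum n t w) ⟨
      conj (value n t w)   ∎
      where
      open ≡-Reasoning
      g : Fin p → ℕ
      g m = indicator (good? w (ι m))

    -- An equality at each index, stronger than `corr-cong`, so that the elements of W can be
    -- replaced by residues before any limit. It rests on `inverse` being constant on residue
    -- classes.
    value-cong : ∀ n t {w w′} → w ≋ w′ → value n t w ≡ value n t w′
    value-cong n t {w} {w′} w≋w′ = trans (value-sum n t w) (trans
      (sumᵍ-cong (λ m → cong₂ (λ k a → k ·ᵍ at (χ p (t ℤ.* a)) n)
        (indicator-cong (good? w (ι m)) (good? w′ (ι m))
          (Good-resp-≋ w≋w′ ≋-refl) (Good-resp-≋ (≋-sym w≋w′) ≋-refl))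
        (cong (λ k → x ℤ.* inv (ι m) ℤ.+ y ℤ.* (+ k)) (inverse-cong (+-≋ (≋-refl {ι m}) w≋w′)))))
      (sym (value-sum n t w′)))

    energy : ℕ → ℤ → ℚ
    energy n t = sumℚ (λ w → normSq (value n t (ι w)))

    re-moment : ∀ n t → reℚ (at (moment t) n) ≡ energy n t
    re-moment n t = trans
      (cong reℚ (at-sumˢ (λ w → corr t (ι w) *ˢ corr (ℤ.- t) (ι w)) n))
      (trans (re-sumᵍ (λ w → at (corr t (ι w) *ˢ corr (ℤ.- t) (ι w)) n))
        (sumℚ-cong (λ w → cong reℚ (trans (at-*ˢ (corr t (ι w)) (corr (ℤ.- t) (ι w)) n)
          (trans (cong (value n t (ι w) ⊗_) (value-neg n t (ι w)))
            (normSq-as-conj (value n t (ι w))))))))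

    0≤energy : ∀ n t → 0ℚ ≤ energy n t
    0≤energy n t = 0≤sumℚ _ (λ w → 0≤normSq (value n t (ι w)))

    K : ℕ
    K = sumℕ (λ w → collisions (ι w))

    -- The tolerance 1 accounts for an identity that holds modulo null sequences only. Real parts
    -- turn it into an inequality in ℚ, and the energy at t = 0 is dropped as nonnegative.
    energy-equation : ∀ n → ‖ at (moment 0ℤ +ˢ (ℕ.pred p ·ˢ moment 1ℤ)) n
        ⊖ at (K ·ˢ (p ·ˢ constant 1ᵍ)) n ‖ ≤ 1ℚ →
      fromℕ (ℕ.pred p) * energy n 1ℤ ≤ fromℕ K * fromℕ p + 1ℚ
    energy-equation n h = begin
      fromℕ (ℕ.pred p) * energy n 1ℤ
        ≤⟨ p≤q+p (0≤energy n 0ℤ) ⟩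
      energy n 0ℤ + fromℕ (ℕ.pred p) * energy n 1ℤ
        ≡⟨ cong₂ (λ s t → s + fromℕ (ℕ.pred p) * t) (re-moment n 0ℤ) (re-moment n 1ℤ) ⟨
      reℚ (at (moment 0ℤ) n) + fromℕ (ℕ.pred p) * reℚ (at (moment 1ℤ) n)
        ≡⟨ cong (λ t → reℚ (at (moment 0ℤ) n) + t) (trans (cong reℚ (at-·ˢ (ℕ.pred p) (moment 1ℤ) n))
             (re-·ᵍ (ℕ.pred p) (at (moment 1ℤ) n))) ⟨
      reℚ (at (moment 0ℤ) n) + reℚ (at (ℕ.pred p ·ˢ moment 1ℤ) n)
        ≡⟨ trans (cong reℚ (at-+ˢ (moment 0ℤ) (ℕ.pred p ·ˢ moment 1ℤ) n))
             (re-⊕ (at (moment 0ℤ) n) (at (ℕ.pred p ·ˢ moment 1ℤ) n)) ⟨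
      reℚ lhs
        ≤⟨ ∣∣≤⇒≤ (≤-trans (∣re∣≤‖ lhs ⊖ rhs ‖) h) ⟩
      reℚ rhs + 1ℚ
        ≡⟨ cong (_+ 1ℚ) (trans (cong reℚ (at-·ˢ K (p ·ˢ constant 1ᵍ) n))
             (trans (re-·ᵍ K (at (p ·ˢ constant 1ᵍ) n)) (cong (fromℕ K *_)
               (trans (cong reℚ (at-·ˢ p (constant 1ᵍ) n)) (trans (re-·ᵍ p 1ᵍ) (*-identityʳ (fromℕ p))))))) ⟩
      fromℕ K * fromℕ p + 1ℚ ∎
      where
      open ≤-Reasoning
      lhs = at (moment 0ℤ +ˢ (ℕ.pred p ·ˢ moment 1ℤ)) n
      rhs = at (K ·ˢ (p ·ˢ constant 1ᵍ)) n

    -- With p ≤ 2 (p - 1), the main term 3p³ is at most 6p² (p - 1); the tolerance 1 is at most p²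
    -- (p - 1). Together they give the 7.
    energy-≤ : Eventually (λ n → energy n 1ℤ ≤ fromℕ 7 * (fromℕ p * fromℕ p))
    energy-≤ = eventually-map (λ {n} h → cancel n (energy-equation n h)) (close second-moment 1ℚ 0<1)
      where
      q = ℕ.pred p
      1≤q : 1 ℕ.≤ q
      1≤q = ℕ.<⇒≤pred 2≤p
      p≤2q : p ℕ.≤ 2 ℕ.* q
      p≤2q = go p 2≤p
        where
        go : ∀ p → 2 ℕ.≤ p → p ℕ.≤ 2 ℕ.* ℕ.pred p
        go (suc (suc k)) _ = subst (2 ℕ.+ k ℕ.≤_) (sym (ℕ.*-distribˡ-+ 2 1 k)) (ℕ.+-monoʳ-≤ 2 (ℕ.m≤m+n k (k ℕ.+ 0)))
        go 1 (s≤s ())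
      bound : K ℕ.* p ℕ.+ 1 ℕ.≤ q ℕ.* (7 ℕ.* (p ℕ.* p))
      bound = begin
        K ℕ.* p ℕ.+ 1
          ≤⟨ ℕ.+-mono-≤ (ℕ.*-mono-≤ total-collisions-≤ p≤2q)
                 (ℕ.*-mono-≤ 1≤q (ℕ.*-mono-≤ 1≤p 1≤p)) ⟩
        3 ℕ.* (p ℕ.* p) ℕ.* (2 ℕ.* q) ℕ.+ q ℕ.* (p ℕ.* p)
          ≡⟨ ℕSolver.solve 2 (λ p q → ℕSolver.con 3 ⊛ (p ⊛ p) ⊛ (ℕSolver.con 2 ⊛ q)
               ⊞ q ⊛ (p ⊛ p) ≐ q ⊛ (ℕSolver.con 7 ⊛ (p ⊛ p))) refl p q ⟩
        q ℕ.* (7 ℕ.* (p ℕ.* p)) ∎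
        where
        open ℕ.≤-Reasoning
        1≤p : 1 ℕ.≤ p
        1≤p = ℕ.≤-trans (s≤s z≤n) 2≤p
      0<q : 0ℚ < fromℕ q
      0<q = <-≤-trans 0<1 (≤-trans (≤-reflexive (sym fromℕ-1)) (fromℕ-mono 1≤q))
      cancel : ∀ n → fromℕ q * energy n 1ℤ ≤ fromℕ K * fromℕ p + 1ℚ →
        energy n 1ℤ ≤ fromℕ 7 * (fromℕ p * fromℕ p)
      cancel n h = let open ≤-Reasoning in *-cancelˡ-≤-pos (fromℕ q) {{positive 0<q}} (begin
        fromℕ q * energy n 1ℤ            ≤⟨ h ⟩
        fromℕ K * fromℕ p + 1ℚ           ≡⟨ cong₂ _+_ (fromℕ-* K p) fromℕ-1 ⟨
        fromℕ (K ℕ.* p) + fromℕ 1        ≡⟨ fromℕ-+ (K ℕ.* p) 1 ⟨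
        fromℕ (K ℕ.* p ℕ.+ 1)            ≤⟨ fromℕ-mono bound ⟩
        fromℕ (q ℕ.* (7 ℕ.* (p ℕ.* p)))
          ≡⟨ trans (fromℕ-* q (7 ℕ.* (p ℕ.* p))) (cong (fromℕ q *_)
               (trans (fromℕ-* 7 (p ℕ.* p)) (cong (fromℕ 7 *_) (fromℕ-* p p)))) ⟩
        fromℕ q * (fromℕ 7 * (fromℕ p * fromℕ p)) ∎)

    invertible? : ∀ w m → Dec (¬ + p ∣ (+ m ℤ.+ w))
    invertible? w m = ¬? (+ p ∣? (+ m ℤ.+ w))

    -- Reconciles the range 1, ..., p - 1 of S with the range 0, ..., p - 1 of `corr`: the added
    -- index 0 has weight 0.
    sum-pred : ∀ q {P : ℕ → Set} (P? : ∀ m → Dec (P m)) (f : ℕ → ℚ[i]) (k : ℕ → ℕ) → ¬ P 0 →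
      (∀ i → suc i ℕ.< q → k i ≡ indicator (P? (suc i))) →
      sumᵍ {ℕ.pred q} (λ i → k (toℕ i) ·ᵍ f (suc (toℕ i))) ≡ sumᵍ {q} (λ i → indicator (P? (toℕ i)) ·ᵍ f (toℕ i))
    sum-pred 0       P? f k ¬P0 h = refl
    sum-pred (suc q) P? f k ¬P0 h with P? 0
    ... | yes P0 = ⊥-elim (¬P0 P0)
    ... | no _   = trans
      (sumᵍ-cong (λ i → cong (_·ᵍ f (suc (toℕ i))) (h (toℕ i) (s≤s (toℕ<n i)))))
      (sym (ℚi.+-identityˡ (sumᵍ {q} (λ i → indicator (P? (suc (toℕ i))) ·ᵍ f (suc (toℕ i))))))

    nth-S≡value : ∀ w n → nth (S x y w p {{prime⇒nonZero p-prime}}) n ≡ value n 1ℤ w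
    nth-S≡value w n = begin
      nth (S x y w p {{prime⇒nonZero p-prime}}) n
        ≡⟨ nth-S x y w p {{prime⇒nonZero p-prime}} n ⟩
      sumᴸᵍ (map f (filter (invertible? w) (applyUpTo suc (ℕ.pred p))))
        ≡⟨ sum-filter (invertible? w) f suc (ℕ.pred p) ⟩
      sumᵍ {ℕ.pred p} (λ i → indicator (invertible? w (suc (toℕ i))) ·ᵍ f (suc (toℕ i)))
        ≡⟨ sum-pred p (λ m → good? w (+ m)) f (λ i → indicator (invertible? w (suc i)))
             (λ { (p∤0 , _) → p∤0 (divides 0ℤ refl) })
             (λ i i<p → indicator-cong (invertible? w (suc i)) (good? w (+ suc i))
               (λ h → (λ p∣i → ℕ.1+n≢0 (<∧∣⇒≡0 i<p p∣i)) , h) proj₂) ⟩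
      sumᵍ {p} (λ i → indicator (good? w (ι i)) ·ᵍ f (toℕ i))
        ≡⟨ sumᵍ-cong (λ m → cong (λ a → indicator (good? w (ι m)) ·ᵍ at (χ p a) n)
             (sym (ℤ.*-identityˡ (phase w (ι m))))) ⟩
      sumᵍ {p} (λ m → indicator (good? w (ι m)) ·ᵍ at (χ p (1ℤ ℤ.* phase w (ι m))) n)
        ≡⟨ value-sum n 1ℤ w ⟨
      value n 1ℤ w ∎
      where
      open ≡-Reasoning
      f : ℕ → ℚ[i]
      f m = at (χ p (phase w (+ m))) n

    -- Incongruent shifts have distinct residues, so by nonnegativity the sum over W extends to all
    -- residue classes.
    sum-normSq-≤ : ∀ n {W} → AllPairs (λ u v → ¬ (+ p ∣ u ℤ.- v)) W →
      sumᴸ (map (λ w → normSq (nth (S x y w p {{prime⇒nonZero p-prime}}) n)) W) ≤ energy n 1ℤ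
    sum-normSq-≤ n {W} distinct = ≤-trans (≤-reflexive (reindex W))
      (sumᴸ≤sumℚ (λ i → normSq (value n 1ℤ (ι i))) (λ i → 0≤normSq (value n 1ℤ (ι i)))
        (AllPairs.map⁺ (AllPairs.map (λ {u} {v} → separate {u} {v}) distinct)))
      where
      separate : ∀ {u v} → ¬ (+ p ∣ u ℤ.- v) → residue u ≢ residue v
      separate {u} {v} u≢v e = u≢v (∣-difference (≋-trans (≋-sym (ι-residue u))
        (≋-trans (≋-reflexive (cong ι e)) (ι-residue v))))
      reindex : ∀ W → sumᴸ (map (λ w → normSq (nth (S x y w p {{prime⇒nonZero p-prime}}) n)) W)
        ≡ sumᴸ (map (λ i → normSq (value n 1ℤ (ι i))) (map residue W))
      reindex []      = refl
      reindex (w ∷ W) = cong₂ _+_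
        (cong normSq (trans (nth-S≡value w n) (value-cong n 1ℤ (≋-sym (ι-residue w))))) (reindex W)

    seq-sumʳ-modulus : ∀ n W → seq (sumʳ (map (λ w → modulus (S x y w p {{prime⇒nonZero p-prime}})) W)) n
      ≡ sumᴸ (map (λ w → approx√ n (normSq (nth (S x y w p {{prime⇒nonZero p-prime}}) n))) W)
    seq-sumʳ-modulus n []      = refl
    seq-sumʳ-modulus n (w ∷ W) = cong (λ t → approx√ n (normSq (nth (S x y w p {{prime⇒nonZero p-prime}}) n)) + t) (seq-sumʳ-modulus n W)

    sum-modulus-≤ : ∀ W → AllPairs (λ u v → ¬ (+ p ∣ u ℤ.- v)) W →
      sumʳ (map (λ w → modulus (S x y w p {{prime⇒nonZero p-prime}})) W)
        ≤ʳ fromℚ (fromℕ 6) *ʳ length W ^¾ *ʳ fromℚ (fromℕ p)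
    -- The 3 is the index from which the approximation to the power of #W is accurate enough.
    sum-modulus-≤ W distinct ε 0<ε = 3 ℕ.⊔ proj₁ energy-≤ , λ n N≤n → begin
      seq (sumʳ (map (λ w → modulus (S x y w p {{prime⇒nonZero p-prime}})) W)) n      ≡⟨ seq-sumʳ-modulus n W ⟩
      sumᴸ (map (λ w → approx√ n (normSq (nth (S x y w p {{prime⇒nonZero p-prime}}) n))) W)
        ≤⟨ sum-approx√-≤ (λ w → normSq (nth (S x y w p {{prime⇒nonZero p-prime}}) n)) W n
             (λ w → 0≤normSq (nth (S x y w p {{prime⇒nonZero p-prime}}) n))
             (ℕ.m⊔n≤o⇒m≤o 3 (proj₁ energy-≤) N≤n) (0≤fromℕ p)
             (≤-trans (sum-normSq-≤ n distinct)
               (proj₂ energy-≤ n (ℕ.m⊔n≤o⇒n≤o 3 (proj₁ energy-≤) N≤n))) ⟩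
      fromℕ 6 * seq (length W ^¾) n * fromℕ p
        ≤⟨ p≤p+q (<⇒≤ 0<ε) ⟩
      fromℕ 6 * seq (length W ^¾) n * fromℕ p + ε ∎
      where open ≤-Reasoning

open import Data.Integer.Base using (ℤ; +_; _-_)
open import Data.Integer.Divisibility.Signed using (_∣_)
open import Data.List.Base using (List; length; map)
open import Data.List.Relation.Unary.AllPairs using (AllPairs)
open import Data.Product.Base using (_,_)
open import Data.Rational.Properties using (≤-reflexive; +-identityˡ)

0<6 : 0ʳ <ʳ fromℚ (fromℕ 6)
0<6 = fromℕ 6 , 0<fromℕ-suc 5 , 0 , λ _ _ → ≤-reflexive (+-identityˡ (fromℕ 6))

proposition4p2 : ∃[ C ] (0ʳ <ʳ C ×
    ((p : ℕ) (p-prime : Prime p) (x y : ℤ) → ¬ (+ p ∣ y) →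
    (W : List ℤ) → AllPairs (λ u v → ¬ (+ p ∣ u - v)) W →
    sumʳ (map (λ w → modulus (S x y w p {{prime⇒nonZero p-prime}})) W)
    ≤ʳ C *ʳ length W ^¾ *ʳ fromℚ (fromℕ p)))
proposition4p2 = fromℚ (fromℕ 6) , 0<6 , λ p p-prime x y p∤y →
  SecondMomentBound.sum-modulus-≤ p p-prime x y p∤y
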